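{- Let $a\colon\mathbb{N}\to\mathbb{Z}_{\ge0}$ and $b\colon\mathbb{N}\to\mathbb{C}$ be two $s$-functions such that $a(n)\ge1$ for every $n\in\mathbb{N}$ that is not squarefree, and let $c\colon\mathbb{N}\to\mathbb{C}$ be a bounded arithmetic function of invariant average $A$ under multiplications. Then $$\lim_{N\to\infty}\frac1N\sum_{\substack{1\le n\le N\\ (n,a(n))=1}}b(n)c(n)=\rho\cdot A,$$ where $$\rho=\frac6{\pi^2}\sum_{d=1}^\infty\frac{\mu(d)}{\sigma(d)}\sum_{\substack{f>1_{a(1)=0}\\ f\in\mathscr{F}\\ d\mid a(f)}}\frac{(d,f)\,b(f)}{\sigma_f}\prod_{p\mid(d,f)}\Big(1+\frac1p\Big).$$
   Context: $\mathbb{N}=\{1,2,3,\dots\}$; $(m,n)$ denotes the gcd, with $(n,0)=n$. $\mathscr{F}$ is the set of squarefull positive integers ($n$ is squarefull if $p^2\mid n$ for every prime $p\mid n$; $1\in\mathscr{F}$). Every $n\ge1$ is uniquely $n=qf$ with $q$ squarefree, $f\in\mathscr{F}$, $\gcd(q,f)=1$; $f=f(n)$ is the squarefull part of $n$. A function $a\colon\mathbb{N}\to\mathbb{C}$ is an $s$-function if $a(n)=a(f(n))$ for all $n\ge1$ and, for every $\varepsilon>0$, $a(n)\ll_\varepsilon n^\varepsilon$. A bounded function $c\colon\mathbb{N}\to\mathbb{C}$ is of invariant average $A$ under multiplications if $\lim_{N\to\infty}\frac1N\sum_{n=1}^N c(n)$ exists and equals $A$, and for every $d\in\mathbb{N}$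 the limit $\lim_{N\to\infty}\frac1N\sum_{n=1}^N c(dn)$ exists and equals $A$. $\mu$ is the Möbius function, $\sigma(n)=\sum_{d\mid n}d$, and $\sigma_f=f\prod_{p\mid f}(1+\frac1p)$. The symbol $1_{a(1)=0}$ equals $1$ if $a(1)=0$ and $0$ otherwise, so the inner sum runs over $f>1$ if $a(1)=0$ and over $f\ge1$ if $a(1)\ne0$. -}

module Defs where

open import Data.Bool using (if_then_else_)
open import Data.Integer using (+_; -[1+_]; +≤+)
open import Data.List using (List; filter; upTo; length; foldr)
open import Data.List.Membership.Propositional.Properties using (∈-filter⁺; ∈-filter⁻; ∈-upTo⁺)
open import Data.List.Relation.Unary.All as All using (All; all?)
open import Data.Nat using (ℕ; zero; suc; _+_; _*_; _^_; _≤_; _<_; _⊔_; s≤s; z≤n; NonZero; _≟_; _<?_)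
import Data.Nat.Properties as ℕₚ
open import Data.Nat.Coprimality using (Coprime)
open import Data.Nat.Divisibility using (_∣_; _∣?_; divides; ∣⇒≤; ∣-trans; m∣m*n)
open import Data.Nat.GCD using (gcd)
open import Data.Nat.ListAction using (sum)
open import Data.Nat.Primality using (Prime; prime?; prime[2])
open import Data.Product using (∃-syntax; _×_; _,_; proj₂)
open import Data.Rational as ℚ using (ℚ; 0ℚ; 1ℚ)
import Data.Rational.Properties as ℚₚ
open import Data.Rational.Solver using (module +-*-Solver)
open import Data.Rational.Unnormalised as ℚᵘ using (mkℚᵘ)
import Data.Rational.Unnormalised.Properties as ℚᵘₚ
open import Data.Sum using (inj₁; inj₂)
open import Relation.Binary.PropositionalEquality
  using (_≡_; _≢_; refl; sym; trans; cong; cong₂; subst; subst₂)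
open import Relation.Nullary using (Dec; yes; no; ¬_; does; contradiction)
open import Relation.Nullary.Decidable using (map′; _×-dec_; ¬?)

------------------------------------------------------------------------
-- Rationals

ℕ→ℚ : ℕ → ℚ
ℕ→ℚ n = + n ℚ./ 1

infixr 8 _^ℚ_
_^ℚ_ : ℚ → ℕ → ℚ
q ^ℚ zero  = 1ℚ
q ^ℚ suc k = q ℚ.* q ^ℚ k

-- Reciprocal made total by inv 0 = 0; everything below that has to mean
-- a quotient applies it to a nonzero argument only.
inv : ℚ → ℚ
inv q with q ℚₚ.≟ 0ℚ
... | yes _   = 0ℚ
... | no  q≢0 = ℚ.1/_ q {{ℚ.≢-nonZero q≢0}}

private
  open ℚₚ.≤-Reasoning

  inv-inverseʳ : ∀ q → q ≢ 0ℚ → q ℚ.* inv q ≡ 1ℚ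
  inv-inverseʳ q q≢0 with q ℚₚ.≟ 0ℚ
  ... | yes q≡0 = contradiction q≡0 q≢0
  ... | no  q≢  = ℚₚ.*-inverseʳ q {{ℚ.≢-nonZero q≢}}

  pos⇒≢0 : ∀ {q} → 0ℚ ℚ.< q → q ≢ 0ℚ
  pos⇒≢0 0<q refl = ℚₚ.<-irrefl refl 0<q

  *-pos : ∀ {p q} → 0ℚ ℚ.< p → 0ℚ ℚ.< q → 0ℚ ℚ.< p ℚ.* q
  *-pos {p} {q} 0<p 0<q =
    ℚₚ.positive⁻¹ (p ℚ.* q) {{ℚₚ.pos*pos⇒pos p {{ℚ.positive 0<p}} q {{ℚ.positive 0<q}}}}

  *-nonNeg : ∀ {p q} → 0ℚ ℚ.≤ p → 0ℚ ℚ.≤ q → 0ℚ ℚ.≤ p ℚ.* q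
  *-nonNeg {p} {q} 0≤p 0≤q =
    ℚₚ.nonNegative⁻¹ (p ℚ.* q)
      {{ℚₚ.nonNeg*nonNeg⇒nonNeg p {{ℚ.nonNegative 0≤p}} q {{ℚ.nonNegative 0≤q}}}}

  *-mono : ∀ {p q r s} → 0ℚ ℚ.≤ r → 0ℚ ℚ.≤ q → p ℚ.≤ q → r ℚ.≤ s → p ℚ.* r ℚ.≤ q ℚ.* s
  *-mono {p} {q} {r} {s} 0≤r 0≤q p≤q r≤s =
    ℚₚ.≤-trans (ℚₚ.*-monoʳ-≤-nonNeg r {{ℚ.nonNegative 0≤r}} p≤q)
               (ℚₚ.*-monoˡ-≤-nonNeg q {{ℚ.nonNegative 0≤q}} r≤s)

  inv-pos : ∀ {q} → 0ℚ ℚ.< q → 0ℚ ℚ.< inv q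
  inv-pos {q} 0<q with q ℚₚ.≟ 0ℚ
  ... | yes q≡0 = contradiction q≡0 (pos⇒≢0 0<q)
  ... | no  q≢  = ℚₚ.positive⁻¹ _ {{ℚₚ.1/pos⇒pos q {{ℚ.positive 0<q}}}}

  ∣-∣≤ : ∀ {p q} → p ℚ.≤ q → ℚ.- p ℚ.≤ q → ℚ.∣ p ∣ ℚ.≤ q
  ∣-∣≤ {p} {q} a b with ℚₚ.∣p∣≡p∨∣p∣≡-p p
  ... | inj₁ e = subst (ℚ._≤ q) (sym e) a
  ... | inj₂ e = subst (ℚ._≤ q) (sym e) b

  p-q≤p : ∀ p {q} → 0ℚ ℚ.≤ q → p ℚ.- q ℚ.≤ p
  p-q≤p p {q} 0≤q =
    subst (p ℚ.- q ℚ.≤_) (ℚₚ.+-identityʳ p) (ℚₚ.+-monoʳ-≤ p (ℚₚ.neg-antimono-≤ 0≤q))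

  0≤q-p : ∀ {p q} → p ℚ.≤ q → 0ℚ ℚ.≤ q ℚ.- p
  0≤q-p {p} {q} p≤q = subst (ℚ._≤ q ℚ.- p) (ℚₚ.+-inverseʳ p) (ℚₚ.+-monoˡ-≤ (ℚ.- p) p≤q)

  *-distribˡ-- : ∀ p q r → p ℚ.* (q ℚ.- r) ≡ p ℚ.* q ℚ.- p ℚ.* r
  *-distribˡ-- p q r = trans (ℚₚ.*-distribˡ-+ p q (ℚ.- r))
                         (cong (p ℚ.* q ℚ.+_) (sym (ℚₚ.neg-distribʳ-* p r)))

  telescope : ∀ p q r → p ℚ.- r ≡ (p ℚ.- q) ℚ.+ (q ℚ.- r)
  telescope = solve 3 (λ p q r → p :- r := (p :- q) :+ (q :- r)) refl
    where open +-*-Solver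

  +-osc : ∀ a b c d {ε} → ℚ.∣ a ℚ.- c ∣ ℚ.≤ ε → ℚ.∣ b ℚ.- d ∣ ℚ.≤ ε →
          ℚ.∣ (a ℚ.+ b) ℚ.- (c ℚ.+ d) ∣ ℚ.≤ (1ℚ ℚ.+ 1ℚ) ℚ.* ε
  +-osc a b c d {ε} h₁ h₂ = begin
      ℚ.∣ (a ℚ.+ b) ℚ.- (c ℚ.+ d) ∣      ≡⟨ cong ℚ.∣_∣ (e₁ a b c d) ⟩
      ℚ.∣ (a ℚ.- c) ℚ.+ (b ℚ.- d) ∣      ≤⟨ ℚₚ.∣p+q∣≤∣p∣+∣q∣ (a ℚ.- c) (b ℚ.- d) ⟩
      ℚ.∣ a ℚ.- c ∣ ℚ.+ ℚ.∣ b ℚ.- d ∣    ≤⟨ ℚₚ.+-mono-≤ h₁ h₂ ⟩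
      ε ℚ.+ ε                            ≡⟨ e₂ ε ⟩
      (1ℚ ℚ.+ 1ℚ) ℚ.* ε                  ∎
    where
    open +-*-Solver
    e₁ : ∀ a b c d → (a ℚ.+ b) ℚ.- (c ℚ.+ d) ≡ (a ℚ.- c) ℚ.+ (b ℚ.- d)
    e₁ = solve 4 (λ a b c d → (a :+ b) :- (c :+ d) := (a :- c) :+ (b :- d)) refl
    e₂ : ∀ a → a ℚ.+ a ≡ (1ℚ ℚ.+ 1ℚ) ℚ.* a
    e₂ = solve 1 (λ a → a :+ a := (con 1ℚ :+ con 1ℚ) :* a) refl

  *-osc : ∀ a b c d {ε B C} → 0ℚ ℚ.≤ B → 0ℚ ℚ.≤ C → ℚ.∣ a ∣ ℚ.≤ B → ℚ.∣ d ∣ ℚ.≤ C →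
          ℚ.∣ a ℚ.- c ∣ ℚ.≤ ε → ℚ.∣ b ℚ.- d ∣ ℚ.≤ ε →
          ℚ.∣ a ℚ.* b ℚ.- c ℚ.* d ∣ ℚ.≤ (B ℚ.+ C) ℚ.* ε
  *-osc a b c d {ε} {B} {C} 0≤B 0≤C a≤B d≤C h₁ h₂ = begin
      ℚ.∣ a ℚ.* b ℚ.- c ℚ.* d ∣
        ≡⟨ cong ℚ.∣_∣ e ⟩
      ℚ.∣ a ℚ.* (b ℚ.- d) ℚ.+ d ℚ.* (a ℚ.- c) ∣
        ≤⟨ ℚₚ.∣p+q∣≤∣p∣+∣q∣ (a ℚ.* (b ℚ.- d)) (d ℚ.* (a ℚ.- c)) ⟩
      ℚ.∣ a ℚ.* (b ℚ.- d) ∣ ℚ.+ ℚ.∣ d ℚ.* (a ℚ.- c) ∣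
        ≡⟨ cong₂ ℚ._+_ (ℚₚ.∣p*q∣≡∣p∣*∣q∣ a (b ℚ.- d)) (ℚₚ.∣p*q∣≡∣p∣*∣q∣ d (a ℚ.- c)) ⟩
      ℚ.∣ a ∣ ℚ.* ℚ.∣ b ℚ.- d ∣ ℚ.+ ℚ.∣ d ∣ ℚ.* ℚ.∣ a ℚ.- c ∣
        ≤⟨ ℚₚ.+-mono-≤
             (*-mono {ℚ.∣ a ∣} {B} {ℚ.∣ b ℚ.- d ∣} {ε} (ℚₚ.0≤∣p∣ (b ℚ.- d)) 0≤B a≤B h₂)
             (*-mono {ℚ.∣ d ∣} {C} {ℚ.∣ a ℚ.- c ∣} {ε} (ℚₚ.0≤∣p∣ (a ℚ.- c)) 0≤C d≤C h₁) ⟩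
      B ℚ.* ε ℚ.+ C ℚ.* ε
        ≡⟨ sym (ℚₚ.*-distribʳ-+ ε B C) ⟩
      (B ℚ.+ C) ℚ.* ε ∎
    where
    e : a ℚ.* b ℚ.- c ℚ.* d ≡ a ℚ.* (b ℚ.- d) ℚ.+ d ℚ.* (a ℚ.- c)
    e = trans (telescope (a ℚ.* b) (a ℚ.* d) (c ℚ.* d))
      (cong₂ ℚ._+_ (sym (*-distribˡ-- a b d))
        (trans (cong₂ ℚ._-_ (ℚₚ.*-comm a d) (ℚₚ.*-comm c d)) (sym (*-distribˡ-- d a c))))

  inv-anti : ∀ {δ q} → 0ℚ ℚ.< δ → δ ℚ.≤ q → inv q ℚ.≤ inv δ
  inv-anti {δ} {q} 0<δ δ≤q = begin
      inv q                       ≡⟨ e₁ (inv q) (inv-inverseʳ δ (pos⇒≢0 0<δ)) ⟩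
      δ ℚ.* (inv δ ℚ.* inv q)     ≤⟨ ℚₚ.*-monoʳ-≤-nonNeg (inv δ ℚ.* inv q) {{ℚ.nonNegative k}} δ≤q ⟩
      q ℚ.* (inv δ ℚ.* inv q)     ≡⟨ e₂ ⟩
      inv δ                       ∎
    where
    0<q : 0ℚ ℚ.< q
    0<q = ℚₚ.<-≤-trans 0<δ δ≤q
    k : 0ℚ ℚ.≤ inv δ ℚ.* inv q
    k = ℚₚ.<⇒≤ (*-pos {inv δ} {inv q} (inv-pos 0<δ) (inv-pos 0<q))
    e₁ : ∀ r → δ ℚ.* inv δ ≡ 1ℚ → r ≡ δ ℚ.* (inv δ ℚ.* r)
    e₁ r e = trans (sym (ℚₚ.*-identityˡ r))
               (trans (cong (ℚ._* r) (sym e)) (ℚₚ.*-assoc δ (inv δ) r))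
    e₂ : q ℚ.* (inv δ ℚ.* inv q) ≡ inv δ
    e₂ = trans (cong (q ℚ.*_) (ℚₚ.*-comm (inv δ) (inv q)))
           (trans (sym (ℚₚ.*-assoc q (inv q) (inv δ)))
             (trans (cong (ℚ._* inv δ) (inv-inverseʳ q (pos⇒≢0 0<q))) (ℚₚ.*-identityˡ (inv δ))))

  inv-osc : ∀ p q {δ ε} → 0ℚ ℚ.< δ → δ ℚ.≤ p → δ ℚ.≤ q → ℚ.∣ q ℚ.- p ∣ ℚ.≤ ε →
            ℚ.∣ inv p ℚ.- inv q ∣ ℚ.≤ (inv δ ℚ.* inv δ) ℚ.* ε
  inv-osc p q {δ} {ε} 0<δ δ≤p δ≤q h = begin
      ℚ.∣ inv p ℚ.- inv q ∣
        ≡⟨ cong ℚ.∣_∣ e ⟩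
      ℚ.∣ (inv p ℚ.* inv q) ℚ.* (q ℚ.- p) ∣
        ≡⟨ ℚₚ.∣p*q∣≡∣p∣*∣q∣ (inv p ℚ.* inv q) (q ℚ.- p) ⟩
      ℚ.∣ inv p ℚ.* inv q ∣ ℚ.* ℚ.∣ q ℚ.- p ∣
        ≡⟨ cong (ℚ._* ℚ.∣ q ℚ.- p ∣) (ℚₚ.0≤p⇒∣p∣≡p (*-nonNeg {inv p} {inv q} 0≤ip 0≤iq)) ⟩
      (inv p ℚ.* inv q) ℚ.* ℚ.∣ q ℚ.- p ∣
        ≤⟨ *-mono {inv p ℚ.* inv q} {inv δ ℚ.* inv δ} {ℚ.∣ q ℚ.- p ∣} {ε}
             (ℚₚ.0≤∣p∣ (q ℚ.- p)) (*-nonNeg {inv δ} {inv δ} 0≤iδ 0≤iδ)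
             (*-mono {inv p} {inv δ} {inv q} {inv δ} 0≤iq 0≤iδ (inv-anti 0<δ δ≤p) (inv-anti 0<δ δ≤q))
             h ⟩
      (inv δ ℚ.* inv δ) ℚ.* ε ∎
    where
    0<p : 0ℚ ℚ.< p
    0<p = ℚₚ.<-≤-trans 0<δ δ≤p
    0<q : 0ℚ ℚ.< q
    0<q = ℚₚ.<-≤-trans 0<δ δ≤q
    0≤ip : 0ℚ ℚ.≤ inv p
    0≤ip = ℚₚ.<⇒≤ (inv-pos 0<p)
    0≤iq : 0ℚ ℚ.≤ inv q
    0≤iq = ℚₚ.<⇒≤ (inv-pos 0<q)
    0≤iδ : 0ℚ ℚ.≤ inv δ
    0≤iδ = ℚₚ.<⇒≤ (inv-pos 0<δ)
    l : (inv p ℚ.* inv q) ℚ.* q ≡ inv p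
    l = trans (ℚₚ.*-assoc (inv p) (inv q) q)
          (trans (cong (inv p ℚ.*_) (trans (ℚₚ.*-comm (inv q) q) (inv-inverseʳ q (pos⇒≢0 0<q))))
            (ℚₚ.*-identityʳ (inv p)))
    r : (inv p ℚ.* inv q) ℚ.* p ≡ inv q
    r = trans (ℚₚ.*-comm (inv p ℚ.* inv q) p)
          (trans (sym (ℚₚ.*-assoc p (inv p) (inv q)))
            (trans (cong (ℚ._* inv q) (inv-inverseʳ p (pos⇒≢0 0<p))) (ℚₚ.*-identityˡ (inv q))))
    e : inv p ℚ.- inv q ≡ (inv p ℚ.* inv q) ℚ.* (q ℚ.- p)
    e = sym (trans (*-distribˡ-- (inv p ℚ.* inv q) q p) (cong₂ ℚ._-_ l r))

------------------------------------------------------------------------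
-- Real numbers: Cauchy sequences of rationals, with equality and order
-- those of the limits.

IsCauchy : (ℕ → ℚ) → Set
IsCauchy x = ∀ ε → 0ℚ ℚ.< ε → ∃[ N ] (∀ m n → N ≤ m → N ≤ n → ℚ.∣ x m ℚ.- x n ∣ ℚ.≤ ε)

record ℝ : Set where
  constructor mkℝ
  field
    seq    : ℕ → ℚ
    cauchy : IsCauchy seq
open ℝ public

infix 4 _≃ᴿ_ _≤ᴿ_
_≃ᴿ_ : ℝ → ℝ → Set
x ≃ᴿ y = ∀ ε → 0ℚ ℚ.< ε → ∃[ N ] (∀ n → N ≤ n → ℚ.∣ seq x n ℚ.- seq y n ∣ ℚ.≤ ε)

_≤ᴿ_ : ℝ → ℝ → Set
x ≤ᴿ y = ∀ ε → 0ℚ ℚ.< ε → ∃[ N ] (∀ n → N ≤ n → seq x n ℚ.≤ seq y n ℚ.+ ε)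

Positiveᴿ : ℝ → Set
Positiveᴿ x = ∃[ δ ] (0ℚ ℚ.< δ × ∃[ N ] (∀ n → N ≤ n → δ ℚ.≤ seq x n))

private
  -- It suffices to bound the oscillation by a fixed multiple of ε.
  cauchy-scale : ∀ {x} K → 0ℚ ℚ.< K →
    (∀ ε → 0ℚ ℚ.< ε → ∃[ N ] (∀ m n → N ≤ m → N ≤ n → ℚ.∣ x m ℚ.- x n ∣ ℚ.≤ K ℚ.* ε)) →
    IsCauchy x
  cauchy-scale {x} K 0<K h ε 0<ε with h (inv K ℚ.* ε) (*-pos {inv K} {ε} (inv-pos 0<K) 0<ε)
  ... | N , b = N , λ m n p q → subst (ℚ.∣ x m ℚ.- x n ∣ ℚ.≤_) e (b m n p q)
    where
    e : K ℚ.* (inv K ℚ.* ε) ≡ ε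
    e = trans (sym (ℚₚ.*-assoc K (inv K) ε))
          (trans (cong (ℚ._* ε) (inv-inverseʳ K (pos⇒≢0 0<K))) (ℚₚ.*-identityˡ ε))

  bound : ∀ x → IsCauchy x → ∃[ B ] (0ℚ ℚ.< B × ∃[ N ] (∀ n → N ≤ n → ℚ.∣ x n ∣ ℚ.≤ B))
  bound x c with c 1ℚ (ℚₚ.positive⁻¹ 1ℚ)
  ... | N , b = 1ℚ ℚ.+ ℚ.∣ x N ∣ , 0<B , N , λ n N≤n → begin
      ℚ.∣ x n ∣                       ≡⟨ cong ℚ.∣_∣ (e (x n) (x N)) ⟩
      ℚ.∣ (x n ℚ.- x N) ℚ.+ x N ∣      ≤⟨ ℚₚ.∣p+q∣≤∣p∣+∣q∣ (x n ℚ.- x N) (x N) ⟩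
      ℚ.∣ x n ℚ.- x N ∣ ℚ.+ ℚ.∣ x N ∣  ≤⟨ ℚₚ.+-monoˡ-≤ ℚ.∣ x N ∣ (b n N N≤n ℕₚ.≤-refl) ⟩
      1ℚ ℚ.+ ℚ.∣ x N ∣                 ∎
    where
    0<B : 0ℚ ℚ.< 1ℚ ℚ.+ ℚ.∣ x N ∣
    0<B = subst (ℚ._< 1ℚ ℚ.+ ℚ.∣ x N ∣) (ℚₚ.+-identityʳ 0ℚ)
            (ℚₚ.+-mono-<-≤ (ℚₚ.positive⁻¹ 1ℚ) (ℚₚ.0≤∣p∣ (x N)))
    e : ∀ p q → p ≡ (p ℚ.- q) ℚ.+ q
    e = solve 2 (λ p q → p := (p :- q) :+ q) refl
      where open +-*-Solver

  const-cauchy : ∀ q → IsCauchy (λ _ → q)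
  const-cauchy q ε 0<ε = 0 , λ _ _ _ _ →
    subst (λ t → ℚ.∣ t ∣ ℚ.≤ ε) (sym (ℚₚ.+-inverseʳ q)) (ℚₚ.<⇒≤ 0<ε)

  +-cauchy : ∀ {x y} → IsCauchy x → IsCauchy y → IsCauchy (λ n → x n ℚ.+ y n)
  +-cauchy {x} {y} cx cy =
    cauchy-scale {λ n → x n ℚ.+ y n} (1ℚ ℚ.+ 1ℚ) (ℚₚ.positive⁻¹ (1ℚ ℚ.+ 1ℚ)) λ ε 0<ε →
      let M , b  = cx ε 0<ε
          N , b′ = cy ε 0<ε
      in M ⊔ N , λ m n p q → +-osc (x m) (y m) (x n) (y n)
           (b  m n (ℕₚ.m⊔n≤o⇒m≤o M N p) (ℕₚ.m⊔n≤o⇒m≤o M N q))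
           (b′ m n (ℕₚ.m⊔n≤o⇒n≤o M N p) (ℕₚ.m⊔n≤o⇒n≤o M N q))

  neg-cauchy : ∀ {x} → IsCauchy x → IsCauchy (λ n → ℚ.- x n)
  neg-cauchy {x} cx ε 0<ε =
    let N , b = cx ε 0<ε
    in N , λ m n p q →
      subst (ℚ._≤ ε)
        (trans (sym (ℚₚ.∣-p∣≡∣p∣ (x m ℚ.- x n))) (cong ℚ.∣_∣ (ℚₚ.neg-distrib-+ (x m) (ℚ.- x n))))
        (b m n p q)

  *-cauchy : ∀ {x y} → IsCauchy x → IsCauchy y → IsCauchy (λ n → x n ℚ.* y n)
  *-cauchy {x} {y} cx cy =
    let B , 0<B , M₁ , bx = bound x cx
        C , 0<C , M₂ , by = bound y cy
    in cauchy-scale {λ n → x n ℚ.* y n} (B ℚ.+ C) (ℚₚ.+-mono-< 0<B 0<C) λ ε 0<ε →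
      let N₁ , b₁ = cx ε 0<ε
          N₂ , b₂ = cy ε 0<ε
          M = M₁ ⊔ M₂
          N = N₁ ⊔ N₂
      in M ⊔ N , λ m n p q →
        let p₁ = ℕₚ.m⊔n≤o⇒m≤o M N p
            p₂ = ℕₚ.m⊔n≤o⇒n≤o M N p
            q₁ = ℕₚ.m⊔n≤o⇒m≤o M N q
            q₂ = ℕₚ.m⊔n≤o⇒n≤o M N q
        in *-osc (x m) (y m) (x n) (y n) (ℚₚ.<⇒≤ 0<B) (ℚₚ.<⇒≤ 0<C)
             (bx m (ℕₚ.m⊔n≤o⇒m≤o M₁ M₂ p₁)) (by n (ℕₚ.m⊔n≤o⇒n≤o M₁ M₂ q₁))
             (b₁ m n (ℕₚ.m⊔n≤o⇒m≤o N₁ N₂ p₂) (ℕₚ.m⊔n≤o⇒m≤o N₁ N₂ q₂))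
             (b₂ m n (ℕₚ.m⊔n≤o⇒n≤o N₁ N₂ p₂) (ℕₚ.m⊔n≤o⇒n≤o N₁ N₂ q₂))

  inv-cauchy : ∀ x → Positiveᴿ x → IsCauchy (λ n → inv (seq x n))
  inv-cauchy (mkℝ x cx) (δ , 0<δ , M , low) =
    cauchy-scale {λ n → inv (x n)} (inv δ ℚ.* inv δ)
      (*-pos {inv δ} {inv δ} (inv-pos 0<δ) (inv-pos 0<δ)) λ ε 0<ε →
        let N , b = cx ε 0<ε
        in M ⊔ N , λ m n p q → inv-osc (x m) (x n) 0<δ
             (low m (ℕₚ.m⊔n≤o⇒m≤o M N p)) (low n (ℕₚ.m⊔n≤o⇒m≤o M N q))
             (b n m (ℕₚ.m⊔n≤o⇒n≤o M N q) (ℕₚ.m⊔n≤o⇒n≤o M N p))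

ℚ→ℝ : ℚ → ℝ
ℚ→ℝ q = mkℝ (λ _ → q) (const-cauchy q)

infixl 6 _+ᴿ_
infixl 7 _*ᴿ_
infix  8 -ᴿ_
infixr 8 _^ᴿ_

_+ᴿ_ : ℝ → ℝ → ℝ
x +ᴿ y = mkℝ (λ n → seq x n ℚ.+ seq y n) (+-cauchy {seq x} {seq y} (cauchy x) (cauchy y))

-ᴿ_ : ℝ → ℝ
-ᴿ x = mkℝ (λ n → ℚ.- seq x n) (neg-cauchy {seq x} (cauchy x))

_*ᴿ_ : ℝ → ℝ → ℝ
x *ᴿ y = mkℝ (λ n → seq x n ℚ.* seq y n) (*-cauchy {seq x} {seq y} (cauchy x) (cauchy y))

_^ᴿ_ : ℝ → ℕ → ℝ
x ^ᴿ zero  = ℚ→ℝ 1ℚ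
x ^ᴿ suc k = x *ᴿ x ^ᴿ k

_/ᴿ_⟨_⟩ : ℝ → (y : ℝ) → Positiveᴿ y → ℝ
x /ᴿ y ⟨ y>0 ⟩ = x *ᴿ mkℝ (λ n → inv (seq y n)) (inv-cauchy y y>0)

^-positive : ∀ {x} → Positiveᴿ x → ∀ k → Positiveᴿ (x ^ᴿ k)
^-positive px zero = 1ℚ , ℚₚ.positive⁻¹ 1ℚ , 0 , λ _ _ → ℚₚ.≤-refl
^-positive {x} px@(δ , 0<δ , M , low) (suc k) =
  let η , 0<η , N , low′ = ^-positive {x} px k
  in δ ℚ.* η , *-pos {δ} {η} 0<δ 0<η , M ⊔ N , λ n p →
    let l = low n (ℕₚ.m⊔n≤o⇒m≤o M N p)
    in *-mono {δ} {seq x n} {η} {seq (x ^ᴿ k) n}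
         (ℚₚ.<⇒≤ 0<η) (ℚₚ.<⇒≤ (ℚₚ.<-≤-trans 0<δ l)) l (low′ n (ℕₚ.m⊔n≤o⇒n≤o M N p))

------------------------------------------------------------------------
-- π as the Leibniz series 4 - 4/3 + 4/5 - 4/7 + ⋯.

leibnizTerm : ℕ → ℚ
leibnizTerm k = + 4 ℚ./ suc (2 * k)

-- alternating k n = tₖ - (tₖ₊₁ - (tₖ₊₂ - ⋯)) with n terms, tₖ = leibnizTerm k;
-- so alternating 0 n is the n-th partial sum of the series.
alternating : ℕ → ℕ → ℚ
alternating k zero    = 0ℚ
alternating k (suc n) = leibnizTerm k ℚ.- alternating (suc k) n

private
  t-bound : ∀ {k} {q : ℚ} → mkℚᵘ (+ 4) (2 * k) ℚᵘ.≤ ℚ.toℚᵘ q → leibnizTerm k ℚ.≤ q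
  t-bound {k} h = ℚₚ.toℚᵘ-cancel-≤ (ℚᵘₚ.≤-respˡ-≃ (ℚᵘₚ.≃-sym (ℚₚ.toℚᵘ-fromℚᵘ (mkℚᵘ (+ 4) (2 * k)))) h)

  t-nonNeg : ∀ k → 0ℚ ℚ.≤ leibnizTerm k
  t-nonNeg k = ℚₚ.nonNegative⁻¹ (leibnizTerm k) {{ℚₚ.normalize-nonNeg 4 (suc (2 * k))}}

  t-anti : ∀ k → leibnizTerm (suc k) ℚ.≤ leibnizTerm k
  t-anti k = t-bound {suc k} (ℚᵘₚ.≤-respʳ-≃ (ℚᵘₚ.≃-sym (ℚₚ.toℚᵘ-fromℚᵘ (mkℚᵘ (+ 4) (2 * k))))
    (ℚᵘ.*≤* (+≤+ (ℕₚ.*-monoʳ-≤ 4 (s≤s (ℕₚ.*-monoʳ-≤ 2 (ℕₚ.n≤1+n k)))))))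

  t-small : ∀ ε → 0ℚ ℚ.< ε → ∃[ N ] leibnizTerm N ℚ.≤ ε
  t-small (ℚ.mkℚ (+ zero) d c) 0<ε =
    contradiction (sym (ℚₚ.↥p≡0⇒p≡0 (ℚ.mkℚ (+ zero) d c) refl)) (ℚₚ.<⇒≢ 0<ε)
  t-small (ℚ.mkℚ -[1+ _ ] d c) (ℚ.*<* ())
  t-small (ℚ.mkℚ (+ suc a) d c) _ = 2 * suc d , t-bound {2 * suc d} (ℚᵘ.*≤* (+≤+ le))
    where
    le : 4 * suc d ≤ suc a * suc (2 * (2 * suc d))
    le = ℕₚ.≤-trans (ℕₚ.≤-reflexive (ℕₚ.*-assoc 2 2 (suc d)))
           (ℕₚ.≤-trans (ℕₚ.n≤1+n _) (ℕₚ.m≤n*m (suc (2 * (2 * suc d))) (suc a)))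

  alt-lower : ∀ k n → 0ℚ ℚ.≤ alternating k n
  alt-upper : ∀ k n → alternating k n ℚ.≤ leibnizTerm k
  alt-lower k zero    = ℚₚ.≤-refl
  alt-lower k (suc n) = 0≤q-p (ℚₚ.≤-trans (alt-upper (suc k) n) (t-anti k))
  alt-upper k zero    = t-nonNeg k
  alt-upper k (suc n) = p-q≤p (leibnizTerm k) (alt-lower (suc k) n)

  alt-osc : ∀ N k m n → N ≤ m → N ≤ n →
            ℚ.∣ alternating k m ℚ.- alternating k n ∣ ℚ.≤ leibnizTerm (N + k)
  alt-osc zero k m n _ _ = ∣-∣≤
    (ℚₚ.≤-trans (p-q≤p (alternating k m) (alt-lower k n)) (alt-upper k m))
    (subst (ℚ._≤ leibnizTerm k) (e (alternating k n) (alternating k m))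
      (ℚₚ.≤-trans (p-q≤p (alternating k n) (alt-lower k m)) (alt-upper k n)))
    where
    open +-*-Solver
    e : ∀ p q → p ℚ.- q ≡ ℚ.- (q ℚ.- p)
    e = solve 2 (λ p q → p :- q := :- (q :- p)) refl
  alt-osc (suc N) k (suc m) (suc n) (s≤s p) (s≤s q) =
    subst₂ (λ u v → u ℚ.≤ leibnizTerm v)
      (trans (sym (ℚₚ.∣-p∣≡∣p∣ (x ℚ.- y))) (cong ℚ.∣_∣ (e (leibnizTerm k) x y)))
      (ℕₚ.+-suc N k)
      (alt-osc N (suc k) m n p q)
    where
    open +-*-Solver
    x = alternating (suc k) m
    y = alternating (suc k) n
    e : ∀ t x y → ℚ.- (x ℚ.- y) ≡ (t ℚ.- x) ℚ.- (t ℚ.- y)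
    e = solve 3 (λ t x y → :- (x :- y) := (t :- x) :- (t :- y)) refl

  alt-cauchy : IsCauchy (alternating 0)
  alt-cauchy ε 0<ε with t-small ε 0<ε
  ... | N , t≤ε = N , λ m n p q →
    ℚₚ.≤-trans (alt-osc N 0 m n p q)
      (subst (λ k → leibnizTerm k ℚ.≤ ε) (sym (ℕₚ.+-identityʳ N)) t≤ε)

π : ℝ
π = mkℝ (alternating 0) alt-cauchy

π-positive : Positiveᴿ π
π-positive = δ , ℚₚ.positive⁻¹ δ , 1 , λ { (suc n) _ →
    ℚₚ.+-monoʳ-≤ (leibnizTerm 0) (ℚₚ.neg-antimono-≤ (alt-upper 1 n)) }
  where
  δ = leibnizTerm 0 ℚ.- leibnizTerm 1

6/π² : ℝ
6/π² = ℚ→ℝ (ℕ→ℚ 6) /ᴿ π ^ᴿ 2 ⟨ ^-positive {π} π-positive 2 ⟩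

------------------------------------------------------------------------
-- Complex numbers

record ℂ : Set where
  constructor _+i_
  field
    re im : ℝ
open ℂ public

infix 4 _≃ᶜ_
_≃ᶜ_ : ℂ → ℂ → Set
z ≃ᶜ w = re z ≃ᴿ re w × im z ≃ᴿ im w

infixl 6 _+ᶜ_ _-ᶜ_
infixl 7 _*ᶜ_ _•_

0ᶜ : ℂ
0ᶜ = ℚ→ℝ 0ℚ +i ℚ→ℝ 0ℚ

_+ᶜ_ _-ᶜ_ _*ᶜ_ : ℂ → ℂ → ℂ
z +ᶜ w = (re z +ᴿ re w) +i (im z +ᴿ im w)
z -ᶜ w = (re z +ᴿ -ᴿ re w) +i (im z +ᴿ -ᴿ im w)
z *ᶜ w = (re z *ᴿ re w +ᴿ -ᴿ (im z *ᴿ im w)) +i (re z *ᴿ im w +ᴿ im z *ᴿ re w)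

_•_ : ℝ → ℂ → ℂ
r • z = (r *ᴿ re z) +i (r *ᴿ im z)

ℕ→ℂ : ℕ → ℂ
ℕ→ℂ n = ℚ→ℝ (ℕ→ℚ n) +i ℚ→ℝ 0ℚ

∣_∣² : ℂ → ℝ
∣ z ∣² = re z *ᴿ re z +ᴿ im z *ᴿ im z

-- ∣ z ∣ ≤ r, squared to avoid the real square root.
∣_∣≤_ : ℂ → ℚ → Set
∣ z ∣≤ r = 0ℚ ℚ.≤ r × ∣ z ∣² ≤ᴿ ℚ→ℝ (r ℚ.* r)

infix 4 _⟶_
_⟶_ : (ℕ → ℂ) → ℂ → Set
z ⟶ L = ∀ ε → 0ℚ ℚ.< ε → ∃[ N ] (∀ n → N ≤ n → ∣ z n -ᶜ L ∣≤ ε)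

-- Arithmetic functions are functions on all of ℕ whose value at 0 is never
-- used: sums start at 1 and hypotheses are restricted to 1 ≤ n.

sumTo : (ℕ → ℂ) → ℕ → ℂ
sumTo u zero    = 0ᶜ
sumTo u (suc N) = sumTo u N +ᶜ u (suc N)

_sumsTo_ : (ℕ → ℂ) → ℂ → Set
u sumsTo S = sumTo u ⟶ S

-- (1/N) ∑_{n=1}^N u n for N ≥ 1; the value at N = 0 is immaterial in limits.
mean : (ℕ → ℂ) → ℕ → ℂ
mean u N = ℚ→ℝ (inv (ℕ→ℚ N)) • sumTo u N

infix 5 _when_
_when_ : ∀ {P : Set} → ℂ → Dec P → ℂ
z when P? = if does P? then z else 0ᶜ

------------------------------------------------------------------------
-- Arithmetic

Squarefree : ℕ → Set
Squarefree n = ∀ {p} → Prime p → ¬ (p ^ 2 ∣ n)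

Squarefull : ℕ → Set
Squarefull n = ∀ {p} → Prime p → p ∣ n → p ^ 2 ∣ n

-- In increasing order, for n ≥ 1.
primeDivisors : ℕ → List ℕ
primeDivisors n = filter (λ p → prime? p ×-dec p ∣? n) (upTo (suc n))

private
  allPrimeDivisors? : ∀ {P : ℕ → Set} → (∀ p → Dec (P p)) → ∀ n → .{{NonZero n}} →
                      Dec (∀ {p} → Prime p → p ∣ n → P p)
  allPrimeDivisors? {P} P? n = map′ to from (all? P? (primeDivisors n))
    where
    Q? = λ p → prime? p ×-dec p ∣? n
    to : All P (primeDivisors n) → ∀ {p} → Prime p → p ∣ n → P p
    to h pp p∣n = All.lookup h (∈-filter⁺ Q? (∈-upTo⁺ (s≤s (∣⇒≤ p∣n))) (pp , p∣n))
    from : (∀ {p} → Prime p → p ∣ n → P p) → All P (primeDivisors n)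
    from h = All.tabulate λ i →
      let pp , p∣n = proj₂ (∈-filter⁻ Q? {xs = upTo (suc n)} i) in h pp p∣n

squarefull? : ∀ n → Dec (Squarefull n)
squarefull? zero      = yes (λ _ _ → divides 0 refl)
squarefull? n@(suc _) = allPrimeDivisors? (λ p → p ^ 2 ∣? n) n

squarefree? : ∀ n → Dec (Squarefree n)
squarefree? zero      = no (λ h → h prime[2] (divides 0 refl))
squarefree? n@(suc _) = map′
    (λ h {p} pp p²∣n → h {p} pp (∣-trans (m∣m*n (p ^ 1)) p²∣n) p²∣n)
    (λ h {p} pp _ → h {p} pp)
    (allPrimeDivisors? (λ p → ¬? (p ^ 2 ∣? n)) n)

μ : ℕ → ℚ
μ n = if does (squarefree? n) then (ℚ.- 1ℚ) ^ℚ length (primeDivisors n) else 0ℚ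

σ : ℕ → ℕ
σ n = sum (filter (_∣? n) (upTo (suc n)))

∏[1+1/p] : ℕ → ℚ
∏[1+1/p] n = foldr (λ p r → (1ℚ ℚ.+ inv (ℕ→ℚ p)) ℚ.* r) 1ℚ (primeDivisors n)

σf : ℕ → ℚ
σf f = ℕ→ℚ f ℚ.* ∏[1+1/p] f

------------------------------------------------------------------------
-- s-functions and invariant averages

-- f = f(n); for n ≥ 1 there is exactly one such f.
IsSquarefullPart : ℕ → ℕ → Set
IsSquarefullPart n f = ∃[ q ] (n ≡ q * f × Squarefree q × Squarefull f × Coprime q f)

-- a(n) ≪_ε n^ε for all ε > 0.  Smaller ε give stronger bounds, so ε runs over
-- the positive rationals k/l, and ∣a n∣ ≤ C n^(k/l) is raised to the power 2l.
Subpolynomial : (ℕ → ℂ) → Set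
Subpolynomial a = ∀ k l → 1 ≤ k → 1 ≤ l → ∃[ C ] (0ℚ ℚ.≤ C × (∀ n → 1 ≤ n →
  ∣ a n ∣² ^ᴿ l ≤ᴿ ℚ→ℝ ((C ^ℚ l ℚ.* ℕ→ℚ n ^ℚ k) ^ℚ 2)))

IsSFunction : (ℕ → ℂ) → Set
IsSFunction a = (∀ n f → 1 ≤ n → IsSquarefullPart n f → a n ≃ᶜ a f) × Subpolynomial a

Bounded : (ℕ → ℂ) → Set
Bounded c = ∃[ M ] (∀ n → 1 ≤ n → ∣ c n ∣≤ M)

HasInvariantAverage : (ℕ → ℂ) → ℂ → Set
HasInvariantAverage c A = (mean c ⟶ A) × (∀ d → 1 ≤ d → mean (λ n → c (d * n)) ⟶ A)

------------------------------------------------------------------------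
-- The constant ρ

1[a1=0] : (ℕ → ℕ) → ℕ
1[a1=0] a = if does (a 1 ≟ 0) then 1 else 0

innerTerm : (ℕ → ℕ) → (ℕ → ℂ) → ℕ → ℕ → ℂ
innerTerm a b d f =
  ℚ→ℝ (ℕ→ℚ (gcd d f) ℚ.* inv (σf f) ℚ.* ∏[1+1/p] (gcd d f)) • b f
    when (1[a1=0] a <? f ×-dec squarefull? f ×-dec d ∣? a f)

outerTerm : (ℕ → ℂ) → ℕ → ℂ
outerTerm inner d = ℚ→ℝ (μ d ℚ.* inv (ℕ→ℚ (σ d))) • inner d

-- ρ = (6/π²) ∑_d μ(d)/σ(d) ∑_f ⋯, including convergence of all the series;
-- the sum over f is taken in increasing order.
IsRho : (ℕ → ℕ) → (ℕ → ℂ) → ℂ → Set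
IsRho a b ρ = ∃[ inner ] ∃[ S ]
  ( (∀ d → 1 ≤ d → innerTerm a b d sumsTo inner d)
  × outerTerm inner sumsTo S
  × ρ ≃ᶜ 6/π² • S )

-- Write n = q f with f the squarefull part of n.  For fixed f, the conditions on q (including
-- (n, a(f)) = 1) say that certain pairwise coprime moduli, one of 1, p, p² for each prime p, do not
-- divide q.  Sieving by the primes p ≤ y one at a time needs only the mean values of the functions
-- n ↦ c(dn), and the primes p > y contribute O(1/y).  The resulting density is an Euler product, and
-- the sum over d ∣ a(f) in ρ is the expansion of its factors at the primes dividing a(f).
-- If f > G³ then n is divisible by a square s² with s > G and f ≤ s³, so by a(n), b(n) ≪ n^ε such n
-- are negligible, uniformly in the length of the sum; since n has squarefull part f with frequency
-- 6/(π² σ_f), the same bound makes the series for ρ converge absolutely.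
-- The Euler product is evaluated by ζ(2) = π²/6, obtained by squaring the Leibniz series.
--
-- Sequences of reals are handled as families of rationals indexed by (N, k), where k is the index
-- in the approximating Cauchy sequences; limits are taken along the filter "for all large N, for all
-- large k".
{-# OPTIONS --safe #-}
module Submission where

open import Defs
open import Data.Nat using (ℕ; zero; suc; _≤_; z≤n; s≤s; _⊔_; _≟_)
open import Data.Nat.GCD using (gcd; gcd[m,n]∣m; gcd[m,n]∣n; gcd-greatest)
open import Data.Product using (∃-syntax; _×_; _,_; proj₁; proj₂)
open import Relation.Nullary using (Dec; yes; no; does; ¬_; contradiction)

import Data.Bool as Bool
open import Data.Bool using (if_then_else_)
import Data.Integer as ℤ
open import Data.Integer using (-[1+_])
import Data.Integer.Properties as ℤₚ
open import Data.List using (List; []; _∷_; foldr; filter; upTo; length)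
open import Data.List.Properties using (filter-++; filter-accept; filter-reject; foldr-++; upTo-∷ʳ)
open import Data.List.Relation.Unary.All using (_∷_)
open import Data.Maybe using (Maybe; just; nothing)
import Data.Nat as ℕ
import Data.Nat.Coprimality as Cop
open import Data.Nat.Coprimality using (Coprime; coprime-divisor; coprime⇒gcd≡1; gcd≡1⇒coprime)
import Data.Nat.Divisibility as Div
open import Data.Nat.Divisibility
  using (_∣_; _∣?_; divides; ∣⇒≤; ∣-trans; ∣-refl; ∣-antisym; m∣m*n; n∣m*n)
open import Data.Nat.DivMod using (_/_; _%_; m≡m%n+[m/n]*n; m%n<n; m*n/n≡m; m/n*n≤m; /-monoˡ-≤)
open import Data.Nat.Induction using (<-rec)
open import Data.Nat.Primality
  using (Prime; prime?; ¬prime[0]; ¬prime[1]; euclidsLemma; prime⇒nonZero; prime⇒nonTrivial;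
    prime⇒irreducible)
open import Data.Nat.Primality.Factorisation using (factorise; module PrimeFactorisation)
import Data.Nat.Properties as ℕₚ
open import Data.Nat.Tactic.RingSolver using () renaming (solve-∀ to solve-ℕ)
import Data.Rational as ℚ
open import Data.Rational using (ℚ; 0ℚ; 1ℚ; _+_; _*_; _-_; -_; mkℚ)
  renaming (_≤_ to _≤ℚ_; _<_ to _<ℚ_; ∣_∣ to abs)
import Data.Rational.Properties as ℚₚ
open import Data.Rational.Properties
  using (*-assoc; *-distribʳ-+; *-distribˡ-+; *-identityʳ; *-identityˡ; *-zeroʳ; *-zeroˡ;
    +-comm; +-identityʳ; +-identityˡ; +-inverseʳ; +-mono-≤; +-monoʳ-≤; +-monoˡ-≤; 0≤∣p∣;
    <-≤-trans; <⇒≤; neg-antimono-≤; positive⁻¹; ∣p*q∣≡∣p∣*∣q∣; ∣p+q∣≤∣p∣+∣q∣; ≤-refl;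
    ≤-reflexive; ≤-trans)
import Data.Rational.Unnormalised as ℚᵘ
import Data.Rational.Unnormalised.Properties as ℚᵘₚ
open import Data.Sum using (_⊎_; inj₁; inj₂)
open import Function using (_∘_; _$_)
open import Relation.Binary.PropositionalEquality
  using (_≡_; _≢_; refl; sym; trans; cong; cong₂; subst; subst₂; module ≡-Reasoning)
open import Relation.Nullary.Decidable using (_×-dec_; ¬?)
open import Tactic.RingSolver using (solve-∀)
import Tactic.RingSolver.Core.AlmostCommutativeRing as ACR

-- Rational arithmetic

-- The value a(n) depends only on the squarefull part f, so fixing f turns the moving condition (n,
-- a(n)) = 1 into one with a fixed modulus. The average of c is the same along every dilation, so
-- each modulus M in the sieve multiplies the mean by 1 - 1/M. The delicate point is the order of
-- summation: the mean value yields a single sum over f, whereas ρ sums over d outside and f inside.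
-- For f up to a bound, the divisors d of a(f) are exhausted at a finite stage; beyond it there are
-- at most a(f) of them, so everything is majorised by |b(f)|(1 + a(f))/σ_f. This is why the growth
-- estimates concern |b(n)|(1 + a(n)). With c = 1 and a = 1 the same sieve counts the n with a given
-- squarefull part, and comparing these counts with 1/σ_f gives convergence without counting
-- squarefull numbers. A value a(f) = 0 would admit every d. Among squarefull f it can occur only at
-- f = 1, which ρ then omits; there the condition (n, 0) = 1 leaves only n = 1.

ringℚ : ACR.AlmostCommutativeRing _ _
ringℚ = ACR.fromCommutativeRing ℚₚ.+-*-commutativeRing isZero?
  where
  isZero? : ∀ x → Maybe (0ℚ ≡ x)
  isZero? x with 0ℚ ℚₚ.≟ x
  ... | yes e = just e
  ... | no  _ = nothing

infix 4 _≥0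
_≥0 : ℚ → Set
q ≥0 = 0ℚ ≤ℚ q

2ℚ : ℚ
2ℚ = 1ℚ + 1ℚ

0<1 : 0ℚ <ℚ 1ℚ
0<1 = positive⁻¹ 1ℚ

0≤1 : 1ℚ ≥0
0≤1 = <⇒≤ 0<1

*-pos : ∀ {p q} → 0ℚ <ℚ p → 0ℚ <ℚ q → 0ℚ <ℚ p * q
*-pos {p} {q} 0<p 0<q =
  positive⁻¹ (p * q) {{ℚₚ.pos*pos⇒pos p {{ℚ.positive 0<p}} q {{ℚ.positive 0<q}}}}

*-≥0 : ∀ {p q} → p ≥0 → q ≥0 → p * q ≥0
*-≥0 {p} {q} 0≤p 0≤q =
  ℚₚ.nonNegative⁻¹ (p * q)
    {{ℚₚ.nonNeg*nonNeg⇒nonNeg p {{ℚ.nonNegative 0≤p}} q {{ℚ.nonNegative 0≤q}}}}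

+-≥0 : ∀ {p q} → p ≥0 → q ≥0 → p + q ≥0
+-≥0 {p} {q} a b = subst (_≤ℚ p + q) (+-identityʳ 0ℚ) (+-mono-≤ a b)

+-pos : ∀ {p q} → 0ℚ <ℚ p → q ≥0 → 0ℚ <ℚ p + q
+-pos {p} {q} a b = subst (_<ℚ p + q) (+-identityʳ 0ℚ) (ℚₚ.+-mono-<-≤ a b)

*-monoˡ : ∀ {r p q} → r ≥0 → p ≤ℚ q → r * p ≤ℚ r * q
*-monoˡ {r} 0≤r = ℚₚ.*-monoˡ-≤-nonNeg r {{ℚ.nonNegative 0≤r}}

*-monoʳ : ∀ {r p q} → r ≥0 → p ≤ℚ q → p * r ≤ℚ q * r
*-monoʳ {r} 0≤r = ℚₚ.*-monoʳ-≤-nonNeg r {{ℚ.nonNegative 0≤r}}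

*-mono : ∀ {p q r s} → r ≥0 → q ≥0 → p ≤ℚ q → r ≤ℚ s → p * r ≤ℚ q * s
*-mono {p} {q} {r} {s} 0≤r 0≤q p≤q r≤s =
  ≤-trans (*-monoʳ {r} {p} {q} 0≤r p≤q) (*-monoˡ {q} {r} {s} 0≤q r≤s)

*-swap : ∀ p q r → p * (q * r) ≡ q * (p * r)
*-swap = solve-∀ ringℚ

≤⇒0≤- : ∀ {p q} → p ≤ℚ q → q - p ≥0
≤⇒0≤- {p} {q} p≤q = subst (_≤ℚ q - p) (+-inverseʳ p) (+-monoˡ-≤ (- p) p≤q)

p-q+q : ∀ p q → (p - q) + q ≡ p
p-q+q = solve-∀ ringℚ

0≤-⇒≤ : ∀ {p q} → q - p ≥0 → p ≤ℚ q
0≤-⇒≤ {p} {q} h = subst₂ _≤ℚ_ (+-identityˡ p) (p-q+q q p) (+-monoˡ-≤ p h)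

≤-+ˡ : ∀ {p q} → q ≥0 → p ≤ℚ q + p
≤-+ˡ {p} {q} 0≤q = subst (_≤ℚ q + p) (+-identityˡ p) (+-monoˡ-≤ p 0≤q)

≤-+ʳ : ∀ {p q} → q ≥0 → p ≤ℚ p + q
≤-+ʳ {p} {q} 0≤q = subst (_≤ℚ p + q) (+-identityʳ p) (+-monoʳ-≤ p 0≤q)

-‿≤ : ∀ p {q} → q ≥0 → p - q ≤ℚ p
-‿≤ p {q} 0≤q = subst (p - q ≤ℚ_) (+-identityʳ p) (+-monoʳ-≤ p (neg-antimono-≤ 0≤q))

pos⇒≢0 : ∀ {q} → 0ℚ <ℚ q → q ≢ 0ℚ
pos⇒≢0 0<q refl = ℚₚ.<-irrefl refl 0<q

abs-≤ : ∀ {p q} → p ≤ℚ q → - p ≤ℚ q → abs p ≤ℚ q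
abs-≤ {p} {q} a b with ℚₚ.∣p∣≡p∨∣p∣≡-p p
... | inj₁ e = subst (_≤ℚ q) (sym e) a
... | inj₂ e = subst (_≤ℚ q) (sym e) b

≤-abs : ∀ p → p ≤ℚ abs p
≤-abs p with ℚₚ.≤-total 0ℚ p
... | inj₁ h = ≤-reflexive (sym (ℚₚ.0≤p⇒∣p∣≡p h))
... | inj₂ h = ≤-trans h (0≤∣p∣ p)

abs-≥0 : ∀ {p} → p ≥0 → abs p ≡ p
abs-≥0 = ℚₚ.0≤p⇒∣p∣≡p

abs-sym : ∀ p q → abs (p - q) ≡ abs (q - p)
abs-sym p q = trans (sym (ℚₚ.∣-p∣≡∣p∣ (p - q))) (cong abs (e p q))
  where
  e : ∀ p q → - (p - q) ≡ q - p
  e = solve-∀ ringℚ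

abs-tri : ∀ p q r → abs (p - r) ≤ℚ abs (p - q) + abs (q - r)
abs-tri p q r = subst (λ t → abs t ≤ℚ abs (p - q) + abs (q - r)) (e p q r) (∣p+q∣≤∣p∣+∣q∣ (p - q) (q - r))
  where
  e : ∀ p q r → (p - q) + (q - r) ≡ p - r
  e = solve-∀ ringℚ

inv-inverseʳ : ∀ {q} → q ≢ 0ℚ → q * inv q ≡ 1ℚ
inv-inverseʳ {q} q≢0 with q ℚₚ.≟ 0ℚ
... | yes q≡0 = contradiction q≡0 q≢0
... | no  q≢  = ℚₚ.*-inverseʳ q {{ℚ.≢-nonZero q≢}}

inv-inverseˡ : ∀ {q} → q ≢ 0ℚ → inv q * q ≡ 1ℚ
inv-inverseˡ {q} q≢0 = trans (ℚₚ.*-comm (inv q) q) (inv-inverseʳ q≢0)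

inv-pos : ∀ {q} → 0ℚ <ℚ q → 0ℚ <ℚ inv q
inv-pos {q} 0<q with q ℚₚ.≟ 0ℚ
... | yes q≡0 = contradiction q≡0 (pos⇒≢0 0<q)
... | no  q≢  = positive⁻¹ _ {{ℚₚ.1/pos⇒pos q {{ℚ.positive 0<q}}}}

inv-≥0 : ∀ {q} → q ≥0 → inv q ≥0
inv-≥0 {q} 0≤q with q ℚₚ.≟ 0ℚ
... | yes _  = ≤-refl
... | no q≢0 = <⇒≤ (positive⁻¹ _ {{ℚₚ.1/pos⇒pos q {{ℚ.positive 0<q}}}})
  where
  0<q : 0ℚ <ℚ q
  0<q = ℚₚ.≰⇒> (λ q≤0 → q≢0 (ℚₚ.≤-antisym q≤0 0≤q))

*-cancelˡ : ∀ {p} → 0ℚ <ℚ p → ∀ {q r} → p * q ≡ p * r → q ≡ r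
*-cancelˡ {p} 0<p {q} {r} e = trans (h q) (trans (cong (inv p *_) e) (sym (h r)))
  where
  h : ∀ q → q ≡ inv p * (p * q)
  h q = sym (trans (sym (*-assoc (inv p) p q))
          (trans (cong (_* q) (inv-inverseˡ (pos⇒≢0 0<p))) (*-identityˡ q)))

inv-unique : ∀ {p q} → 0ℚ <ℚ p → p * q ≡ 1ℚ → q ≡ inv p
inv-unique {p} 0<p e = *-cancelˡ 0<p (trans e (sym (inv-inverseʳ (pos⇒≢0 0<p))))

inv-* : ∀ {p q} → 0ℚ <ℚ p → 0ℚ <ℚ q → inv (p * q) ≡ inv p * inv q
inv-* {p} {q} 0<p 0<q = sym (inv-unique (*-pos {p} {q} 0<p 0<q)
  (trans (e p q (inv p) (inv q))
    (trans (cong₂ _*_ (inv-inverseʳ (pos⇒≢0 0<p)) (inv-inverseʳ (pos⇒≢0 0<q))) (*-identityˡ 1ℚ))))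
  where
  e : ∀ p q r s → (p * q) * (r * s) ≡ (p * r) * (q * s)
  e = solve-∀ ringℚ

*-inv-≤ : ∀ {p q r} → 0ℚ <ℚ q → p ≤ℚ q * r → inv q * p ≤ℚ r
*-inv-≤ {p} {q} {r} 0<q h = subst (inv q * p ≤ℚ_)
  (trans (sym (*-assoc (inv q) q r)) (trans (cong (_* r) (inv-inverseˡ (pos⇒≢0 0<q))) (*-identityˡ r)))
  (*-monoˡ {inv q} {p} {q * r} (<⇒≤ (inv-pos 0<q)) h)

inv-anti : ∀ {p q} → 0ℚ <ℚ p → p ≤ℚ q → inv q ≤ℚ inv p
inv-anti {p} {q} 0<p p≤q = subst (_≤ℚ inv p) (*-identityʳ (inv q))
  (*-inv-≤ {1ℚ} {q} {inv p} (<-≤-trans 0<p p≤q)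
    (subst (_≤ℚ q * inv p) (inv-inverseʳ (pos⇒≢0 0<p)) (*-monoʳ {inv p} {p} {q} (<⇒≤ (inv-pos 0<p)) p≤q)))

*-scale : ∀ {K} → 0ℚ <ℚ K → ∀ ε → K * (inv K * ε) ≡ ε
*-scale {K} 0<K ε = trans (sym (*-assoc K (inv K) ε))
  (trans (cong (_* ε) (inv-inverseʳ (pos⇒≢0 0<K))) (*-identityˡ ε))

ℕ→ℚ-toℚᵘ : ∀ n → ℚ.toℚᵘ (ℕ→ℚ n) ℚᵘ.≃ ℚᵘ.mkℚᵘ (ℤ.+ n) 0
ℕ→ℚ-toℚᵘ n = ℚₚ.toℚᵘ-fromℚᵘ (ℚᵘ.mkℚᵘ (ℤ.+ n) 0)

ℕ→ℚ-+ : ∀ m n → ℕ→ℚ (m ℕ.+ n) ≡ ℕ→ℚ m + ℕ→ℚ n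
ℕ→ℚ-+ m n = ℚₚ.toℚᵘ-injective (ℚᵘₚ.≃-trans (ℕ→ℚ-toℚᵘ (m ℕ.+ n)) (ℚᵘₚ.≃-sym
  (ℚᵘₚ.≃-trans (ℚₚ.toℚᵘ-homo-+ (ℕ→ℚ m) (ℕ→ℚ n))
    (ℚᵘₚ.≃-trans (ℚᵘₚ.+-cong (ℕ→ℚ-toℚᵘ m) (ℕ→ℚ-toℚᵘ n))
      (ℚᵘ.*≡* (cong (ℤ._* ℤ.+ 1) (trans (cong₂ ℤ._+_ (ℤₚ.*-identityʳ (ℤ.+ m)) (ℤₚ.*-identityʳ (ℤ.+ n))) refl)))))))

ℕ→ℚ-* : ∀ m n → ℕ→ℚ (m ℕ.* n) ≡ ℕ→ℚ m * ℕ→ℚ n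
ℕ→ℚ-* m n = ℚₚ.toℚᵘ-injective (ℚᵘₚ.≃-trans (ℕ→ℚ-toℚᵘ (m ℕ.* n)) (ℚᵘₚ.≃-sym
  (ℚᵘₚ.≃-trans (ℚₚ.toℚᵘ-homo-* (ℕ→ℚ m) (ℕ→ℚ n))
    (ℚᵘₚ.≃-trans (ℚᵘₚ.*-cong (ℕ→ℚ-toℚᵘ m) (ℕ→ℚ-toℚᵘ n))
      (ℚᵘ.*≡* (cong (ℤ._* ℤ.+ 1) (sym (ℤₚ.pos-* m n))))))))

ℕ→ℚ-mono : ∀ {m n} → m ≤ n → ℕ→ℚ m ≤ℚ ℕ→ℚ n
ℕ→ℚ-mono {m} {n} h = ℚₚ.toℚᵘ-cancel-≤ (ℚᵘₚ.≤-respˡ-≃ (ℚᵘₚ.≃-sym (ℕ→ℚ-toℚᵘ m))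
  (ℚᵘₚ.≤-respʳ-≃ (ℚᵘₚ.≃-sym (ℕ→ℚ-toℚᵘ n))
    (ℚᵘ.*≤* (ℤₚ.*-monoʳ-≤-nonNeg (ℤ.+ 1) (ℤ.+≤+ h)))))

ℕ→ℚ-≥0 : ∀ n → ℕ→ℚ n ≥0
ℕ→ℚ-≥0 n = ℕ→ℚ-mono {0} {n} z≤n

ℕ→ℚ-pos : ∀ {n} → 1 ≤ n → 0ℚ <ℚ ℕ→ℚ n
ℕ→ℚ-pos {n} h = <-≤-trans 0<1 (ℕ→ℚ-mono {1} {n} h)

ℕ→ℚ-suc : ∀ n → ℕ→ℚ (suc n) ≡ ℕ→ℚ n + 1ℚ
ℕ→ℚ-suc n = trans (cong ℕ→ℚ (ℕₚ.+-comm 1 n)) (ℕ→ℚ-+ n 1)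

archimedean : ∀ q → ∃[ n ] (1 ≤ n × q ≤ℚ ℕ→ℚ n)
archimedean (mkℚ -[1+ a ] d c) = 1 , s≤s z≤n , ℚ.*≤* ℤ.-≤+
archimedean q@(mkℚ (ℤ.+ a) d c) = suc a , s≤s z≤n ,
  ℚₚ.toℚᵘ-cancel-≤ (ℚᵘₚ.≤-respʳ-≃ (ℚᵘₚ.≃-sym (ℕ→ℚ-toℚᵘ (suc a)))
    (ℚᵘ.*≤* (subst₂ ℤ._≤_ (sym (ℤₚ.*-identityʳ (ℤ.+ a))) (ℤₚ.pos-* (suc a) (suc d))
      (ℤ.+≤+ (ℕₚ.≤-trans (ℕₚ.n≤1+n a) (ℕₚ.m≤m*n (suc a) (suc d)))))))

inv-small : ∀ {ε} → 0ℚ <ℚ ε → ∃[ n ] (1 ≤ n × inv (ℕ→ℚ n) ≤ℚ ε)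
inv-small {ε} 0<ε with archimedean (inv ε)
... | n , 1≤n , h = n , 1≤n , subst (_≤ℚ ε) (*-identityʳ (inv (ℕ→ℚ n)))
  (*-inv-≤ {1ℚ} {ℕ→ℚ n} {ε} (ℕ→ℚ-pos 1≤n)
    (subst (_≤ℚ ℕ→ℚ n * ε) (inv-inverseˡ (pos⇒≢0 0<ε)) (*-monoʳ {ε} (<⇒≤ 0<ε) h)))

-- Finite sums, indicators, filters and limits

module _ {P A : Set} {x y : A} where

  if-yes : (P? : Dec P) → P → (if does P? then x else y) ≡ x
  if-yes (yes _) p = refl
  if-yes (no ¬p) p = contradiction p ¬p

  if-no : (P? : Dec P) → ¬ P → (if does P? then x else y) ≡ y
  if-no (yes p) ¬p = contradiction p ¬p
  if-no (no _)  ¬p = refl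

𝟙 : {P : Set} → Dec P → ℚ
𝟙 P? = if does P? then 1ℚ else 0ℚ

module _ {P : Set} where

  𝟙-yes : (P? : Dec P) → P → 𝟙 P? ≡ 1ℚ
  𝟙-yes = if-yes

  𝟙-no : (P? : Dec P) → ¬ P → 𝟙 P? ≡ 0ℚ
  𝟙-no = if-no

  𝟙-≥0 : (P? : Dec P) → 𝟙 P? ≥0
  𝟙-≥0 (yes _) = 0≤1
  𝟙-≥0 (no _)  = ≤-refl

  𝟙-≤1 : (P? : Dec P) → 𝟙 P? ≤ℚ 1ℚ
  𝟙-≤1 (yes _) = ≤-refl
  𝟙-≤1 (no _)  = 0≤1

  𝟙-yes-* : (P? : Dec P) → P → ∀ x → 𝟙 P? * x ≡ x
  𝟙-yes-* P? p x = trans (cong (_* x) (𝟙-yes P? p)) (*-identityˡ x)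

  𝟙-no-* : (P? : Dec P) → ¬ P → ∀ x → 𝟙 P? * x ≡ 0ℚ
  𝟙-no-* P? ¬p x = trans (cong (_* x) (𝟙-no P? ¬p)) (*-zeroˡ x)

  𝟙-*-cong : (P? : Dec P) → ∀ {x y} → (P → x ≡ y) → 𝟙 P? * x ≡ 𝟙 P? * y
  𝟙-*-cong (yes p)         h = cong (1ℚ *_) (h p)
  𝟙-*-cong (no _) {x} {y} h = trans (*-zeroˡ x) (sym (*-zeroˡ y))

  module _ {Q : Set} where

    𝟙-⇔ : (P? : Dec P) (Q? : Dec Q) → (P → Q) → (Q → P) → 𝟙 P? ≡ 𝟙 Q?
    𝟙-⇔ P? (yes q) f g = 𝟙-yes P? (g q)
    𝟙-⇔ P? (no ¬q) f g = 𝟙-no P? (¬q ∘ f)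

    𝟙-× : (P? : Dec P) (Q? : Dec Q) → 𝟙 (P? ×-dec Q?) ≡ 𝟙 P? * 𝟙 Q?
    𝟙-× (yes _) Q? = sym (*-identityˡ (𝟙 Q?))
    𝟙-× (no _)  Q? = sym (*-zeroˡ (𝟙 Q?))

∑ ∏ : (ℕ → ℚ) → ℕ → ℚ
∑ u zero    = 0ℚ
∑ u (suc N) = ∑ u N + u (suc N)
∏ u zero    = 1ℚ
∏ u (suc N) = ∏ u N * u (suc N)

∑-cong : ∀ {u v} N → (∀ n → 1 ≤ n → n ≤ N → u n ≡ v n) → ∑ u N ≡ ∑ v N
∑-cong zero    h = refl
∑-cong (suc N) h = cong₂ _+_ (∑-cong N λ n p q → h n p (ℕₚ.m≤n⇒m≤1+n q)) (h (suc N) (s≤s z≤n) ℕₚ.≤-refl)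

∏-cong : ∀ {u v} N → (∀ n → 1 ≤ n → n ≤ N → u n ≡ v n) → ∏ u N ≡ ∏ v N
∏-cong zero    h = refl
∏-cong (suc N) h = cong₂ _*_ (∏-cong N λ n p q → h n p (ℕₚ.m≤n⇒m≤1+n q)) (h (suc N) (s≤s z≤n) ℕₚ.≤-refl)

∑-mono : ∀ {u v} N → (∀ n → 1 ≤ n → n ≤ N → u n ≤ℚ v n) → ∑ u N ≤ℚ ∑ v N
∑-mono zero    h = ≤-refl
∑-mono (suc N) h = +-mono-≤ (∑-mono N λ n p q → h n p (ℕₚ.m≤n⇒m≤1+n q)) (h (suc N) (s≤s z≤n) ℕₚ.≤-refl)

∑-+ : ∀ u v N → ∑ (λ n → u n + v n) N ≡ ∑ u N + ∑ v N
∑-+ u v zero    = refl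
∑-+ u v (suc N) = trans (cong (_+ (u (suc N) + v (suc N))) (∑-+ u v N))
                        (e (∑ u N) (∑ v N) (u (suc N)) (v (suc N)))
  where
  e : ∀ a b c d → (a + b) + (c + d) ≡ (a + c) + (b + d)
  e = solve-∀ ringℚ

∑-* : ∀ c u N → ∑ (λ n → c * u n) N ≡ c * ∑ u N
∑-* c u zero    = sym (*-zeroʳ c)
∑-* c u (suc N) = trans (cong (_+ c * u (suc N)) (∑-* c u N)) (sym (*-distribˡ-+ c (∑ u N) (u (suc N))))

∑-neg : ∀ u N → ∑ (λ n → - u n) N ≡ - ∑ u N
∑-neg u zero    = refl
∑-neg u (suc N) = trans (cong (_+ - u (suc N)) (∑-neg u N)) (sym (ℚₚ.neg-distrib-+ (∑ u N) (u (suc N))))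

∑-- : ∀ u v N → ∑ (λ n → u n - v n) N ≡ ∑ u N - ∑ v N
∑-- u v N = trans (∑-+ u (λ n → - v n) N) (cong (∑ u N +_) (∑-neg v N))

∑-0 : ∀ {u} N → (∀ n → 1 ≤ n → n ≤ N → u n ≡ 0ℚ) → ∑ u N ≡ 0ℚ
∑-0 zero    h = refl
∑-0 (suc N) h = trans (cong₂ _+_ (∑-0 N λ n p q → h n p (ℕₚ.m≤n⇒m≤1+n q)) (h (suc N) (s≤s z≤n) ℕₚ.≤-refl)) refl

∑-≥0 : ∀ {u} N → (∀ n → 1 ≤ n → n ≤ N → u n ≥0) → ∑ u N ≥0
∑-≥0 zero    h = ≤-refl
∑-≥0 (suc N) h = +-≥0 (∑-≥0 N λ n p q → h n p (ℕₚ.m≤n⇒m≤1+n q)) (h (suc N) (s≤s z≤n) ℕₚ.≤-refl)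

∑-abs : ∀ u N → abs (∑ u N) ≤ℚ ∑ (λ n → abs (u n)) N
∑-abs u zero    = ≤-refl
∑-abs u (suc N) = ≤-trans (∣p+q∣≤∣p∣+∣q∣ (∑ u N) (u (suc N))) (+-monoˡ-≤ (abs (u (suc N))) (∑-abs u N))

∑-swap : ∀ (u : ℕ → ℕ → ℚ) M N → ∑ (λ m → ∑ (u m) N) M ≡ ∑ (λ n → ∑ (λ m → u m n) M) N
∑-swap u zero    N = sym (∑-0 N λ _ _ _ → refl)
∑-swap u (suc M) N = trans (cong (_+ ∑ (u (suc M)) N) (∑-swap u M N))
  (sym (∑-+ (λ n → ∑ (λ m → u m n) M) (u (suc M)) N))

∑-const : ∀ c N → ∑ (λ _ → c) N ≡ ℕ→ℚ N * c
∑-const c zero    = sym (*-zeroˡ c)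
∑-const c (suc N) = trans (cong (_+ c) (∑-const c N))
  (trans (e (ℕ→ℚ N) c) (cong (_* c) (sym (ℕ→ℚ-suc N))))
  where
  e : ∀ n c → n * c + c ≡ (n + 1ℚ) * c
  e = solve-∀ ringℚ

∑-split : ∀ u M N → ∑ u (M ℕ.+ N) ≡ ∑ u M + ∑ (λ n → u (M ℕ.+ n)) N
∑-split u M zero    = trans (cong (∑ u) (ℕₚ.+-identityʳ M)) (sym (+-identityʳ (∑ u M)))
∑-split u M (suc N) = trans (cong (∑ u) (ℕₚ.+-suc M N))
  (trans (cong₂ _+_ (∑-split u M N) (cong u (sym (ℕₚ.+-suc M N))))
    (ℚₚ.+-assoc (∑ u M) (∑ (λ n → u (M ℕ.+ n)) N) (u (M ℕ.+ suc N))))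

∑-monoN : ∀ {u M N} → (∀ n → 1 ≤ n → u n ≥0) → M ≤ N → ∑ u M ≤ℚ ∑ u N
∑-monoN {u} {M} {N} h M≤N = subst (λ t → ∑ u M ≤ℚ ∑ u t) (ℕₚ.m+[n∸m]≡n M≤N)
  (subst (∑ u M ≤ℚ_) (sym (∑-split u M (N ℕ.∸ M)))
    (≤-+ʳ (∑-≥0 (N ℕ.∸ M) λ n 1≤n _ → h (M ℕ.+ n) (ℕₚ.≤-trans 1≤n (ℕₚ.m≤n+m n M)))))

∑-term : ∀ {u} N m → (∀ n → 1 ≤ n → n ≤ N → u n ≥0) → 1 ≤ m → m ≤ N → u m ≤ℚ ∑ u N
∑-term zero    m h 1≤m m≤N = contradiction (ℕₚ.≤-trans 1≤m m≤N) λ ()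
∑-term {u} (suc N) m h 1≤m m≤N with m ℕₚ.≟ suc N
... | yes refl = ≤-+ˡ (∑-≥0 N λ n p q → h n p (ℕₚ.m≤n⇒m≤1+n q))
... | no m≢ = ≤-trans
  (∑-term N m (λ n p q → h n p (ℕₚ.m≤n⇒m≤1+n q)) 1≤m (ℕₚ.≤-pred (ℕₚ.≤∧≢⇒< m≤N m≢)))
  (≤-+ʳ (h (suc N) (s≤s z≤n) ℕₚ.≤-refl))

∑-single : ∀ {u} N m → (∀ n → 1 ≤ n → n ≤ N → n ≢ m → u n ≡ 0ℚ) → 1 ≤ m → m ≤ N → ∑ u N ≡ u m
∑-single zero    m h 1≤m m≤N = contradiction (ℕₚ.≤-trans 1≤m m≤N) λ ()
∑-single {u} (suc N) m h 1≤m m≤N with m ℕₚ.≟ suc N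
... | yes refl = trans (cong (_+ u m) (∑-0 N λ n p q → h n p (ℕₚ.m≤n⇒m≤1+n q) (ℕₚ.<⇒≢ (s≤s q)))) (+-identityˡ (u m))
... | no m≢ = trans (cong₂ _+_
    (∑-single N m (λ n p q → h n p (ℕₚ.m≤n⇒m≤1+n q)) 1≤m (ℕₚ.≤-pred (ℕₚ.≤∧≢⇒< m≤N m≢)))
    (h (suc N) (s≤s z≤n) ℕₚ.≤-refl (m≢ ∘ sym)))
  (+-identityʳ (u m))

record Filter (I : Set) : Set₁ where
  no-eta-equality
  field
    Ev   : (I → Set) → Set
    pure : ∀ {P} → (∀ i → P i) → Ev P
    map  : ∀ {P Q} → (∀ i → P i → Q i) → Ev P → Ev Q
    zip  : ∀ {P Q} → Ev P → Ev Q → Ev (λ i → P i × Q i)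
open Filter

ev : Filter ℕ
ev .Ev P = ∃[ N ] (∀ n → N ≤ n → P n)
ev .pure h = 0 , λ n _ → h n
ev .map f (N , h) = N , λ n p → f n (h n p)
ev .zip (M , g) (N , h) = M ⊔ N , λ n p → g n (ℕₚ.m⊔n≤o⇒m≤o M N p) , h n (ℕₚ.m⊔n≤o⇒n≤o M N p)

infixr 6 _⊗_
-- The iterated filter: the threshold for `j` may depend on `i`. This matches `⟶`, where the
-- approximation index is only required to be large after `N` has been fixed.
_⊗_ : ∀ {I J} → Filter I → Filter J → Filter (I × J)
(F ⊗ G) .Ev P = Ev F λ i → Ev G λ j → P (i , j)
(F ⊗ G) .pure h = pure F λ i → pure G λ j → h (i , j)
(F ⊗ G) .map f = map F λ i → map G λ j → f (i , j)
(F ⊗ G) .zip a b = map F (λ i (x , y) → zip G x y) (zip F a b)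

ev² : Filter (ℕ × ℕ)
ev² = ev ⊗ ev

module _ {I : Set} (F : Filter I) where

  record Small (u : I → ℚ) : Set where
    constructor small
    field at : ∀ ε → 0ℚ <ℚ ε → Ev F (λ i → abs (u i) ≤ℚ ε)
  open Small public

  record Bdd (u : I → ℚ) : Set where
    constructor bdd
    field
      bd     : ℚ
      bd-pos : 0ℚ <ℚ bd
      bd-ev  : Ev F (λ i → abs (u i) ≤ℚ bd)
  open Bdd public

  -- Both sides are families, because a limit is a real number and is only known through its own
  -- approximations.
  record Lim (u v : I → ℚ) : Set where
    constructor lim
    field diff : Small (λ i → u i - v i)
  open Lim public

  Ev² : ∀ {P Q R : I → Set} → (∀ i → P i → Q i → R i) → Ev F P → Ev F Q → Ev F R
  Ev² f p q = map F (λ i (a , b) → f i a b) (zip F p q)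

module _ {I : Set} {F : Filter I} where

  small-cong : ∀ {u v : I → ℚ} → (∀ i → u i ≡ v i) → Small F u → Small F v
  small-cong e s = small λ ε 0<ε → map F (λ i → subst (λ t → abs t ≤ℚ ε) (e i)) (at s ε 0<ε)

  small-dom : ∀ {u v : I → ℚ} → Ev F (λ i → abs (u i) ≤ℚ v i) → Small F v → Small F u
  small-dom {u} {v} h s = small λ ε 0<ε →
    Ev² F (λ i a b → ≤-trans a (≤-trans (≤-abs (v i)) b)) h (at s ε 0<ε)

  small-scale : ∀ {u : I → ℚ} K → 0ℚ <ℚ K →
    (∀ ε → 0ℚ <ℚ ε → Ev F (λ i → abs (u i) ≤ℚ K * ε)) → Small F u
  small-scale {u} K 0<K h = small λ ε 0<ε →
    map F (λ i → subst (abs (u i) ≤ℚ_) (*-scale 0<K ε)) (h (inv K * ε) (*-pos (inv-pos 0<K) 0<ε))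

  small-0 : Small F (λ _ → 0ℚ)
  small-0 = small λ ε 0<ε → pure F λ _ → <⇒≤ 0<ε

  small-+ : ∀ {u v : I → ℚ} → Small F u → Small F v → Small F (λ i → u i + v i)
  small-+ {u} {v} s t = small-scale 2ℚ (positive⁻¹ 2ℚ) λ ε 0<ε →
    Ev² F (λ i a b → ≤-trans (∣p+q∣≤∣p∣+∣q∣ (u i) (v i))
      (subst (abs (u i) + abs (v i) ≤ℚ_) (e ε) (+-mono-≤ a b)))
      (at s ε 0<ε) (at t ε 0<ε)
    where
    e : ∀ x → x + x ≡ 2ℚ * x
    e = solve-∀ ringℚ

  small-neg : ∀ {u : I → ℚ} → Small F u → Small F (λ i → - u i)
  small-neg {u} s = small λ ε 0<ε → map F (λ i → subst (_≤ℚ ε) (sym (ℚₚ.∣-p∣≡∣p∣ (u i)))) (at s ε 0<ε)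

  small-* : ∀ {u v : I → ℚ} → Bdd F u → Small F v → Small F (λ i → u i * v i)
  small-* {u} {v} b s = small-scale (bd b) (bd-pos b) λ ε 0<ε →
    Ev² F (λ i p q → subst (_≤ℚ bd b * ε) (sym (∣p*q∣≡∣p∣*∣q∣ (u i) (v i)))
        (*-mono (0≤∣p∣ (v i)) (<⇒≤ (bd-pos b)) p q))
      (bd-ev b) (at s ε 0<ε)

  -- The approximant `w` may depend on ε. This is what allows truncation at a sieving level or at a
  -- partial sum that is chosen only after the tolerance.
  small-approx : ∀ {u : I → ℚ} K → K ≥0 →
    (∀ ε → 0ℚ <ℚ ε → ∃[ w ] (Small F w × Ev F (λ i → abs (u i - w i) ≤ℚ K * ε))) → Small F u
  small-approx {u} K 0≤K h = small-scale (1ℚ + K) (+-pos 0<1 0≤K) λ ε 0<ε →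
    let w , s , d = h ε 0<ε
    in Ev² F (λ i a b → subst₂ (λ x y → abs x ≤ℚ y) (p-q+q (u i) (w i)) (e K ε)
         (≤-trans (∣p+q∣≤∣p∣+∣q∣ (u i - w i) (w i)) (+-mono-≤ a b))) d (at s ε 0<ε)
    where
    e : ∀ K x → K * x + x ≡ (1ℚ + K) * x
    e = solve-∀ ringℚ

  bdd-const : ∀ c → Bdd F (λ _ → c)
  bdd-const c = bdd (1ℚ + abs c) (+-pos 0<1 (0≤∣p∣ c)) (pure F λ _ → ≤-+ˡ {abs c} 0≤1)

  bdd-≤ : ∀ {u : I → ℚ} c → (∀ i → abs (u i) ≤ℚ c) → Bdd F u
  bdd-≤ {u} c h = bdd (1ℚ + abs c) (+-pos 0<1 (0≤∣p∣ c))
    (pure F λ i → ≤-trans (h i) (≤-trans (≤-abs c) (≤-+ˡ {abs c} 0≤1)))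

  bdd-+ : ∀ {u v : I → ℚ} → Bdd F u → Bdd F v → Bdd F (λ i → u i + v i)
  bdd-+ {u} {v} a b = bdd (bd a + bd b) (ℚₚ.+-mono-< (bd-pos a) (bd-pos b))
    (Ev² F (λ i p q → ≤-trans (∣p+q∣≤∣p∣+∣q∣ (u i) (v i)) (+-mono-≤ p q)) (bd-ev a) (bd-ev b))

  bdd-* : ∀ {u v : I → ℚ} → Bdd F u → Bdd F v → Bdd F (λ i → u i * v i)
  bdd-* {u} {v} a b = bdd (bd a * bd b) (*-pos (bd-pos a) (bd-pos b))
    (Ev² F (λ i p q → subst (_≤ℚ bd a * bd b) (sym (∣p*q∣≡∣p∣*∣q∣ (u i) (v i)))
        (*-mono (0≤∣p∣ (v i)) (<⇒≤ (bd-pos a)) p q)) (bd-ev a) (bd-ev b))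

  small⇒bdd : ∀ {u : I → ℚ} → Small F u → Bdd F u
  small⇒bdd s = bdd 1ℚ 0<1 (at s 1ℚ 0<1)

  bdd-cong : ∀ {u v : I → ℚ} → (∀ i → u i ≡ v i) → Bdd F u → Bdd F v
  bdd-cong e b = bdd (bd b) (bd-pos b) (map F (λ i → subst (λ t → abs t ≤ℚ bd b) (e i)) (bd-ev b))

  lim-bdd : ∀ {u v : I → ℚ} → Lim F u v → Bdd F v → Bdd F u
  lim-bdd {u} {v} l b = bdd-cong (λ i → p-q+q (u i) (v i)) (bdd-+ (small⇒bdd (diff l)) b)

  lim-refl : ∀ {u : I → ℚ} → Lim F u u
  lim-refl {u} = lim (small-cong (λ i → sym (+-inverseʳ (u i))) small-0)

  lim-cong : ∀ {u v u′ v′ : I → ℚ} → (∀ i → u i ≡ u′ i) → (∀ i → v i ≡ v′ i) → Lim F u v → Lim F u′ v′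
  lim-cong e f l = lim (small-cong (λ i → cong₂ _-_ (e i) (f i)) (diff l))

  lim-≡ : ∀ {u v : I → ℚ} → (∀ i → u i ≡ v i) → Lim F u v
  lim-≡ e = lim-cong (λ _ → refl) e lim-refl

  lim-sym : ∀ {u v : I → ℚ} → Lim F u v → Lim F v u
  lim-sym {u} {v} l = lim (small-cong (λ i → e (u i) (v i)) (small-neg (diff l)))
    where
    e : ∀ x y → - (x - y) ≡ y - x
    e = solve-∀ ringℚ

  lim-trans : ∀ {u v w : I → ℚ} → Lim F u v → Lim F v w → Lim F u w
  lim-trans {u} {v} {w} l m = lim (small-cong (λ i → e (u i) (v i) (w i)) (small-+ (diff l) (diff m)))
    where
    e : ∀ x y z → (x - y) + (y - z) ≡ x - z
    e = solve-∀ ringℚ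

  lim-+ : ∀ {u v u′ v′ : I → ℚ} → Lim F u v → Lim F u′ v′ → Lim F (λ i → u i + u′ i) (λ i → v i + v′ i)
  lim-+ {u} {v} {u′} {v′} l m = lim (small-cong (λ i → e (u i) (v i) (u′ i) (v′ i)) (small-+ (diff l) (diff m)))
    where
    e : ∀ x y z w → (x - y) + (z - w) ≡ (x + z) - (y + w)
    e = solve-∀ ringℚ

  lim-neg : ∀ {u v : I → ℚ} → Lim F u v → Lim F (λ i → - u i) (λ i → - v i)
  lim-neg {u} {v} l = lim (small-cong (λ i → e (u i) (v i)) (small-neg (diff l)))
    where
    e : ∀ x y → - (x - y) ≡ - x - (- y)
    e = solve-∀ ringℚ

  lim-- : ∀ {u v u′ v′ : I → ℚ} → Lim F u v → Lim F u′ v′ → Lim F (λ i → u i - u′ i) (λ i → v i - v′ i)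
  lim-- l m = lim-+ l (lim-neg m)

  lim-* : ∀ {u v u′ v′ : I → ℚ} → Bdd F u → Bdd F v′ → Lim F u v → Lim F u′ v′ →
          Lim F (λ i → u i * u′ i) (λ i → v i * v′ i)
  lim-* {u} {v} {u′} {v′} b b′ l m = lim (small-cong (λ i → e (u i) (v i) (u′ i) (v′ i))
    (small-+ (small-* b (diff m)) (small-* b′ (diff l))))
    where
    e : ∀ x y z w → x * (z - w) + w * (x - y) ≡ x * z - y * w
    e = solve-∀ ringℚ

  lim-*ˡ : ∀ {c u v : I → ℚ} → Bdd F c → Lim F u v → Lim F (λ i → c i * u i) (λ i → c i * v i)
  lim-*ˡ {c} {u} {v} b l = lim (small-cong (λ i → e (c i) (u i) (v i)) (small-* b (diff l)))
    where
    e : ∀ x y z → x * (y - z) ≡ x * y - x * z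
    e = solve-∀ ringℚ

  lim-∑ : ∀ {u v : ℕ → I → ℚ} K → (∀ f → 1 ≤ f → f ≤ K → Lim F (u f) (v f)) →
          Lim F (λ i → ∑ (λ f → u f i) K) (λ i → ∑ (λ f → v f i) K)
  lim-∑ zero    h = lim-refl
  lim-∑ (suc K) h = lim-+ (lim-∑ K λ f p q → h f p (ℕₚ.m≤n⇒m≤1+n q)) (h (suc K) (s≤s z≤n) ℕₚ.≤-refl)

module _ {I J : Set} {F : Filter I} {G : Filter J} where

  small-∘proj₁ : ∀ {u : I → ℚ} → Small F u → Small (F ⊗ G) (λ (i , j) → u i)
  small-∘proj₁ s = small λ ε 0<ε → map F (λ i h → pure G λ _ → h) (at s ε 0<ε)

  small-∘proj₂ : ∀ {u : J → ℚ} → Small G u → Small (F ⊗ G) (λ (i , j) → u j)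
  small-∘proj₂ s = small λ ε 0<ε → pure F λ _ → at s ε 0<ε

  bdd-∘proj₂ : ∀ {u : J → ℚ} → Bdd G u → Bdd (F ⊗ G) (λ (i , j) → u j)
  bdd-∘proj₂ b = bdd (bd b) (bd-pos b) (pure F λ _ → bd-ev b)

  lim-∘proj₁ : ∀ {u v : I → ℚ} → Lim F u v → Lim (F ⊗ G) (λ (i , j) → u i) (λ (i , j) → v i)
  lim-∘proj₁ l = lim (small-∘proj₁ (diff l))

  lim-∘proj₂ : ∀ {u v : J → ℚ} → Lim G u v → Lim (F ⊗ G) (λ (i , j) → u j) (λ (i , j) → v j)
  lim-∘proj₂ l = lim (small-∘proj₂ (diff l))

Unbounded : (ℕ → ℕ) → Set
Unbounded φ = ∀ M → ∃[ N ] (∀ n → N ≤ n → M ≤ φ n)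

lim-reindex : ∀ {J} {G : Filter J} {u v : ℕ × J → ℚ} {φ} → Unbounded φ → Lim (ev ⊗ G) u v →
              Lim (ev ⊗ G) (λ (n , j) → u (φ n , j)) (λ (n , j) → v (φ n , j))
lim-reindex {φ = φ} h l = lim (small λ ε 0<ε →
  let M , s = at (diff l) ε 0<ε
      N , t = h M
  in N , λ n p → s (φ n) (t n p))

-- Mean values and sieving

-- Cut the range into `N / M` blocks of length `M` and a remainder: only the last member of each
-- block is a multiple, and the remainder contains none.
∑-multiples : ∀ M .{{_ : ℕ.NonZero M}} (u : ℕ → ℚ) N → ∑ (λ n → 𝟙 (M ∣? n) * u n) N ≡ ∑ (λ q → u (M ℕ.* q)) (N / M)
∑-multiples M@(suc m) u N = subst (λ t → ∑ v t ≡ ∑ w (N / M)) (sym N≡)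
  (trans (upToRemainder (N % M) (N / M) (m%n<n N M)) (blocks (N / M)))
  where
  v w : ℕ → ℚ
  v n = 𝟙 (M ∣? n) * u n
  w q = u (M ℕ.* q)
  N≡ : N ≡ M ℕ.* (N / M) ℕ.+ N % M
  N≡ = trans (m≡m%n+[m/n]*n N M) (trans (ℕₚ.+-comm (N % M) _) (cong (ℕ._+ N % M) (ℕₚ.*-comm (N / M) M)))
  between : ∀ q r → suc r ℕ.< M → v (suc (M ℕ.* q ℕ.+ r)) ≡ 0ℚ
  between q r r<M = 𝟙-no-* (M ∣? suc (M ℕ.* q ℕ.+ r)) no-div (u (suc (M ℕ.* q ℕ.+ r)))
    where
    no-div : ¬ (M ∣ suc (M ℕ.* q ℕ.+ r))
    no-div d = Div.>⇒∤ r<M (Div.∣m+n∣m⇒∣n (subst (M ∣_) (sym (ℕₚ.+-suc (M ℕ.* q) r)) d) (m∣m*n q))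
  upToRemainder : ∀ r q → r ℕ.< M → ∑ v (M ℕ.* q ℕ.+ r) ≡ ∑ v (M ℕ.* q)
  upToRemainder zero    q _   = cong (∑ v) (ℕₚ.+-identityʳ (M ℕ.* q))
  upToRemainder (suc r) q r<M = trans (cong (∑ v) (ℕₚ.+-suc (M ℕ.* q) r))
    (trans (cong₂ _+_ (upToRemainder r q (ℕₚ.<-trans (ℕₚ.n<1+n r) r<M)) (between q r r<M)) (+-identityʳ (∑ v (M ℕ.* q))))
  next : ∀ q → M ℕ.* suc q ≡ suc (M ℕ.* q ℕ.+ m)
  next q = trans (ℕₚ.*-suc M q) (trans (ℕₚ.+-comm M (M ℕ.* q)) (ℕₚ.+-suc (M ℕ.* q) m))
  blocks : ∀ q → ∑ v (M ℕ.* q) ≡ ∑ w q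
  blocks zero    = cong (∑ v) (ℕₚ.*-zeroʳ M)
  blocks (suc q) = trans (cong (∑ v) (next q))
    (cong₂ _+_ (trans (upToRemainder m q ℕₚ.≤-refl) (blocks q))
      (trans (cong (_* u (suc (M ℕ.* q ℕ.+ m)))
          (𝟙-yes (M ∣? suc (M ℕ.* q ℕ.+ m)) (subst (M ∣_) (next q) (m∣m*n (suc q)))))
        (trans (*-identityˡ _) (cong u (sym (next q))))))

-- A family u of (pre-)reals is indexed by n and the approximation index k.
avg : (ℕ → ℕ → ℚ) → ℕ × ℕ → ℚ
avg u (N , k) = inv (ℕ→ℚ N) * ∑ (λ n → u n k) N

record HasMean (u : ℕ → ℕ → ℚ) (α : ℕ → ℚ) : Set where
  constructor hasMean
  field avg-lim : Lim ev² (avg u) (λ (N , k) → α k)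
open HasMean public

mean-cong : ∀ {u v α} → (∀ n k → 1 ≤ n → u n k ≡ v n k) → HasMean u α → HasMean v α
mean-cong e (hasMean l) = hasMean (lim-cong (λ (N , k) → cong (inv (ℕ→ℚ N) *_) (∑-cong N λ n p _ → e n k p)) (λ _ → refl) l)

mean-cong-α : ∀ {u α β} → (∀ k → α k ≡ β k) → HasMean u α → HasMean u β
mean-cong-α e (hasMean l) = hasMean (lim-cong (λ _ → refl) (λ (N , k) → e k) l)

mean-+ : ∀ {u v α β} → HasMean u α → HasMean v β → HasMean (λ n k → u n k + v n k) (λ k → α k + β k)
mean-+ {u} {v} (hasMean h) (hasMean g) = hasMean $ lim-cong
  (λ (N , k) → trans (sym (*-distribˡ-+ (inv (ℕ→ℚ N)) (∑ (λ n → u n k) N) (∑ (λ n → v n k) N)))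
                     (cong (inv (ℕ→ℚ N) *_) (sym (∑-+ (λ n → u n k) (λ n → v n k) N))))
  (λ _ → refl) (lim-+ h g)

mean-*ˡ : ∀ {c u α} → Bdd ev c → HasMean u α → HasMean (λ n k → c k * u n k) (λ k → c k * α k)
mean-*ˡ {c} {u} b (hasMean h) = hasMean $ lim-cong
  (λ (N , k) → trans (e (c k) (inv (ℕ→ℚ N)) (∑ (λ n → u n k) N))
                     (cong (inv (ℕ→ℚ N) *_) (sym (∑-* (c k) (λ n → u n k) N))))
  (λ _ → refl) (lim-*ˡ (bdd-∘proj₂ b) h)
  where
  e : ∀ x y z → x * (y * z) ≡ y * (x * z)
  e = solve-∀ ringℚ

mean-neg : ∀ {u α} → HasMean u α → HasMean (λ n k → - u n k) (λ k → - α k)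
mean-neg {u} {α} h = mean-cong (λ n k _ → e (u n k)) (mean-cong-α (λ k → e (α k)) (mean-*ˡ (bdd-const (- 1ℚ)) h))
  where
  e : ∀ x → - 1ℚ * x ≡ - x
  e = solve-∀ ringℚ

mean-∑ : ∀ {u : ℕ → ℕ → ℕ → ℚ} {α : ℕ → ℕ → ℚ} K → (∀ f → 1 ≤ f → f ≤ K → HasMean (u f) (α f)) →
         HasMean (λ n k → ∑ (λ f → u f n k) K) (λ k → ∑ (λ f → α f k) K)
mean-∑ zero    h = hasMean $ lim-≡ λ (N , k) →
  trans (cong (inv (ℕ→ℚ N) *_) (∑-0 N λ _ _ _ → refl)) (*-zeroʳ (inv (ℕ→ℚ N)))
mean-∑ {u} {α} (suc K) h = mean-+
  (mean-∑ K λ f p q → h f p (ℕₚ.m≤n⇒m≤1+n q)) (h (suc K) (s≤s z≤n) ℕₚ.≤-refl)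

inv-ℕ-anti : ∀ {m n} → 1 ≤ m → m ≤ n → inv (ℕ→ℚ n) ≤ℚ inv (ℕ→ℚ m)
inv-ℕ-anti {m} {n} 1≤m m≤n = inv-anti {ℕ→ℚ m} {ℕ→ℚ n} (ℕ→ℚ-pos {m} 1≤m) (ℕ→ℚ-mono {m} {n} m≤n)

inv-ℕ-≥0 : ∀ n → inv (ℕ→ℚ n) ≥0
inv-ℕ-≥0 n = inv-≥0 {ℕ→ℚ n} (ℕ→ℚ-≥0 n)

small-inv : Small ev (λ N → inv (ℕ→ℚ N))
small-inv = small λ ε 0<ε → let n , 1≤n , h = inv-small 0<ε in
  n , λ m n≤m → subst (_≤ℚ ε) (sym (abs-≥0 (inv-ℕ-≥0 m)))
    (≤-trans (inv-ℕ-anti 1≤n n≤m) h)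

abs-≤0 : ∀ {x c} → x ≤ℚ 0ℚ → - c ≤ℚ x → abs x ≤ℚ c
abs-≤0 {x} {c} x≤0 -c≤x = abs-≤
  (≤-trans x≤0 (subst (0ℚ ≤ℚ_) (neg-neg c) (neg-antimono-≤ (≤-trans -c≤x x≤0))))
  (subst (- x ≤ℚ_) (neg-neg c) (neg-antimono-≤ -c≤x))
  where
  neg-neg : ∀ c → - (- c) ≡ c
  neg-neg = solve-∀ ringℚ

module _ (M : ℕ) .{{_ : ℕ.NonZero M}} where

  private
    1≤M : 1 ≤ M
    1≤M = ℕ.>-nonZero⁻¹ M

  /-unbounded : Unbounded (_/ M)
  /-unbounded K = K ℕ.* M , λ n h → subst (_≤ n / M) (m*n/n≡m K M) (/-monoˡ-≤ M h)

  -- Division with remainder r < M makes the difference exactly -r/(NM), which lies between -1/N and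
  -- 0.
  lim-/ : Lim ev (λ N → inv (ℕ→ℚ N) * ℕ→ℚ (N / M)) (λ _ → inv (ℕ→ℚ M))
  lim-/ = lim (small-dom {v = λ N → inv (ℕ→ℚ N)} (1 , close) small-inv)
    where
    1/M = inv (ℕ→ℚ M)
    close : ∀ N → 1 ≤ N → abs (inv (ℕ→ℚ N) * ℕ→ℚ (N / M) - 1/M) ≤ℚ inv (ℕ→ℚ N)
    close N 1≤N = abs-≤0
        (subst (_≤ℚ 0ℚ) (sym e₃) (neg-antimono-≤ (*-≥0 (*-≥0 0≤in (inv-ℕ-≥0 M)) (ℕ→ℚ-≥0 (N % M)))))
        (subst (- i ≤ℚ_) (sym e₃) (neg-antimono-≤
          (subst₂ _≤ℚ_ (sym (*-assoc i 1/M r)) (*-identityʳ i) (*-monoˡ 0≤in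
            (*-inv-≤ {r} {ℕ→ℚ M} {1ℚ} (ℕ→ℚ-pos 1≤M)
              (subst (r ≤ℚ_) (sym (*-identityʳ (ℕ→ℚ M))) (ℕ→ℚ-mono (ℕₚ.<⇒≤ (m%n<n N M)))))))))
      where
      i = inv (ℕ→ℚ N)
      q = ℕ→ℚ (N / M)
      r = ℕ→ℚ (N % M)
      0≤in = inv-ℕ-≥0 N
      N≡ : ℕ→ℚ N ≡ r + q * ℕ→ℚ M
      N≡ = trans (cong ℕ→ℚ (m≡m%n+[m/n]*n N M))
        (trans (ℕ→ℚ-+ (N % M) (N / M ℕ.* M)) (cong (r +_) (ℕ→ℚ-* (N / M) M)))
      e₁ : i * q ≡ i * q * (ℕ→ℚ M * 1/M)
      e₁ = sym (trans (cong (i * q *_) (inv-inverseʳ (pos⇒≢0 (ℕ→ℚ-pos 1≤M)))) (*-identityʳ (i * q)))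
      e₂ : 1/M ≡ 1/M * (i * (r + q * ℕ→ℚ M))
      e₂ = sym (trans (cong (1/M *_) (trans (cong (i *_) (sym N≡)) (inv-inverseˡ (pos⇒≢0 (ℕ→ℚ-pos 1≤N))))) (*-identityʳ 1/M))
      ring : ∀ i q m j r → i * q * (m * j) - j * (i * (r + q * m)) ≡ - (i * j * r)
      ring = solve-∀ ringℚ
      e₃ : i * q - 1/M ≡ - (i * 1/M * r)
      e₃ = trans (cong₂ _-_ e₁ e₂) (ring i q (ℕ→ℚ M) 1/M r)

  -- The mean up to N over the multiples of M factors into (N / M)/N, which tends to 1/M, and the
  -- mean of the dilated function up to N / M.
  mean-multiples : ∀ {u : ℕ → ℕ → ℚ} {α : ℕ → ℚ} → Bdd ev α → HasMean (λ q k → u (M ℕ.* q) k) α →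
                   HasMean (λ n k → 𝟙 (M ∣? n) * u n k) (λ k → inv (ℕ→ℚ M) * α k)
  mean-multiples {u} {α} b (hasMean h) = hasMean $ lim-cong (λ (N , k) → sym (e N k)) (λ _ → refl)
    (lim-* (lim-bdd (lim-∘proj₁ lim-/) (bdd-const (inv (ℕ→ℚ M)))) (bdd-∘proj₂ b)
           (lim-∘proj₁ lim-/) (lim-reindex /-unbounded h))
    where
    e : ∀ N k → avg (λ n k → 𝟙 (M ∣? n) * u n k) (N , k) ≡
                inv (ℕ→ℚ N) * ℕ→ℚ (N / M) * avg (λ q k → u (M ℕ.* q) k) (N / M , k)
    e N k = trans (cong (inv (ℕ→ℚ N) *_) (∑-multiples M (λ n → u n k) N)) (g (N / M))
      where
      i = inv (ℕ→ℚ N)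
      g : ∀ K → i * ∑ (λ q → u (M ℕ.* q) k) K ≡ i * ℕ→ℚ K * avg (λ q k → u (M ℕ.* q) k) (K , k)
      g zero    = trans (*-zeroʳ i) (sym (trans (cong (i * 0ℚ *_) (*-zeroʳ (inv (ℕ→ℚ 0)))) (*-zeroʳ (i * 0ℚ))))
      g (suc K) = sym (trans (ring i (ℕ→ℚ (suc K)) (inv (ℕ→ℚ (suc K))) s)
        (trans (cong (λ t → i * (t * s)) (inv-inverseʳ (pos⇒≢0 (ℕ→ℚ-pos {suc K} (s≤s z≤n))))) (cong (i *_) (*-identityˡ s))))
        where
        s = ∑ (λ q → u (M ℕ.* q) k) (suc K)
        ring : ∀ i K j s → i * K * (j * s) ≡ i * ((K * j) * s)
        ring = solve-∀ ringℚ

module _ (M : ℕ → ℕ) where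

  -- M i = 0 means that no condition is imposed at i: 0 divides no n ≥ 1, and inv 0 = 0.
  sieve : ℕ → ℕ → ℚ
  sieve y q = ∏ (λ i → 1ℚ - 𝟙 (M i ∣? q)) y

  sieveDensity : ℕ → ℚ
  sieveDensity y = ∏ (λ i → 1ℚ - inv (ℕ→ℚ (M i))) y

  module CoprimeModuli (M-coprime : ∀ i j q → i ≢ j → M j ≢ 0 → M i ∣ M j ℕ.* q → M i ∣ q) where

    -- Pairwise coprimality enters only here: imposing divisibility by the next modulus does not
    -- disturb the earlier conditions.
    sieve-* : ∀ y q → M (suc y) ≢ 0 → sieve y (M (suc y) ℕ.* q) ≡ sieve y q
    sieve-* y q M≢0 = ∏-cong y λ i _ i≤y → cong (λ t → 1ℚ - t) (𝟙-⇔ (M i ∣? (M (suc y) ℕ.* q)) (M i ∣? q)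
      (M-coprime i (suc y) q (ℕₚ.<⇒≢ (s≤s i≤y)) M≢0) (λ d → Div.∣n⇒∣m*n (M (suc y)) d))

    module _ {γ : ℕ → ℕ → ℚ} {α : ℕ → ℚ} (b : Bdd ev α)
             (h : ∀ m → 1 ≤ m → HasMean (λ n k → γ (m ℕ.* n) k) α) where

      -- A new modulus M subtracts the mean over its multiples, where the function becomes the
      -- dilate of γ by mM. So the induction must be run for all `m` at once, and each step
      -- multiplies the mean by 1 - 1/M.
      mean-sieve : ∀ y m → 1 ≤ m → HasMean (λ q k → sieve y q * γ (m ℕ.* q) k) (λ k → sieveDensity y * α k)
      mean-sieve zero m 1≤m =
        mean-cong (λ n k _ → sym (*-identityˡ (γ (m ℕ.* n) k))) (mean-cong-α (λ k → sym (*-identityˡ (α k))) (h m 1≤m))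
      mean-sieve (suc y) m 1≤m with M (suc y) in eq
      ... | zero  = mean-cong (λ q k 1≤q → cong (_* γ (m ℕ.* q) k)
              (sym (trans (cong (λ t → sieve y q * (1ℚ - t)) (𝟙-no (0 ∣? q) λ d → ℕₚ.<⇒≢ 1≤q (sym (Div.0∣⇒≡0 d))))
                (*-identityʳ (sieve y q)))))
            (mean-cong-α (λ k → cong (_* α k) (sym (*-identityʳ (sieveDensity y)))) (mean-sieve y m 1≤m))
      ... | M′@(suc _) = mean-cong (λ q k _ → e (sieve y q) (𝟙 (M′ ∣? q)) (γ (m ℕ.* q) k))
            (mean-cong-α (λ k → e (sieveDensity y) (inv (ℕ→ℚ M′)) (α k))
              (mean-+ (mean-sieve y m 1≤m) (mean-neg (mean-multiples M′ {u = λ q k → sieve y q * γ (m ℕ.* q) k}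
                (bdd-* (bdd-const (sieveDensity y)) b)
                (mean-cong (λ q k _ → cong₂ _*_ (sym (shift q)) (cong (λ t → γ t k) (ℕₚ.*-assoc m M′ q)))
                  (mean-sieve y (m ℕ.* M′) (ℕₚ.*-mono-≤ 1≤m (s≤s z≤n))))))))
        where
        e : ∀ s t g → s * g - t * (s * g) ≡ s * (1ℚ - t) * g
        e = solve-∀ ringℚ
        shift : ∀ q → sieve y (M′ ℕ.* q) ≡ sieve y q
        shift q = subst (λ t → sieve y (t ℕ.* q) ≡ sieve y q) eq (sieve-* y q λ z → ℕₚ.1+n≢0 (trans (sym eq) z))

-- Squarefull parts

prime-≥1 : ∀ {p} → Prime p → 1 ≤ p
prime-≥1 {p} pp = ℕ.>-nonZero⁻¹ p {{prime⇒nonZero pp}}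

prime-≥2 : ∀ {p} → Prime p → 2 ≤ p
prime-≥2 {p} pp = ℕ.nonTrivial⇒n>1 p {{prime⇒nonTrivial pp}}

∣⇒≤′ : ∀ {m n} → 1 ≤ n → m ∣ n → m ≤ n
∣⇒≤′ {n = n} 1≤n d = ∣⇒≤ {{ℕ.>-nonZero 1≤n}} d

∣-≥1 : ∀ {m n} → 1 ≤ n → m ∣ n → 1 ≤ m
∣-≥1 {zero}  1≤n d = contradiction (Div.0∣⇒≡0 d) (ℕₚ.<⇒≢ 1≤n ∘ sym)
∣-≥1 {suc m} 1≤n d = s≤s z≤n

*-≥1 : ∀ {m n} → 1 ≤ m → 1 ≤ n → 1 ≤ m ℕ.* n
*-≥1 {m} {n} p q = ℕₚ.*-mono-≤ p q

*-≥1ʳ : ∀ m {n} → 1 ≤ m ℕ.* n → 1 ≤ n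
*-≥1ʳ m {n} h = ∣-≥1 h (n∣m*n m)

*-≥1ˡ : ∀ {m} n → 1 ≤ m ℕ.* n → 1 ≤ m
*-≥1ˡ n h = ∣-≥1 h (m∣m*n n)

primeDivisor : ∀ {n} → 2 ≤ n → ∃[ p ] (Prime p × p ∣ n)
primeDivisor {n@(suc _)} 2≤n with factorise n
... | record { factors = []; isFactorisation = e } = contradiction e (ℕₚ.<⇒≢ 2≤n ∘ sym)
... | record { factors = p ∷ ps; isFactorisation = e; factorsPrime = pp ∷ _ } =
  p , pp , subst (p ∣_) (sym e) (m∣m*n _)

prime-∣-prime : ∀ {p q} → Prime p → Prime q → p ∣ q → p ≡ q
prime-∣-prime pp pq d with prime⇒irreducible pq d
... | inj₁ refl = contradiction pp ¬prime[1]
... | inj₂ e    = e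

prime-∣-^2 : ∀ {p} q → Prime p → p ∣ q ℕ.^ 2 → p ∣ q
prime-∣-^2 q pp d with euclidsLemma q (q ℕ.* 1) pp d
... | inj₁ h = h
... | inj₂ h = subst (_ ∣_) (ℕₚ.*-identityʳ q) h

noCommonPrime⇒coprime : ∀ {m n} → 1 ≤ m → (∀ {p} → Prime p → p ∣ m → ¬ (p ∣ n)) → Coprime m n
noCommonPrime⇒coprime 1≤m h {zero}  (d , _) = contradiction (Div.0∣⇒≡0 d) (ℕₚ.<⇒≢ 1≤m ∘ sym)
noCommonPrime⇒coprime 1≤m h {suc zero} _ = refl
noCommonPrime⇒coprime 1≤m h {suc (suc i)} (d , e) =
  let p , pp , p∣i = primeDivisor {suc (suc i)} (s≤s (s≤s z≤n))
  in contradiction (∣-trans p∣i e) (h pp (∣-trans p∣i d))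

coprime⇒noCommonPrime : ∀ {m n p} → Coprime m n → Prime p → p ∣ m → ¬ (p ∣ n)
coprime⇒noCommonPrime c pp d e = ¬prime[1] (subst Prime (c (d , e)) pp)

prime∤⇒coprime : ∀ {p n} → Prime p → ¬ (p ∣ n) → Coprime p n
prime∤⇒coprime pp p∤n = noCommonPrime⇒coprime (prime-≥1 pp)
  λ pr r∣p r∣n → p∤n (subst (_∣ _) (prime-∣-prime pr pp r∣p) r∣n)

prime∤⇒coprime-^2 : ∀ {p n} → Prime p → ¬ (p ∣ n) → Coprime (p ℕ.^ 2) n
prime∤⇒coprime-^2 {p} pp p∤n = noCommonPrime⇒coprime (*-≥1 (prime-≥1 pp) (*-≥1 (prime-≥1 pp) (s≤s z≤n)))
  λ pr r∣p² r∣n → p∤n (subst (_∣ _) (prime-∣-prime pr pp (prime-∣-^2 p pr r∣p²)) r∣n)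

^2≡* : ∀ p → p ℕ.^ 2 ≡ p ℕ.* p
^2≡* p = cong (p ℕ.*_) (ℕₚ.*-identityʳ p)

p∣p^2 : ∀ p → p ∣ p ℕ.^ 2
p∣p^2 p = m∣m*n (p ℕ.^ 1)

squarefree-∣ : ∀ {m n} → m ∣ n → Squarefree n → Squarefree m
squarefree-∣ m∣n sf pp d = sf pp (∣-trans d m∣n)

squarefree-* : ∀ {p q} → Prime p → ¬ (p ∣ q) → Squarefree q → Squarefree (p ℕ.* q)
squarefree-* {p} {q} pp p∤q sf {r} pr d with r ℕₚ.≟ p
... | yes refl = p∤q (Div.*-cancelˡ-∣ p {{prime⇒nonZero pp}} (subst (_∣ p ℕ.* q) (^2≡* p) d))
... | no r≢p = sf pr (coprime-divisor (prime∤⇒coprime-^2 pr (λ r∣p → r≢p (prime-∣-prime pr pp r∣p))) d)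

squarefree[1] : Squarefree 1
squarefree[1] pp d = ¬prime[1] (subst Prime (Div.∣1⇒≡1 (∣-trans (p∣p^2 _) d)) pp)

squarefree-*⇒∤ : ∀ {p q} → Prime p → Squarefree (p ℕ.* q) → ¬ (p ∣ q)
squarefree-*⇒∤ {p} {q} pp sf d = sf pp (subst (_∣ p ℕ.* q) (sym (^2≡* p)) (Div.*-monoʳ-∣ p d))

<-prime* : ∀ {p t} → Prime p → 1 ≤ t → t ℕ.< p ℕ.* t
<-prime* {p} {t} pp 1≤t = subst (ℕ._< p ℕ.* t) (ℕₚ.*-identityˡ t)
  (ℕₚ.*-monoˡ-< t {{ℕ.>-nonZero 1≤t}} (prime-≥2 pp))

squarefullPart-∣ : ∀ {n f} → IsSquarefullPart n f → f ∣ n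
squarefullPart-∣ (q , e , _) = divides q e

-- Let n = r g be the second decomposition. A prime p of f has p² dividing r g; if p divided r it
-- would be prime to g, so p² would divide the squarefree r. Hence f is prime to r and divides g,
-- and the roles can be exchanged.
squarefullPart-unique : ∀ {n f g} → 1 ≤ n → IsSquarefullPart n f → IsSquarefullPart n g → f ≡ g
squarefullPart-unique {n} {f} {g} 1≤n F G = ∣-antisym (half 1≤n F G) (half 1≤n G F)
  where
  half : ∀ {n f g} → 1 ≤ n → IsSquarefullPart n f → IsSquarefullPart n g → f ∣ g
  half {n} {f} {g} 1≤n (q , e , _ , full , _) (r , e′ , sfr , _ , c) =
    coprime-divisor (noCommonPrime⇒coprime (*-≥1ʳ q (subst (1 ≤_) e 1≤n)) p∤r) f∣rg
    where
    f∣rg : f ∣ r ℕ.* g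
    f∣rg = subst (f ∣_) e′ (divides q e)
    p∤r : ∀ {p} → Prime p → p ∣ f → ¬ (p ∣ r)
    p∤r {p} pp p∣f p∣r = sfr pp (coprime-divisor
      (prime∤⇒coprime-^2 pp (coprime⇒noCommonPrime c pp p∣r))
      (subst (p ℕ.^ 2 ∣_) (ℕₚ.*-comm r g) (∣-trans (full pp p∣f) f∣rg)))

-- Strong induction: a prime dividing `n` exactly once is moved into the squarefree factor. If there
-- is no such prime, `n` is squarefull itself.
squarefullPart-exists : ∀ n → 1 ≤ n → ∃[ f ] IsSquarefullPart n f
squarefullPart-exists = <-rec _ λ n rec 1≤n →
  case n 1≤n (λ m m<n 1≤m → rec m<n 1≤m)
    (ℕₚ.anyUpTo? (λ p → prime? p ×-dec (p ∣? n ×-dec ¬? (p ℕ.^ 2 ∣? n))) (suc n))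
  where
  case : ∀ n → 1 ≤ n → (∀ m → m ℕ.< n → 1 ≤ m → ∃[ f ] IsSquarefullPart m f) →
         Dec (∃[ p ] (p ℕ.< suc n × (Prime p × (p ∣ n × ¬ (p ℕ.^ 2 ∣ n))))) → ∃[ f ] IsSquarefullPart n f
  case n 1≤n rec (no h) = n , 1 , sym (ℕₚ.*-identityˡ n) , squarefree[1] , full , Cop.1-coprimeTo n
    where
    full : Squarefull n
    full {p} pp p∣n with p ℕ.^ 2 ∣? n
    ... | yes d = d
    ... | no ¬d = contradiction (p , s≤s (∣⇒≤′ 1≤n p∣n) , pp , p∣n , ¬d) h
  case n 1≤n rec (yes (p , _ , pp , divides m e , p²∤n)) =
    let f , q , e′ , sfq , sff , c = rec m m<n 1≤m
        p∤q : ¬ (p ∣ q)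
        p∤q d = p∤m (subst (p ∣_) (sym e′) (Div.∣m⇒∣m*n f d))
        p∤f : ¬ (p ∣ f)
        p∤f d = p∤m (subst (p ∣_) (sym e′) (Div.∣n⇒∣m*n q d))
    in f , p ℕ.* q , trans n≡ (trans (cong (p ℕ.*_) e′) (sym (ℕₚ.*-assoc p q f))) ,
       squarefree-* pp p∤q sfq , sff ,
       noCommonPrime⇒coprime (*-≥1 (prime-≥1 pp) (*-≥1ˡ f (subst (1 ≤_) e′ 1≤m)))
         (λ {r} pr r∣pq r∣f → case-∣ pr r∣f p∤f c (euclidsLemma p q pr r∣pq))
    where
    n≡ : n ≡ p ℕ.* m
    n≡ = trans e (ℕₚ.*-comm m p)
    1≤m : 1 ≤ m
    1≤m = *-≥1ʳ p (subst (1 ≤_) n≡ 1≤n)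
    m<n : m ℕ.< n
    m<n = subst (m ℕ.<_) (sym n≡) (<-prime* pp 1≤m)
    p∤m : ¬ (p ∣ m)
    p∤m d = p²∤n (subst₂ _∣_ (sym (^2≡* p)) (sym n≡) (Div.*-monoʳ-∣ p d))
    case-∣ : ∀ {r q f} → Prime r → r ∣ f → ¬ (p ∣ f) → Coprime q f → r ∣ p ⊎ r ∣ q → _
    case-∣ pr r∣f p∤f c (inj₁ d) = p∤f (subst (_∣ _) (prime-∣-prime pr pp d) r∣f)
    case-∣ pr r∣f p∤f c (inj₂ d) = coprime⇒noCommonPrime c pr d r∣f

squarefullPart : ℕ → ℕ
squarefullPart zero    = 0
squarefullPart (suc n) = proj₁ (squarefullPart-exists (suc n) (s≤s z≤n))

squarefullPart-spec : ∀ n → 1 ≤ n → IsSquarefullPart n (squarefullPart n)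
squarefullPart-spec (suc n) _ = proj₂ (squarefullPart-exists (suc n) (s≤s z≤n))

squarefree∣ : ∀ t s → 1 ≤ t → Squarefree t → (∀ {p} → Prime p → p ∣ t → p ∣ s) → t ∣ s
squarefree∣ = <-rec _ step
  where
  step : ∀ t → (∀ {t′} → t′ ℕ.< t → ∀ s → 1 ≤ t′ → Squarefree t′ → (∀ {p} → Prime p → p ∣ t′ → p ∣ s) → t′ ∣ s) →
         ∀ s → 1 ≤ t → Squarefree t → (∀ {p} → Prime p → p ∣ t → p ∣ s) → t ∣ s
  step (suc zero) rec s 1≤t sf h = Div.1∣ s
  step t@(suc (suc _)) rec s 1≤t sf h with primeDivisor {t} (s≤s (s≤s z≤n))
  ... | p , pp , divides t′ e with h pp (divides t′ e)
  ...   | divides s′ e″ = subst₂ _∣_ (sym e) (sym e″) (Div.*-monoˡ-∣ p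
          (coprime-divisor {n = p} (Cop.sym (prime∤⇒coprime pp p∤t′))
            (subst (t′ ∣_) (trans e″ (ℕₚ.*-comm s′ p))
              (rec t′<t s 1≤t′ (squarefree-∣ t′∣t sf) (λ pr d → h pr (∣-trans d t′∣t))))))
    where
    t≡ : t ≡ p ℕ.* t′
    t≡ = trans e (ℕₚ.*-comm t′ p)
    t′∣t : t′ ∣ t
    t′∣t = divides p t≡
    1≤t′ : 1 ≤ t′
    1≤t′ = *-≥1ʳ p (subst (1 ≤_) t≡ 1≤t)
    t′<t : t′ ℕ.< t
    t′<t = subst (t′ ℕ.<_) (sym t≡) (<-prime* pp 1≤t′)
    p∤t′ : ¬ (p ∣ t′)
    p∤t′ = squarefree-*⇒∤ pp (subst Squarefree t≡ sf)

-- Strong induction, pulling out p² for a prime p as long as there is one.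
squarePart : ∀ n → 1 ≤ n → ∃[ s ] ∃[ t ] (n ≡ s ℕ.* s ℕ.* t × Squarefree t)
squarePart = <-rec _ λ n rec 1≤n → case n 1≤n (λ m m<n 1≤m → rec m<n 1≤m)
    (ℕₚ.anyUpTo? (λ p → prime? p ×-dec (p ℕ.^ 2 ∣? n)) (suc n))
  where
  case : ∀ n → 1 ≤ n → (∀ m → m ℕ.< n → 1 ≤ m → ∃[ s ] ∃[ t ] (m ≡ s ℕ.* s ℕ.* t × Squarefree t)) →
         Dec (∃[ p ] (p ℕ.< suc n × (Prime p × p ℕ.^ 2 ∣ n))) → ∃[ s ] ∃[ t ] (n ≡ s ℕ.* s ℕ.* t × Squarefree t)
  case n 1≤n rec (no h) = 1 , n , sym (ℕₚ.*-identityˡ n) ,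
    λ {p} pp d → h (p , s≤s (∣⇒≤′ 1≤n (∣-trans (p∣p^2 p) d)) , pp , d)
  case n 1≤n rec (yes (p , _ , pp , divides m e)) =
    let s , t , e′ , sf = rec m m<n 1≤m
    in p ℕ.* s , t , trans n≡ (trans (cong (p ℕ.* p ℕ.*_) e′) (ring p s t)) , sf
    where
    ring : ∀ p s t → p ℕ.* p ℕ.* (s ℕ.* s ℕ.* t) ≡ p ℕ.* s ℕ.* (p ℕ.* s) ℕ.* t
    ring = solve-ℕ
    n≡ : n ≡ p ℕ.* p ℕ.* m
    n≡ = trans e (trans (ℕₚ.*-comm m (p ℕ.^ 2)) (cong (ℕ._* m) (^2≡* p)))
    1≤m : 1 ≤ m
    1≤m = *-≥1ʳ (p ℕ.* p) (subst (1 ≤_) n≡ 1≤n)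
    m<n : m ℕ.< n
    m<n = subst (m ℕ.<_) (trans (sym (ℕₚ.*-assoc p p m)) (sym n≡))
      (ℕₚ.<-≤-trans (<-prime* pp 1≤m) (ℕₚ.*-monoʳ-≤ p (ℕₚ.<⇒≤ (<-prime* pp 1≤m))))

-- Write f = s²t with t squarefree. A prime p of t must divide s, since otherwise p², which divides
-- s²t, would divide t. So the squarefree t divides s, and f = s²t ≤ s³.
squarefull⇒bigSquare : ∀ {f} → 1 ≤ f → Squarefull f → ∃[ s ] (1 ≤ s × s ℕ.* s ∣ f × f ≤ s ℕ.* s ℕ.* s)
squarefull⇒bigSquare {f} 1≤f full with squarePart f 1≤f
... | s , t , e , sft = s , 1≤s , divides t (trans e (ℕₚ.*-comm (s ℕ.* s) t)) ,
    subst (_≤ s ℕ.* s ℕ.* s) (sym e) (ℕₚ.*-monoʳ-≤ (s ℕ.* s) (∣⇒≤′ 1≤s t∣s))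
  where
  1≤sst : 1 ≤ s ℕ.* s ℕ.* t
  1≤sst = subst (1 ≤_) e 1≤f
  1≤s : 1 ≤ s
  1≤s = *-≥1ʳ s (*-≥1ˡ t 1≤sst)
  t∣s : t ∣ s
  t∣s = squarefree∣ t s (*-≥1ʳ (s ℕ.* s) 1≤sst) sft p∣s
    where
    p∣s : ∀ {p} → Prime p → p ∣ t → p ∣ s
    p∣s {p} pp p∣t with p ∣? s
    ... | yes d = d
    ... | no ¬d = contradiction (coprime-divisor (prime∤⇒coprime-^2 pp ¬d)
            (coprime-divisor (prime∤⇒coprime-^2 pp ¬d)
              (subst (p ℕ.^ 2 ∣_) (trans e (ℕₚ.*-assoc s s t))
                (full pp (subst (p ∣_) (sym e) (Div.∣n⇒∣m*n (s ℕ.* s) p∣t)))))) (sft pp)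

-- Divisor sums and products over primes

∑-tail : ∀ {u : ℕ → ℚ} {m n} → m ≤ n → (∀ i → m ℕ.< i → u i ≡ 0ℚ) → ∑ u n ≡ ∑ u m
∑-tail {u} {m} {n} m≤n h with ℕₚ.m≤n⇒m<n∨m≡n m≤n
... | inj₂ refl = refl
∑-tail {u} {m} {suc n} m≤n h | inj₁ (s≤s m≤n′) =
  trans (cong₂ _+_ (∑-tail m≤n′ h) (h (suc n) (s≤s m≤n′))) (+-identityʳ (∑ u m))

∏-tail : ∀ {u : ℕ → ℚ} {m n} → m ≤ n → (∀ i → m ℕ.< i → u i ≡ 1ℚ) → ∏ u n ≡ ∏ u m
∏-tail {u} {m} {n} m≤n h with ℕₚ.m≤n⇒m<n∨m≡n m≤n
... | inj₂ refl = refl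
∏-tail {u} {m} {suc n} m≤n h | inj₁ (s≤s m≤n′) =
  trans (cong₂ _*_ (∏-tail m≤n′ h) (h (suc n) (s≤s m≤n′))) (*-identityʳ (∏ u m))

∏-* : ∀ u v N → ∏ (λ n → u n * v n) N ≡ ∏ u N * ∏ v N
∏-* u v zero    = refl
∏-* u v (suc N) = trans (cong (_* (u (suc N) * v (suc N))) (∏-* u v N)) (e (∏ u N) (∏ v N) (u (suc N)) (v (suc N)))
  where
  e : ∀ a b c d → (a * b) * (c * d) ≡ (a * c) * (b * d)
  e = solve-∀ ringℚ

∏-change : ∀ {u v : ℕ → ℚ} {c p} N → 1 ≤ p → p ≤ N → (∀ i → i ≢ p → u i ≡ v i) → u p ≡ c * v p →
           ∏ u N ≡ c * ∏ v N
∏-change zero 1≤p p≤N h e = contradiction (ℕₚ.≤-trans 1≤p p≤N) λ ()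
∏-change {u} {v} {c} {p} (suc N) 1≤p p≤N h e with p ℕₚ.≟ suc N
... | yes refl = trans (cong₂ _*_ (∏-cong N λ n _ n≤N → h n (ℕₚ.<⇒≢ (s≤s n≤N))) e) (r (∏ v N) c (v p))
  where
  r : ∀ a b c → a * (b * c) ≡ b * (a * c)
  r = solve-∀ ringℚ
... | no p≢ = trans (cong₂ _*_ (∏-change {u} {v} {c} N 1≤p (ℕₚ.≤-pred (ℕₚ.≤∧≢⇒< p≤N p≢)) h e) (h (suc N) (p≢ ∘ sym)))
  (*-assoc c (∏ v N) (v (suc N)))

-- With the factor 1 at every other index, a product over the primes of `n` becomes a product over
-- an interval. Extended to a common range, the products for different `n` can be compared factor by
-- factor.
primeFactorOr1 : (ℕ → ℚ) → ℕ → ℕ → ℚ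
primeFactorOr1 φ n i = if does (prime? i ×-dec i ∣? n) then φ i else 1ℚ

∏ₚ : (ℕ → ℚ) → ℕ → ℚ
∏ₚ φ n = ∏ (primeFactorOr1 φ n) n

primeFactorOr1-yes : ∀ φ {n i} → Prime i → i ∣ n → primeFactorOr1 φ n i ≡ φ i
primeFactorOr1-yes φ {n} {i} pi d = if-yes (prime? i ×-dec i ∣? n) (pi , d)

primeFactorOr1-no : ∀ φ {n i} → ¬ (Prime i × i ∣ n) → primeFactorOr1 φ n i ≡ 1ℚ
primeFactorOr1-no φ {n} {i} = if-no (prime? i ×-dec i ∣? n)

primeFactorOr1-⇔ : ∀ φ {m n i} → (Prime i → i ∣ m → i ∣ n) → (Prime i → i ∣ n → i ∣ m) →
                   primeFactorOr1 φ m i ≡ primeFactorOr1 φ n i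
primeFactorOr1-⇔ φ {m} {n} {i} f g = case (prime? i ×-dec i ∣? m)
  where
  case : Dec (Prime i × i ∣ m) → primeFactorOr1 φ m i ≡ primeFactorOr1 φ n i
  case (yes (pi , d)) = trans (primeFactorOr1-yes φ pi d) (sym (primeFactorOr1-yes φ pi (f pi d)))
  case (no h)         = trans (primeFactorOr1-no φ h) (sym (primeFactorOr1-no φ λ (pi , d) → h (pi , g pi d)))

∏ₚ-extend : ∀ φ {n} y → 1 ≤ n → n ≤ y → ∏ (primeFactorOr1 φ n) y ≡ ∏ₚ φ n
∏ₚ-extend φ y 1≤n n≤y = ∏-tail n≤y λ i n<i →
  primeFactorOr1-no φ λ (_ , d) → ℕₚ.<⇒≱ n<i (∣⇒≤′ 1≤n d)

∏ₚ-* : ∀ φ {p m} → Prime p → ¬ (p ∣ m) → 1 ≤ m → ∏ₚ φ (p ℕ.* m) ≡ φ p * ∏ₚ φ m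
∏ₚ-* φ {p} {m} pp p∤m 1≤m = trans
  (∏-change {primeFactorOr1 φ (p ℕ.* m)} {primeFactorOr1 φ m} {φ p} (p ℕ.* m) (prime-≥1 pp)
    (ℕₚ.m≤m*n p m {{ℕ.>-nonZero 1≤m}})
    (λ i i≢p → primeFactorOr1-⇔ φ (λ pi d → coprime-divisor {n = p}
        (prime∤⇒coprime pi (λ i∣p → i≢p (prime-∣-prime pi pp i∣p))) d) (λ _ → Div.∣n⇒∣m*n p))
    (trans (primeFactorOr1-yes φ pp (m∣m*n m))
      (sym (trans (cong (φ p *_) (primeFactorOr1-no φ (λ (_ , d) → p∤m d))) (*-identityʳ (φ p))))))
  (cong (φ p *_) (∏ₚ-extend φ (p ℕ.* m) 1≤m (ℕₚ.m≤n*m m p {{prime⇒nonZero pp}})))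

∏ₚ-1 : ∀ φ → ∏ₚ φ 1 ≡ 1ℚ
∏ₚ-1 φ = trans (*-identityˡ _) (primeFactorOr1-no φ {1} {1} λ (p , _) → ¬prime[1] p)

foldr-primeDivisors : ∀ φ n → foldr (λ p r → φ p * r) 1ℚ (primeDivisors n) ≡ ∏ₚ φ n
foldr-primeDivisors φ n = go n
  where
  Q? : ∀ p → Dec (Prime p × p ∣ n)
  Q? p = prime? p ×-dec p ∣? n
  f : ℕ → ℚ → ℚ
  f p r = φ p * r
  pull : ∀ x xs → foldr f x xs ≡ foldr f 1ℚ xs * x
  pull x []       = sym (*-identityˡ x)
  pull x (p ∷ xs) = trans (cong (φ p *_) (pull x xs)) (sym (*-assoc (φ p) (foldr f 1ℚ xs) x))
  single : ∀ i → foldr f 1ℚ (filter Q? (i ∷ [])) ≡ primeFactorOr1 φ n i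
  single i = case (Q? i)
    where
    case : Dec (Prime i × i ∣ n) → foldr f 1ℚ (filter Q? (i ∷ [])) ≡ primeFactorOr1 φ n i
    case (yes h) = trans (cong (foldr f 1ℚ) (filter-accept Q? h))
      (trans (*-identityʳ (φ i)) (sym (if-yes (Q? i) h)))
    case (no h)  = trans (cong (foldr f 1ℚ) (filter-reject Q? h)) (sym (if-no (Q? i) h))
  go : ∀ y → foldr f 1ℚ (filter Q? (upTo (suc y))) ≡ ∏ (primeFactorOr1 φ n) y
  go zero    = trans (single 0) (primeFactorOr1-no φ {n} {0} λ (p , _) → ¬prime[0] p)
  go (suc y) = trans (cong (foldr f 1ℚ ∘ filter Q?) (sym (upTo-∷ʳ (suc y))))
    (trans (cong (foldr f 1ℚ) (filter-++ Q? (upTo (suc y)) (suc y ∷ [])))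
      (trans (foldr-++ f 1ℚ (filter Q? (upTo (suc y))) (filter Q? (suc y ∷ [])))
        (trans (pull _ (filter Q? (upTo (suc y)))) (cong₂ _*_ (go y) (single (suc y))))))

1+1/ : ℕ → ℚ
1+1/ p = 1ℚ + inv (ℕ→ℚ p)

∏[1+1/p]≡∏ₚ : ∀ n → ∏[1+1/p] n ≡ ∏ₚ 1+1/ n
∏[1+1/p]≡∏ₚ n = foldr-primeDivisors 1+1/ n

μ≡∏ₚ : ∀ n → μ n ≡ 𝟙 (squarefree? n) * ∏ₚ (λ _ → - 1ℚ) n
μ≡∏ₚ n with squarefree? n
... | yes _ = trans (go (primeDivisors n))
                (trans (foldr-primeDivisors (λ _ → - 1ℚ) n) (sym (*-identityˡ (∏ₚ (λ _ → - 1ℚ) n))))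
  where
  go : ∀ (xs : List ℕ) → (- 1ℚ) ^ℚ length xs ≡ foldr (λ _ r → - 1ℚ * r) 1ℚ xs
  go []       = refl
  go (_ ∷ xs) = cong (- 1ℚ *_) (go xs)
... | no _  = sym (*-zeroˡ (∏ₚ (λ _ → - 1ℚ) n))

divisorSum : (ℕ → ℚ) → ℕ → ℚ
divisorSum u n = ∑ (λ e → 𝟙 (e ∣? n) * u e) n

divisorSum-extend : ∀ u {n} y → 1 ≤ n → n ≤ y → ∑ (λ e → 𝟙 (e ∣? n) * u e) y ≡ divisorSum u n
divisorSum-extend u {n} y 1≤n n≤y = ∑-tail n≤y λ i n<i →
  𝟙-no-* (i ∣? n) (λ d → ℕₚ.<⇒≱ n<i (∣⇒≤′ 1≤n d)) (u i)

module _ {u h : ℕ → ℚ} (u-* : ∀ {p q} → Prime p → ¬ (p ∣ q) → 1 ≤ q → u (p ℕ.* q) ≡ h p * u q) where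

  -- The divisors of pm prime to p are those of m; the others are pq with q ∣ m, and they contribute
  -- `h p` times the same sum.
  divisorSum-* : ∀ {p m} → Prime p → ¬ (p ∣ m) → 1 ≤ m → divisorSum u (p ℕ.* m) ≡ (1ℚ + h p) * divisorSum u m
  divisorSum-* {p} {m} pp p∤m 1≤m = trans (∑-cong D λ e _ _ → split e)
    (trans (∑-+ (λ e → 𝟙 (e ∣? m) * u e) (λ e → 𝟙 (p ∣? e) * (𝟙 (e ∣? D) * u e)) D)
      (trans (cong₂ _+_ (divisorSum-extend u D 1≤m m≤D) second) (ring (h p) (divisorSum u m))))
    where
    instance
      _ : ℕ.NonZero p
      _ = prime⇒nonZero pp
    D = p ℕ.* m
    m≤D : m ≤ D
    m≤D = ℕₚ.m≤n*m m p
    ring : ∀ h s → s + h * s ≡ (1ℚ + h) * s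
    ring = solve-∀ ringℚ
    z : ∀ x → 0ℚ * x ≡ 0ℚ
    z = *-zeroˡ
    split : ∀ e → 𝟙 (e ∣? D) * u e ≡ 𝟙 (e ∣? m) * u e + 𝟙 (p ∣? e) * (𝟙 (e ∣? D) * u e)
    split e with p ∣? e
    ... | yes p∣e = sym (trans (cong₂ _+_ (trans (cong (_* u e) (𝟙-no (e ∣? m) λ d → p∤m (∣-trans p∣e d))) (z (u e)))
                      (*-identityˡ (𝟙 (e ∣? D) * u e))) (+-identityˡ _))
    ... | no p∤e  = trans (cong (_* u e) (𝟙-⇔ (e ∣? D) (e ∣? m)
                      (coprime-divisor {n = p} (Cop.sym (prime∤⇒coprime pp p∤e))) (Div.∣n⇒∣m*n p)))
                      (sym (trans (cong (𝟙 (e ∣? m) * u e +_) (z (𝟙 (e ∣? D) * u e))) (+-identityʳ _)))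
    D/p : D / p ≡ m
    D/p = trans (cong (_/ p) (ℕₚ.*-comm p m)) (m*n/n≡m m p)
    second : ∑ (λ e → 𝟙 (p ∣? e) * (𝟙 (e ∣? D) * u e)) D ≡ h p * divisorSum u m
    second = trans (∑-multiples p (λ e → 𝟙 (e ∣? D) * u e) D)
      (trans (cong (∑ (λ q → 𝟙 (p ℕ.* q ∣? D) * u (p ℕ.* q))) D/p)
        (trans (∑-cong m λ q 1≤q _ → trans
            (cong (_* u (p ℕ.* q)) (𝟙-⇔ (p ℕ.* q ∣? D) (q ∣? m) (Div.*-cancelˡ-∣ p) (Div.*-monoʳ-∣ p)))
            (trans (𝟙-*-cong (q ∣? m) λ q∣m → u-* pp (λ d → p∤m (∣-trans d q∣m)) 1≤q) (*-swap (𝟙 (q ∣? m)) (h p) (u q))))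
          (∑-* (h p) (λ e → 𝟙 (e ∣? m) * u e) m)))

σ≡divisorSum : ∀ n → ℕ→ℚ (σ n) ≡ divisorSum ℕ→ℚ n
σ≡divisorSum n = go n
  where
  f : ℕ → ℕ → ℕ
  f = ℕ._+_
  pull : ∀ x xs → ℕ→ℚ (foldr f x xs) ≡ ℕ→ℚ (foldr f 0 xs) + ℕ→ℚ x
  pull x []       = sym (+-identityˡ (ℕ→ℚ x))
  pull x (p ∷ xs) = trans (ℕ→ℚ-+ p (foldr f x xs)) (trans (cong (ℕ→ℚ p +_) (pull x xs))
    (trans (sym (ℚₚ.+-assoc (ℕ→ℚ p) (ℕ→ℚ (foldr f 0 xs)) (ℕ→ℚ x)))
      (cong (_+ ℕ→ℚ x) (sym (ℕ→ℚ-+ p (foldr f 0 xs))))))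
  single : ∀ i → ℕ→ℚ (foldr f 0 (filter (_∣? n) (i ∷ []))) ≡ 𝟙 (i ∣? n) * ℕ→ℚ i
  single i with i ∣? n
  ... | yes _ = trans (cong ℕ→ℚ (ℕₚ.+-identityʳ i)) (sym (*-identityˡ (ℕ→ℚ i)))
  ... | no _  = sym (*-zeroˡ (ℕ→ℚ i))
  go : ∀ y → ℕ→ℚ (foldr f 0 (filter (_∣? n) (upTo (suc y)))) ≡ ∑ (λ e → 𝟙 (e ∣? n) * ℕ→ℚ e) y
  go zero    = trans (single 0) (*-zeroʳ (𝟙 (0 ∣? n)))
  go (suc y) = trans (cong (ℕ→ℚ ∘ foldr f 0 ∘ filter (_∣? n)) (sym (upTo-∷ʳ (suc y))))
    (trans (cong (ℕ→ℚ ∘ foldr f 0) (filter-++ (_∣? n) (upTo (suc y)) (suc y ∷ [])))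
      (trans (cong ℕ→ℚ (foldr-++ f 0 (filter (_∣? n) (upTo (suc y))) (filter (_∣? n) (suc y ∷ []))))
        (trans (pull _ (filter (_∣? n) (upTo (suc y)))) (cong₂ _+_ (go y) (single (suc y))))))

σ-* : ∀ {p m} → Prime p → ¬ (p ∣ m) → 1 ≤ m → ℕ→ℚ (σ (p ℕ.* m)) ≡ (1ℚ + ℕ→ℚ p) * ℕ→ℚ (σ m)
σ-* {p} {m} pp p∤m 1≤m = trans (σ≡divisorSum (p ℕ.* m))
  (trans (divisorSum-* {ℕ→ℚ} {ℕ→ℚ} (λ {p} {q} _ _ _ → ℕ→ℚ-* p q) pp p∤m 1≤m)
    (cong ((1ℚ + ℕ→ℚ p) *_) (sym (σ≡divisorSum m))))

squarefree-induction : (P : ℕ → Set) → P 1 →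
  (∀ {p m} → Prime p → ¬ (p ∣ m) → 1 ≤ m → Squarefree m → P m → P (p ℕ.* m)) → ∀ n → 1 ≤ n → Squarefree n → P n
squarefree-induction P base step = <-rec _ go
  where
  go : ∀ n → (∀ {m} → m ℕ.< n → 1 ≤ m → Squarefree m → P m) → 1 ≤ n → Squarefree n → P n
  go (suc zero) rec 1≤n sf = base
  go n@(suc (suc _)) rec 1≤n sf with primeDivisor {n} (s≤s (s≤s z≤n))
  ... | p , pp , divides m e = subst P (sym n≡) (step pp p∤m 1≤m (squarefree-∣ m∣n sf)
          (rec (subst (m ℕ.<_) (sym n≡) (<-prime* pp 1≤m)) 1≤m (squarefree-∣ m∣n sf)))
    where
    n≡ : n ≡ p ℕ.* m
    n≡ = trans e (ℕₚ.*-comm m p)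
    m∣n : m ∣ n
    m∣n = divides p n≡
    1≤m : 1 ≤ m
    1≤m = *-≥1ʳ p (subst (1 ≤_) n≡ 1≤n)
    p∤m : ¬ (p ∣ m)
    p∤m = squarefree-*⇒∤ pp (subst Squarefree n≡ sf)

p*[1+1/p] : ∀ {p} → 1 ≤ p → ℕ→ℚ p * 1+1/ p ≡ 1ℚ + ℕ→ℚ p
p*[1+1/p] {p} 1≤p = trans (ring (ℕ→ℚ p) (inv (ℕ→ℚ p)))
  (trans (cong (_+ ℕ→ℚ p) (inv-inverseʳ (pos⇒≢0 (ℕ→ℚ-pos 1≤p)))) refl)
  where
  ring : ∀ a b → a * (1ℚ + b) ≡ a * b + a
  ring = solve-∀ ringℚ

-- The Dedekind function; it agrees with σ at squarefree n.
ψ : ℕ → ℚ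
ψ n = ℕ→ℚ n * ∏[1+1/p] n

ψ-* : ∀ {p m} → Prime p → ¬ (p ∣ m) → 1 ≤ m → ψ (p ℕ.* m) ≡ (1ℚ + ℕ→ℚ p) * ψ m
ψ-* {p} {m} pp p∤m 1≤m = trans
  (cong₂ _*_ (ℕ→ℚ-* p m) (trans (∏[1+1/p]≡∏ₚ (p ℕ.* m)) (∏ₚ-* 1+1/ pp p∤m 1≤m)))
  (trans (ring (ℕ→ℚ p) (ℕ→ℚ m) (1+1/ p) (∏ₚ 1+1/ m))
    (cong₂ (λ x y → x * (ℕ→ℚ m * y)) (p*[1+1/p] (prime-≥1 pp)) (sym (∏[1+1/p]≡∏ₚ m))))
  where
  ring : ∀ a b c d → (a * b) * (c * d) ≡ (a * c) * (b * d)
  ring = solve-∀ ringℚ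

σ≡ψ : ∀ n → 1 ≤ n → Squarefree n → ℕ→ℚ (σ n) ≡ ψ n
σ≡ψ = squarefree-induction (λ n → ℕ→ℚ (σ n) ≡ ψ n) refl
  λ {p} pp p∤m 1≤m _ e → trans (σ-* pp p∤m 1≤m) (trans (cong ((1ℚ + ℕ→ℚ p) *_) e) (sym (ψ-* pp p∤m 1≤m)))

σ-pos : ∀ {n} → 1 ≤ n → 0ℚ <ℚ ℕ→ℚ (σ n)
σ-pos {n@(suc _)} 1≤n = subst (0ℚ <ℚ_) (sym (σ≡divisorSum n)) (<-≤-trans (ℕ→ℚ-pos 1≤n)
  (subst (_≤ℚ divisorSum ℕ→ℚ n) (𝟙-yes-* (n ∣? n) ∣-refl (ℕ→ℚ n))
    (∑-term {λ e → 𝟙 (e ∣? n) * ℕ→ℚ e} n n (λ i _ _ → *-≥0 (𝟙-≥0 (i ∣? n)) (ℕ→ℚ-≥0 i)) 1≤n ℕₚ.≤-refl)))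

gcd-≥1ˡ : ∀ {m} n → 1 ≤ m → 1 ≤ gcd m n
gcd-≥1ˡ {m} n 1≤m = ∣-≥1 1≤m (gcd[m,n]∣m m n)

gcd-prime-∤ : ∀ {p d f} → Prime p → ¬ (p ∣ f) → gcd (p ℕ.* d) f ≡ gcd d f
gcd-prime-∤ {p} {d} {f} pp p∤f = ∣-antisym
  (gcd-greatest (coprime-divisor {n = p} (noCommonPrime (gcd[m,n]∣n (p ℕ.* d) f)) (gcd[m,n]∣m (p ℕ.* d) f)) (gcd[m,n]∣n (p ℕ.* d) f))
  (gcd-greatest (Div.∣n⇒∣m*n p (gcd[m,n]∣m d f)) (gcd[m,n]∣n d f))
  where
  noCommonPrime : ∀ {g} → g ∣ f → Coprime g p
  noCommonPrime g∣f = Cop.sym (prime∤⇒coprime pp λ p∣g → p∤f (∣-trans p∣g g∣f))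

gcd-prime-∣ : ∀ {p d f} → Prime p → ¬ (p ∣ d) → p ∣ f → gcd (p ℕ.* d) f ≡ p ℕ.* gcd d f
gcd-prime-∣ {p} {d} {f} pp p∤d p∣f = ∣-antisym
  (helper (gcd-greatest (m∣m*n d) p∣f) (gcd[m,n]∣m (p ℕ.* d) f) (gcd[m,n]∣n (p ℕ.* d) f))
  (gcd-greatest (Div.*-monoʳ-∣ p (gcd[m,n]∣m d f)) (pg∣f p∣f))
  where
  helper : ∀ {g} → p ∣ g → g ∣ p ℕ.* d → g ∣ f → g ∣ p ℕ.* gcd d f
  helper {g} (divides g′ e) g∣pd g∣f = subst (_∣ p ℕ.* gcd d f) (sym g≡) (Div.*-monoʳ-∣ p (gcd-greatest
      (Div.*-cancelˡ-∣ p {{prime⇒nonZero pp}} (subst (_∣ p ℕ.* d) g≡ g∣pd))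
      (∣-trans (divides p g≡) g∣f)))
    where
    g≡ : g ≡ p ℕ.* g′
    g≡ = trans e (ℕₚ.*-comm g′ p)
  pg∣f : p ∣ f → p ℕ.* gcd d f ∣ f
  pg∣f (divides f′ e) = subst (p ℕ.* gcd d f ∣_) (sym f≡) (Div.*-monoʳ-∣ p
      (coprime-divisor {n = p} (Cop.sym (prime∤⇒coprime pp λ h → p∤d (∣-trans h (gcd[m,n]∣m d f))))
        (subst (gcd d f ∣_) f≡ (gcd[m,n]∣n d f))))
    where
    f≡ : f ≡ p ℕ.* f′
    f≡ = trans e (ℕₚ.*-comm f′ p)

module _ (f : ℕ) where

  -- The values at primes of d ↦ μ(d)/σ(d) ψ((d,f)).
  atPrime : ℕ → ℚ
  atPrime p = if does (p ∣? f) then - 1ℚ else - inv (1ℚ + ℕ→ℚ p)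

  coefficient : ℕ → ℚ
  coefficient d = μ d * inv (ℕ→ℚ (σ d)) * ψ (gcd d f)

  -- The new prime brings -1 from μ and 1/(1 + p) from σ. If p ∣ f, the gcd also acquires p and ψ
  -- gains the factor 1 + p, which cancels; otherwise the gcd is unchanged.
  coefficient-* : ∀ {p d} → Prime p → ¬ (p ∣ d) → 1 ≤ d → coefficient (p ℕ.* d) ≡ atPrime p * coefficient d
  coefficient-* {p} {d} pp p∤d 1≤d = begin
    μ (p ℕ.* d) * inv (ℕ→ℚ (σ (p ℕ.* d))) * ψ (gcd (p ℕ.* d) f)
      ≡⟨ cong₂ (λ x y → x * y * ψ (gcd (p ℕ.* d) f)) μ-* (trans (cong inv (σ-* pp p∤d 1≤d)) (inv-* 0<1+p (σ-pos 1≤d))) ⟩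
    (- 1ℚ * μ d) * (i * inv (ℕ→ℚ (σ d))) * ψ (gcd (p ℕ.* d) f)
      ≡⟨ case (p ∣? f) ⟩
    atPrime p * coefficient d ∎
    where
    open ≡-Reasoning
    i = inv (1ℚ + ℕ→ℚ p)
    0<1+p : 0ℚ <ℚ 1ℚ + ℕ→ℚ p
    0<1+p = +-pos 0<1 (ℕ→ℚ-≥0 p)
    μ-* : μ (p ℕ.* d) ≡ - 1ℚ * μ d
    μ-* = trans (μ≡∏ₚ (p ℕ.* d)) (trans (cong₂ _*_
        (𝟙-⇔ (squarefree? (p ℕ.* d)) (squarefree? d) (squarefree-∣ (n∣m*n p)) (squarefree-* pp p∤d))
        (∏ₚ-* (λ _ → - 1ℚ) pp p∤d 1≤d))
      (trans (*-swap (𝟙 (squarefree? d)) (- 1ℚ) (∏ₚ (λ _ → - 1ℚ) d)) (cong (- 1ℚ *_) (sym (μ≡∏ₚ d)))))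
    m = μ d
    s = inv (ℕ→ℚ (σ d))
    g = ψ (gcd d f)
    q = 1ℚ + ℕ→ℚ p
    case : Dec (p ∣ f) → (- 1ℚ * m) * (i * s) * ψ (gcd (p ℕ.* d) f) ≡ atPrime p * (m * s * g)
    case (yes p∣f) = trans (cong ((- 1ℚ * m) * (i * s) *_)
          (trans (cong ψ (gcd-prime-∣ pp p∤d p∣f))
            (ψ-* pp (λ h → p∤d (∣-trans h (gcd[m,n]∣m d f))) (gcd-≥1ˡ f 1≤d))))
        (trans (ring m i s q g)
          (trans (cong (_* (- 1ℚ * (m * s * g))) (inv-inverseˡ (pos⇒≢0 0<1+p)))
            (trans (*-identityˡ (- 1ℚ * (m * s * g))) (cong (_* (m * s * g)) (sym (if-yes (p ∣? f) p∣f))))))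
      where
      ring : ∀ m i s q g → (- 1ℚ * m) * (i * s) * (q * g) ≡ (i * q) * (- 1ℚ * (m * s * g))
      ring = solve-∀ ringℚ
    case (no p∤f) = trans (cong (λ t → (- 1ℚ * m) * (i * s) * ψ t) (gcd-prime-∤ pp p∤f))
        (trans (ring m i s g) (cong (_* (m * s * g)) (sym (if-no (p ∣? f) p∤f))))
      where
      ring : ∀ m i s g → (- 1ℚ * m) * (i * s) * g ≡ - i * (m * s * g)
      ring = solve-∀ ringℚ

radical : ∀ n → 1 ≤ n → ∃[ r ] (1 ≤ r × Squarefree r × r ∣ n × (∀ {p} → Prime p → p ∣ n → p ∣ r))
radical = <-rec _ go
  where
  go : ∀ n → (∀ {m} → m ℕ.< n → 1 ≤ m → ∃[ r ] (1 ≤ r × Squarefree r × r ∣ m × (∀ {p} → Prime p → p ∣ m → p ∣ r))) →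
       1 ≤ n → ∃[ r ] (1 ≤ r × Squarefree r × r ∣ n × (∀ {p} → Prime p → p ∣ n → p ∣ r))
  go (suc zero) rec 1≤n = 1 , 1≤n , squarefree[1] , ∣-refl , λ _ d → d
  go n@(suc (suc _)) rec 1≤n with primeDivisor {n} (s≤s (s≤s z≤n))
  ... | p , pp , divides m e = case (p ∣? r)
    where
    n≡ : n ≡ p ℕ.* m
    n≡ = trans e (ℕₚ.*-comm m p)
    1≤m : 1 ≤ m
    1≤m = *-≥1ʳ p (subst (1 ≤_) n≡ 1≤n)
    ih = rec (subst (m ℕ.<_) (sym n≡) (<-prime* pp 1≤m)) 1≤m
    r = proj₁ ih
    1≤r = proj₁ (proj₂ ih)
    sf : Squarefree r
    sf = proj₁ (proj₂ (proj₂ ih))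
    r∣m = proj₁ (proj₂ (proj₂ (proj₂ ih)))
    h : ∀ {p} → Prime p → p ∣ m → p ∣ r
    h = proj₂ (proj₂ (proj₂ (proj₂ ih)))
    case : Dec (p ∣ r) → ∃[ s ] (1 ≤ s × Squarefree s × s ∣ n × (∀ {q} → Prime q → q ∣ n → q ∣ s))
    case (yes p∣r) = r , 1≤r , sf , ∣-trans r∣m (divides p n≡) , g
      where
      g : ∀ {q} → Prime q → q ∣ n → q ∣ r
      g {q} pq d with euclidsLemma p m pq (subst (q ∣_) n≡ d)
      ... | inj₁ q∣p = ∣-trans q∣p p∣r
      ... | inj₂ q∣m = h pq q∣m
    case (no p∤r) = p ℕ.* r , *-≥1 (prime-≥1 pp) 1≤r , squarefree-* pp p∤r sf ,
        subst (p ℕ.* r ∣_) (sym n≡) (Div.*-monoʳ-∣ p r∣m) , g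
      where
      g : ∀ {q} → Prime q → q ∣ n → q ∣ p ℕ.* r
      g {q} pq d with euclidsLemma p m pq (subst (q ∣_) n≡ d)
      ... | inj₁ q∣p = Div.∣m⇒∣m*n r q∣p
      ... | inj₂ q∣m = Div.∣n⇒∣m*n p (h pq q∣m)

module _ {u h : ℕ → ℚ} (u-* : ∀ {p q} → Prime p → ¬ (p ∣ q) → 1 ≤ q → u (p ℕ.* q) ≡ h p * u q)
         (u-1 : u 1 ≡ 1ℚ) (u-squarefree : ∀ {d} → ¬ Squarefree d → u d ≡ 0ℚ) where

  -- Only squarefree divisors count, and these are the same for `n` and for its radical. On the
  -- squarefree radical, one prime can be split off at a time.
  divisorSum≡∏ₚ : ∀ n → 1 ≤ n → divisorSum u n ≡ ∏ₚ (λ p → 1ℚ + h p) n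
  divisorSum≡∏ₚ n 1≤n with radical n 1≤n
  ... | r , 1≤r , sf , r∣n , rad = begin
    divisorSum u n                          ≡⟨ ∑-cong n (λ e 1≤e _ → toRadical e 1≤e) ⟩
    ∑ (λ e → 𝟙 (e ∣? r) * u e) n            ≡⟨ divisorSum-extend u n 1≤r r≤n ⟩
    divisorSum u r                          ≡⟨ onSquarefree r 1≤r sf ⟩
    ∏ₚ φ r                                  ≡⟨ ∏ₚ-extend φ n 1≤r r≤n ⟨
    ∏ (primeFactorOr1 φ r) n                ≡⟨ ∏-cong n (λ i _ _ → primeFactorOr1-⇔ φ (λ _ d → ∣-trans d r∣n) rad) ⟩
    ∏ₚ φ n                                  ∎
    where
    open ≡-Reasoning
    φ : ℕ → ℚ
    φ p = 1ℚ + h p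
    r≤n : r ≤ n
    r≤n = ∣⇒≤′ 1≤n r∣n
    toRadical : ∀ e → 1 ≤ e → 𝟙 (e ∣? n) * u e ≡ 𝟙 (e ∣? r) * u e
    toRadical e 1≤e with squarefree? e
    ... | yes sfe = cong (_* u e) (𝟙-⇔ (e ∣? n) (e ∣? r)
            (λ d → squarefree∣ e r 1≤e sfe (λ pp p∣e → rad pp (∣-trans p∣e d))) (λ d → ∣-trans d r∣n))
    ... | no ¬sf  = trans (cong (𝟙 (e ∣? n) *_) (u-squarefree ¬sf)) (trans (*-zeroʳ (𝟙 (e ∣? n)))
            (sym (trans (cong (𝟙 (e ∣? r) *_) (u-squarefree ¬sf)) (*-zeroʳ (𝟙 (e ∣? r))))))
    onSquarefree : ∀ r → 1 ≤ r → Squarefree r → divisorSum u r ≡ ∏ₚ φ r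
    onSquarefree = squarefree-induction (λ r → divisorSum u r ≡ ∏ₚ φ r)
      (trans (trans (cong (0ℚ +_) (trans (cong (_* u 1) (𝟙-yes (1 ∣? 1) ∣-refl)) (trans (*-identityˡ (u 1)) u-1))) refl)
             (sym (∏ₚ-1 φ)))
      λ {p} pp p∤m 1≤m _ e → trans (divisorSum-* {u} {h} u-* pp p∤m 1≤m)
        (trans (cong (φ p *_) e) (sym (∏ₚ-* φ pp p∤m 1≤m)))

-- Zero as soon as some prime divides both `f` and `a`, when no multiple of `f` is prime to `a`;
-- otherwise the product of p/(p + 1) over the primes p of `a`.
localFactor : ℕ → ℕ → ℚ
localFactor f a = ∏ₚ (λ p → 1ℚ + atPrime f p) a

-- This evaluates the sum over d in ρ for a fixed f. It is exact from D = a on, so no limit in `D`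
-- is involved.
∑-coefficient : ∀ f {a} D → 1 ≤ a → a ≤ D → ∑ (λ d → 𝟙 (d ∣? a) * coefficient f d) D ≡ localFactor f a
∑-coefficient f {a} D 1≤a a≤D = trans (divisorSum-extend (coefficient f) D 1≤a a≤D)
  (divisorSum≡∏ₚ {coefficient f} {atPrime f} (coefficient-* f) at1 nonSquarefree a 1≤a)
  where
  at1 : coefficient f 1 ≡ 1ℚ
  at1 = cong (λ t → 1ℚ * ψ t) (Div.∣1⇒≡1 (gcd[m,n]∣m 1 f))
  nonSquarefree : ∀ {d} → ¬ Squarefree d → coefficient f d ≡ 0ℚ
  nonSquarefree {d} ¬sf = trans (cong (λ t → t * inv (ℕ→ℚ (σ d)) * ψ (gcd d f))
      (trans (μ≡∏ₚ d) (𝟙-no-* (squarefree? d) ¬sf (∏ₚ (λ _ → - 1ℚ) d))))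
    (trans (cong (_* ψ (gcd d f)) (*-zeroˡ (inv (ℕ→ℚ (σ d))))) (*-zeroˡ (ψ (gcd d f))))

-- Local conditions at the primes

∏-1 : ∀ {u : ℕ → ℚ} N → (∀ i → 1 ≤ i → i ≤ N → u i ≡ 1ℚ) → ∏ u N ≡ 1ℚ
∏-1 zero    h = refl
∏-1 (suc N) h = trans (cong₂ _*_ (∏-1 N λ n p q → h n p (ℕₚ.m≤n⇒m≤1+n q)) (h (suc N) (s≤s z≤n) ℕₚ.≤-refl)) refl

module _ (M : ℕ → ℕ) where

  sieve≡1 : ∀ y q → (∀ i → 1 ≤ i → i ≤ y → ¬ (M i ∣ q)) → sieve M y q ≡ 1ℚ
  sieve≡1 y q h = ∏-1 y λ i 1≤i i≤y → cong (λ t → 1ℚ - t) (𝟙-no (M i ∣? q) (h i 1≤i i≤y))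

  sieve-dichotomy : ∀ y q → (∀ i → 1 ≤ i → i ≤ y → ¬ (M i ∣ q)) ⊎ sieve M y q ≡ 0ℚ
  sieve-dichotomy zero    q = inj₁ λ i 1≤i i≤0 → contradiction (ℕₚ.≤-trans 1≤i i≤0) λ ()
  sieve-dichotomy (suc y) q = case (sieve-dichotomy y q) (M (suc y) ∣? q)
    where
    case : (∀ i → 1 ≤ i → i ≤ y → ¬ (M i ∣ q)) ⊎ sieve M y q ≡ 0ℚ → Dec (M (suc y) ∣ q) →
           (∀ i → 1 ≤ i → i ≤ suc y → ¬ (M i ∣ q)) ⊎ sieve M (suc y) q ≡ 0ℚ
    case (inj₂ e) _ = inj₂ (trans (cong (_* (1ℚ - 𝟙 (M (suc y) ∣? q))) e) (*-zeroˡ (1ℚ - 𝟙 (M (suc y) ∣? q))))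
    case (inj₁ h) (yes d) = inj₂ (trans (cong (λ t → sieve M y q * (1ℚ - t)) (𝟙-yes (M (suc y) ∣? q) d))
                                        (*-zeroʳ (sieve M y q)))
    case (inj₁ h) (no ¬d) = inj₁ g
      where
      g : ∀ i → 1 ≤ i → i ≤ suc y → ¬ (M i ∣ q)
      g i 1≤i i≤ with ℕₚ.m≤n⇒m<n∨m≡n i≤
      ... | inj₁ (s≤s i≤y) = h i 1≤i i≤y
      ... | inj₂ refl      = ¬d

eulerFactor : ℕ → ℚ
eulerFactor i = if does (prime? i) then 1ℚ - inv (ℕ→ℚ i) * inv (ℕ→ℚ i) else 1ℚ

eulerProduct : ℕ → ℚ
eulerProduct = ∏ eulerFactor

module _ (f a : ℕ) where

  -- For n = fq: if p ∣ f, then p ∤ q because q is prime to f; if p ∣ a, then p ∤ n. If both hold,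
  -- no q is admissible, whence the modulus 1, which divides everything. If neither holds, only
  -- squarefreeness of q remains, whence p².
  data Modulus (p : ℕ) : ℕ → Set where
    notPrime : ¬ Prime p → Modulus p 0
    inBoth   : Prime p → p ∣ f → p ∣ a → Modulus p 1
    inLeft   : Prime p → p ∣ f → ¬ (p ∣ a) → Modulus p p
    inRight  : Prime p → ¬ (p ∣ f) → p ∣ a → Modulus p p
    inNone   : Prime p → ¬ (p ∣ f) → ¬ (p ∣ a) → Modulus p (p ℕ.^ 2)

  hasModulus : ∀ p → ∃[ M ] Modulus p M
  hasModulus p with prime? p | p ∣? f | p ∣? a
  ... | no ¬pp | _      | _      = 0 , notPrime ¬pp
  ... | yes pp | yes df | yes da = 1 , inBoth pp df da
  ... | yes pp | yes df | no ¬da = p , inLeft pp df ¬da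
  ... | yes pp | no ¬df | yes da = p , inRight pp ¬df da
  ... | yes pp | no ¬df | no ¬da = p ℕ.^ 2 , inNone pp ¬df ¬da

  -- The p-part of n = f q obeys the conditions on n exactly when modulus p does not divide q.
  modulus : ℕ → ℕ
  modulus p = proj₁ (hasModulus p)

  modulus∣^2 : ∀ {p M} → Modulus p M → Prime p → M ∣ p ℕ.^ 2
  modulus∣^2 (notPrime ¬pp)  pp = contradiction pp ¬pp
  modulus∣^2 {p} (inBoth _ _ _)  pp = Div.1∣ (p ℕ.^ 2)
  modulus∣^2 {p} (inLeft _ _ _)  pp = p∣p^2 p
  modulus∣^2 {p} (inRight _ _ _) pp = p∣p^2 p
  modulus∣^2 (inNone _ _ _)  pp = ∣-refl

  modulus-prime : ∀ {p M} → Modulus p M → M ≡ 0 ⊎ Prime p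
  modulus-prime (notPrime _)     = inj₁ refl
  modulus-prime (inBoth pp _ _)  = inj₂ pp
  modulus-prime (inLeft pp _ _)  = inj₂ pp
  modulus-prime (inRight pp _ _) = inj₂ pp
  modulus-prime (inNone pp _ _)  = inj₂ pp

  nonzero-factor : ∀ m n → m ℕ.* n ≡ 0 → m ≢ 0 → n ≡ 0
  nonzero-factor m n e m≢0 with ℕₚ.m*n≡0⇒m≡0∨n≡0 m {n} e
  ... | inj₁ z = contradiction z m≢0
  ... | inj₂ z = z

  modulus-coprime : ∀ i j q → i ≢ j → modulus j ≢ 0 → modulus i ∣ modulus j ℕ.* q → modulus i ∣ q
  modulus-coprime i j q i≢j Mj≢0 d
    with hasModulus i | hasModulus j
  ... | Mi , vi | Mj , vj with modulus-prime vi | modulus-prime vj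
  ...   | _         | inj₁ e  = contradiction e Mj≢0
  -- A zero modulus divides the product only if the product is 0, and then q = 0.
  ...   | inj₁ refl | inj₂ _  = subst (0 ∣_)
            (sym (nonzero-factor Mj q (Div.0∣⇒≡0 d) Mj≢0)) ∣-refl
  ...   | inj₂ pi | inj₂ pj = coprime-divisor
            (λ (x , y) → prime∤⇒coprime-^2 pi (λ h → i≢j (prime-∣-prime pi pj (prime-∣-^2 j pi h)))
              (∣-trans x (modulus∣^2 vi pi) , ∣-trans y (modulus∣^2 vj pj))) d

  -- The local identities are (1 + 1/p)(1 - 1/p) = 1 - 1/p² if p divides only `f`, and 1 - 1/p = (1
  -- - 1/p²)(1 - 1/(1 + p)) if p divides only `a`. If p divides both, each side is 0; if neither,
  -- each side is 1 - 1/p².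
  eulerFactor-modulus : ∀ p → primeFactorOr1 1+1/ f p * (1ℚ - inv (ℕ→ℚ (modulus p))) ≡
                              eulerFactor p * primeFactorOr1 (λ p → 1ℚ + atPrime f p) a p
  eulerFactor-modulus p = go (proj₂ (hasModulus p))
    where
    φ = λ p → 1ℚ + atPrime f p
    x = inv (ℕ→ℚ p)
    w = inv (1ℚ + ℕ→ℚ p)
    go : ∀ {M} → Modulus p M → primeFactorOr1 1+1/ f p * (1ℚ - inv (ℕ→ℚ M)) ≡ eulerFactor p * primeFactorOr1 φ a p
    go (notPrime ¬pp) = cong₂ _*_
      (trans (primeFactorOr1-no 1+1/ λ (pp , _) → ¬pp pp) (sym (if-no (prime? p) ¬pp)))
      (sym (primeFactorOr1-no φ λ (pp , _) → ¬pp pp))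
    go (inBoth pp df da) = trans (*-zeroʳ (primeFactorOr1 1+1/ f p))
      (sym (trans (cong (eulerFactor p *_) (trans (primeFactorOr1-yes φ pp da)
        (cong (1ℚ +_) (if-yes (p ∣? f) df)))) (*-zeroʳ (eulerFactor p))))
    go (inLeft pp df ¬da) = trans (cong (_* (1ℚ - x)) (primeFactorOr1-yes 1+1/ pp df))
      (trans (ring x) (sym (trans (cong₂ _*_ (if-yes (prime? p) pp) (primeFactorOr1-no φ λ (_ , d) → ¬da d))
        (*-identityʳ (1ℚ - x * x)))))
      where
      ring : ∀ x → (1ℚ + x) * (1ℚ - x) ≡ 1ℚ - x * x
      ring = solve-∀ ringℚ
    go (inRight pp ¬df da) = trans (cong (_* (1ℚ - x)) (primeFactorOr1-no 1+1/ λ (_ , d) → ¬df d))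
      (sym (trans (cong₂ _*_ (if-yes (prime? p) pp) (trans (primeFactorOr1-yes φ pp da) (cong (1ℚ +_) (if-no (p ∣? f) ¬df))))
        (trans (ring₁ x w) (trans (cong (_* (1ℚ - x)) one) refl))))
      where
      P = ℕ→ℚ p
      ring₁ : ∀ x w → (1ℚ - x * x) * (1ℚ + - w) ≡ ((1ℚ + x) * (1ℚ - w)) * (1ℚ - x)
      ring₁ = solve-∀ ringℚ
      ring₂ : ∀ x w P → (P * x + x) * ((1ℚ + P) * w - w) ≡ (P * x) * ((1ℚ + P) * w)
      ring₂ = solve-∀ ringℚ
      Px : P * x ≡ 1ℚ
      Px = inv-inverseʳ (pos⇒≢0 (ℕ→ℚ-pos (prime-≥1 pp)))
      Pw : (1ℚ + P) * w ≡ 1ℚ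
      Pw = inv-inverseʳ (pos⇒≢0 (+-pos 0<1 (ℕ→ℚ-≥0 p)))
      one : (1ℚ + x) * (1ℚ - w) ≡ 1ℚ
      one = trans (cong₂ (λ s t → (s + x) * (t - w)) (sym Px) (sym Pw))
              (trans (ring₂ x w P) (trans (cong₂ _*_ Px Pw) (*-identityˡ 1ℚ)))
    go (inNone pp ¬df ¬da) = trans (cong (_* (1ℚ - inv (ℕ→ℚ (p ℕ.^ 2)))) (primeFactorOr1-no 1+1/ λ (_ , d) → ¬df d))
      (trans (*-identityˡ (1ℚ - inv (ℕ→ℚ (p ℕ.^ 2))))
        (sym (trans (cong₂ _*_ (trans (if-yes (prime? p) pp) (cong (λ t → 1ℚ - t) (sym inv²))) (primeFactorOr1-no φ λ (_ , d) → ¬da d))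
          (*-identityʳ (1ℚ - inv (ℕ→ℚ (p ℕ.^ 2)))))))
      where
      inv² : inv (ℕ→ℚ (p ℕ.^ 2)) ≡ x * x
      inv² = trans (cong inv (trans (cong ℕ→ℚ (^2≡* p)) (ℕ→ℚ-* p p)))
               (inv-* {ℕ→ℚ p} {ℕ→ℚ p} (ℕ→ℚ-pos (prime-≥1 pp)) (ℕ→ℚ-pos (prime-≥1 pp)))

∏[1+1/p]-pos : ∀ n → 0ℚ <ℚ ∏[1+1/p] n
∏[1+1/p]-pos n = subst (0ℚ <ℚ_) (sym (∏[1+1/p]≡∏ₚ n)) (go n)
  where
  case : ∀ i → Dec (Prime i × i ∣ n) → 0ℚ <ℚ primeFactorOr1 1+1/ n i
  case i (yes (pi , d)) = subst (0ℚ <ℚ_) (sym (primeFactorOr1-yes 1+1/ pi d)) (+-pos 0<1 (inv-ℕ-≥0 i))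
  case i (no h)         = subst (0ℚ <ℚ_) (sym (primeFactorOr1-no 1+1/ h)) 0<1
  go : ∀ y → 0ℚ <ℚ ∏ (primeFactorOr1 1+1/ n) y
  go zero    = 0<1
  go (suc y) = *-pos (go y) (case (suc y) (prime? (suc y) ×-dec suc y ∣? n))

σf-pos : ∀ {f} → 1 ≤ f → 0ℚ <ℚ σf f
σf-pos {f} 1≤f = *-pos (ℕ→ℚ-pos {f} 1≤f) (∏[1+1/p]-pos f)

-- After multiplication by the product of 1 + 1/p over p ∣ f, this is the local identity taken over
-- all indices up to `y`. The range must contain all primes of `f` and `a`.
sieveDensity-modulus : ∀ {f a} y → 1 ≤ f → 1 ≤ a → f ≤ y → a ≤ y →
  sieveDensity (modulus f a) y ≡ eulerProduct y * (inv (∏[1+1/p] f) * localFactor f a)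
sieveDensity-modulus {f} {a} y 1≤f 1≤a f≤y a≤y = *-cancelˡ (∏[1+1/p]-pos f) (begin
    P * sieveDensity (modulus f a) y
      ≡⟨ cong (_* sieveDensity (modulus f a) y) (trans (∏[1+1/p]≡∏ₚ f) (sym (∏ₚ-extend 1+1/ y 1≤f f≤y))) ⟩
    ∏ (primeFactorOr1 1+1/ f) y * sieveDensity (modulus f a) y
      ≡⟨ sym (∏-* (primeFactorOr1 1+1/ f) (λ i → 1ℚ - inv (ℕ→ℚ (modulus f a i))) y) ⟩
    ∏ (λ i → primeFactorOr1 1+1/ f i * (1ℚ - inv (ℕ→ℚ (modulus f a i)))) y
      ≡⟨ ∏-cong y (λ i _ _ → eulerFactor-modulus f a i) ⟩
    ∏ (λ i → eulerFactor i * primeFactorOr1 φ a i) y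
      ≡⟨ ∏-* eulerFactor (primeFactorOr1 φ a) y ⟩
    eulerProduct y * ∏ (primeFactorOr1 φ a) y
      ≡⟨ cong (eulerProduct y *_) (∏ₚ-extend φ y 1≤a a≤y) ⟩
    eulerProduct y * localFactor f a
      ≡⟨ *-identityˡ (eulerProduct y * localFactor f a) ⟨
    1ℚ * (eulerProduct y * localFactor f a)
      ≡⟨ cong (_* (eulerProduct y * localFactor f a)) (inv-inverseʳ (pos⇒≢0 (∏[1+1/p]-pos f))) ⟨
    (P * inv P) * (eulerProduct y * localFactor f a)
      ≡⟨ ring P (inv P) (eulerProduct y) (localFactor f a) ⟩
    P * (eulerProduct y * (inv P * localFactor f a)) ∎)
  where
  open ≡-Reasoning
  P = ∏[1+1/p] f
  φ = λ p → 1ℚ + atPrime f p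
  ring : ∀ a b c d → (a * b) * (c * d) ≡ a * (c * (b * d))
  ring = solve-∀ ringℚ

module _ {f a : ℕ} (1≤f : 1 ≤ f) (full : Squarefull f) (1≤a : 1 ≤ a) where

  Good : ℕ → Set
  Good n = squarefullPart n ≡ f × gcd n a ≡ 1

  good? : ∀ n → Dec (Good n)
  good? n = (squarefullPart n ℕₚ.≟ f) ×-dec (gcd n a ℕₚ.≟ 1)

  good⇒modulus∤ : ∀ q → 1 ≤ q → Good (f ℕ.* q) → ∀ p → ¬ (modulus f a p ∣ q)
  good⇒modulus∤ q 1≤q (e , g) p = go (proj₂ (hasModulus f a p))
    where
    part : IsSquarefullPart (f ℕ.* q) f
    part = subst (IsSquarefullPart (f ℕ.* q)) e (squarefullPart-spec (f ℕ.* q) (*-≥1 1≤f 1≤q))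
    q≡ : proj₁ part ≡ q
    q≡ = ℕₚ.*-cancelˡ-≡ (proj₁ part) q f {{ℕ.>-nonZero 1≤f}}
      (trans (ℕₚ.*-comm f (proj₁ part)) (sym (proj₁ (proj₂ part))))
    sfq : Squarefree q
    sfq = subst Squarefree q≡ (proj₁ (proj₂ (proj₂ part)))
    cqf : Coprime q f
    cqf = subst (λ t → Coprime t f) q≡ (proj₂ (proj₂ (proj₂ (proj₂ part))))
    noCommon : ∀ {p} → Prime p → p ∣ f ℕ.* q → ¬ (p ∣ a)
    noCommon = coprime⇒noCommonPrime (gcd≡1⇒coprime g)
    go : ∀ {M} → Modulus f a p M → ¬ (M ∣ q)
    go (notPrime _)         d = ℕₚ.<⇒≢ 1≤q (sym (Div.0∣⇒≡0 d))
    go (inBoth pp df da)    d = noCommon pp (Div.∣m⇒∣m*n q df) da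
    go (inLeft pp df ¬da)   d = coprime⇒noCommonPrime cqf pp d df
    go (inRight pp ¬df da)  d = noCommon pp (Div.∣n⇒∣m*n f d) da
    go (inNone pp ¬df ¬da)  d = sfq pp d

  -- Primes above `y` divide neither `f` nor `a`, so all they demand is p² ∤ q. The hypothesis on
  -- large squares supplies exactly that.
  modulus∤⇒good : ∀ y q → f ≤ y → a ≤ y → 1 ≤ q → (∀ p → 1 ≤ p → p ≤ y → ¬ (modulus f a p ∣ q)) →
                  (∀ s → y ℕ.< s → ¬ (s ℕ.* s ∣ q)) → Good (f ℕ.* q)
  modulus∤⇒good y q f≤y a≤y 1≤q noModulus noSquare =
      squarefullPart-unique (*-≥1 1≤f 1≤q) (squarefullPart-spec (f ℕ.* q) (*-≥1 1≤f 1≤q))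
        (q , ℕₚ.*-comm f q , sfq , full , cqf) ,
      coprime⇒gcd≡1 (noCommonPrime⇒coprime (*-≥1 1≤f 1≤q) noCommon)
    where
    sfq : Squarefree q
    sfq {p} pp d with p ℕ.≤? y
    ... | no p≰y = noSquare p (ℕₚ.≰⇒> p≰y) (subst (_∣ q) (^2≡* p) d)
    ... | yes p≤y = noModulus p (prime-≥1 pp) p≤y (∣-trans (modulus∣^2 f a (proj₂ (hasModulus f a p)) pp) d)
    divides-p : ∀ {p M} → Modulus f a p M → Prime p → p ∣ f ⊎ p ∣ a → M ∣ p
    divides-p (notPrime ¬pp) pp _ = contradiction pp ¬pp
    divides-p (inBoth _ _ _) pp _ = Div.1∣ _
    divides-p (inLeft _ _ _) pp _ = ∣-refl
    divides-p (inRight _ _ _) pp _ = ∣-refl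
    divides-p (inNone _ ¬df _) pp (inj₁ d) = contradiction d ¬df
    divides-p (inNone _ _ ¬da) pp (inj₂ d) = contradiction d ¬da
    cqf : Coprime q f
    cqf = noCommonPrime⇒coprime 1≤q λ {p} pp p∣q p∣f →
      noModulus p (prime-≥1 pp) (ℕₚ.≤-trans (∣⇒≤′ 1≤f p∣f) f≤y)
        (∣-trans (divides-p (proj₂ (hasModulus f a p)) pp (inj₁ p∣f)) p∣q)
    noCommon : ∀ {p} → Prime p → p ∣ f ℕ.* q → ¬ (p ∣ a)
    noCommon {p} pp p∣fq p∣a = noModulus p (prime-≥1 pp) p≤y (go (proj₂ (hasModulus f a p)) (euclidsLemma f q pp p∣fq))
      where
      p≤y = ℕₚ.≤-trans (∣⇒≤′ 1≤a p∣a) a≤y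
      both : ∀ {M} → Modulus f a p M → p ∣ f → M ∣ q
      both (notPrime ¬pp) _ = contradiction pp ¬pp
      both (inBoth _ _ _) _ = Div.1∣ q
      both (inLeft _ _ ¬da) _ = contradiction p∣a ¬da
      both (inRight _ ¬df _) d = contradiction d ¬df
      both (inNone _ _ ¬da) _ = contradiction p∣a ¬da
      go : ∀ {M} → Modulus f a p M → p ∣ f ⊎ p ∣ q → M ∣ q
      go v (inj₁ p∣f) = both v p∣f
      go v (inj₂ p∣q) = ∣-trans (divides-p v pp (inj₂ p∣a)) p∣q

  bigSquares : ℕ → ℕ → ℕ → ℚ
  bigSquares y S q = ∑ (λ s → 𝟙 (y ℕ.<? s) * 𝟙 (s ℕ.* s ∣? q)) S

  bigSquares-≥0 : ∀ y S q → bigSquares y S q ≥0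
  bigSquares-≥0 y S q = ∑-≥0 S λ s _ _ → *-≥0 (𝟙-≥0 (y ℕ.<? s)) (𝟙-≥0 (s ℕ.* s ∣? q))

  -- A good number always passes the sieve. One that passes without being good has s² ∣ q for some s
  -- > y, so the error is at most the number of such s.
  good-sieve : ∀ y S q → f ≤ y → a ≤ y → 1 ≤ q → q ≤ S →
               abs (𝟙 (good? (f ℕ.* q)) - sieve (modulus f a) y q) ≤ℚ bigSquares y S q
  good-sieve y S q f≤y a≤y 1≤q q≤S = case (good? (f ℕ.* q)) (sieve-dichotomy (modulus f a) y q)
      (ℕₚ.anyUpTo? (λ s → y ℕ.<? s ×-dec s ℕ.* s ∣? q) (suc q))
    where
    I = sieve (modulus f a) y q
    Φ = good? (f ℕ.* q)
    by : ∀ {x z} → 𝟙 Φ ≡ x → I ≡ z → abs (x - z) ≤ℚ bigSquares y S q → abs (𝟙 Φ - I) ≤ℚ bigSquares y S q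
    by refl refl h = h
    case : Dec (Good (f ℕ.* q)) → (∀ i → 1 ≤ i → i ≤ y → ¬ (modulus f a i ∣ q)) ⊎ I ≡ 0ℚ →
           Dec (∃[ s ] (s ℕ.< suc q × (y ℕ.< s × s ℕ.* s ∣ q))) → abs (𝟙 Φ - I) ≤ℚ bigSquares y S q
    case (yes g) _ _ = by (𝟙-yes Φ g) (sieve≡1 (modulus f a) y q λ i _ _ → good⇒modulus∤ q 1≤q g i) (bigSquares-≥0 y S q)
    case (no ¬g) (inj₂ e) _ = by (𝟙-no Φ ¬g) e (bigSquares-≥0 y S q)
    case (no ¬g) (inj₁ h) (yes (s , s<1+q , y<s , d)) = by (𝟙-no Φ ¬g) (sieve≡1 (modulus f a) y q h)
      (subst (_≤ℚ bigSquares y S q) (cong₂ _*_ (𝟙-yes (y ℕ.<? s) y<s) (𝟙-yes (s ℕ.* s ∣? q) d))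
        (∑-term {λ s → 𝟙 (y ℕ.<? s) * 𝟙 (s ℕ.* s ∣? q)} S s
          (λ s _ _ → *-≥0 (𝟙-≥0 (y ℕ.<? s)) (𝟙-≥0 (s ℕ.* s ∣? q)))
          (ℕₚ.≤-trans (s≤s z≤n) y<s) (ℕₚ.≤-trans (ℕₚ.≤-pred s<1+q) q≤S)))
    case (no ¬g) (inj₁ h) (no none) = contradiction
      (modulus∤⇒good y q f≤y a≤y 1≤q h λ s y<s d → none (s , s≤s (s≤q s d) , y<s , d)) ¬g
      where
      s≤q : ∀ s → s ℕ.* s ∣ q → s ≤ q
      s≤q s d = ∣⇒≤′ 1≤q (∣-trans (m∣m*n s) d)

-- Mean values over a fixed squarefull part

count-multiples : ∀ M N → 1 ≤ M → ∑ (λ n → 𝟙 (M ∣? n)) N ≤ℚ ℕ→ℚ N * inv (ℕ→ℚ M)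
count-multiples M N 1≤M = subst (_≤ℚ ℕ→ℚ N * inv (ℕ→ℚ M))
  (sym (trans (∑-cong N λ n _ _ → sym (*-identityʳ (𝟙 (M ∣? n))))
    (trans (∑-multiples M (λ _ → 1ℚ) N) (trans (∑-const 1ℚ (N / M)) (*-identityʳ (ℕ→ℚ (N / M)))))))
  (subst₂ _≤ℚ_ (trans (*-assoc Q m (inv m)) (trans (cong (Q *_) (inv-inverseʳ (pos⇒≢0 (ℕ→ℚ-pos 1≤M)))) (*-identityʳ Q)))
    refl (*-monoʳ (inv-ℕ-≥0 M) (subst (_≤ℚ ℕ→ℚ N) (ℕ→ℚ-* (N / M) M) (ℕ→ℚ-mono (m/n*n≤m N M)))))
  where
  instance
    _ : ℕ.NonZero M
    _ = ℕ.>-nonZero 1≤M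
  Q = ℕ→ℚ (N / M)
  m = ℕ→ℚ M

inv² : ℕ → ℚ
inv² s = inv (ℕ→ℚ s) * inv (ℕ→ℚ s)

inv²-≥0 : ∀ s → inv² s ≥0
inv²-≥0 s = *-≥0 (inv-ℕ-≥0 s) (inv-ℕ-≥0 s)

inv²≡ : ∀ s → 1 ≤ s → inv (ℕ→ℚ (s ℕ.* s)) ≡ inv² s
inv²≡ s 1≤s = trans (cong inv (ℕ→ℚ-* s s)) (inv-* {ℕ→ℚ s} {ℕ→ℚ s} (ℕ→ℚ-pos 1≤s) (ℕ→ℚ-pos 1≤s))

-- A union bound: after exchanging the sums, each s² has at most N/s² multiples up to N. The weights
-- let it serve both the sieve tail and the large squarefull parts.
∑-squares : ∀ {w : ℕ → ℚ} N S → (∀ s → 1 ≤ s → w s ≥0) →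
  ∑ (λ q → ∑ (λ s → w s * 𝟙 (s ℕ.* s ∣? q)) S) N ≤ℚ ℕ→ℚ N * ∑ (λ s → w s * inv² s) S
∑-squares {w} N S 0≤w = subst₂ _≤ℚ_ (∑-swap (λ s q → w s * 𝟙 (s ℕ.* s ∣? q)) S N)
  (∑-* (ℕ→ℚ N) (λ s → w s * inv² s) S)
  (∑-mono S λ s 1≤s _ → subst₂ _≤ℚ_ (sym (∑-* (w s) (λ q → 𝟙 (s ℕ.* s ∣? q)) N))
    (trans (cong (λ t → w s * (ℕ→ℚ N * t)) (inv²≡ s 1≤s)) (*-swap (w s) (ℕ→ℚ N) (inv² s)))
    (*-monoˡ (0≤w s 1≤s) (count-multiples (s ℕ.* s) N (*-≥1 1≤s 1≤s))))

inv-telescope : ∀ n → 1 ≤ n → inv² (suc n) ≤ℚ inv (ℕ→ℚ n) - inv (ℕ→ℚ (suc n))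
inv-telescope n 1≤n = subst (inv² (suc n) ≤ℚ_) (sym e)
  (*-monoʳ (inv-ℕ-≥0 (suc n)) (inv-ℕ-anti 1≤n (ℕₚ.n≤1+n n)))
  where
  i = inv (ℕ→ℚ n)
  j = inv (ℕ→ℚ (suc n))
  ring : ∀ i j N M → i * (M * j) - j * (N * i) ≡ i * j * (M - N)
  ring = solve-∀ ringℚ
  e : i - j ≡ i * j
  e = trans (cong₂ _-_
        (trans (sym (*-identityʳ i)) (cong (i *_) (sym (inv-inverseʳ (pos⇒≢0 (ℕ→ℚ-pos {suc n} (s≤s z≤n)))))))
        (trans (sym (*-identityʳ j)) (cong (j *_) (sym (inv-inverseʳ (pos⇒≢0 (ℕ→ℚ-pos 1≤n)))))))
      (trans (ring i j (ℕ→ℚ n) (ℕ→ℚ (suc n))) (trans (cong (λ t → i * j * (t - ℕ→ℚ n)) (ℕ→ℚ-suc n))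
        (trans (cong (i * j *_) (ring₂ (ℕ→ℚ n))) (*-identityʳ (i * j)))))
    where
    ring₂ : ∀ x → (x + 1ℚ) - x ≡ 1ℚ
    ring₂ = solve-∀ ringℚ

inv²-tail : ∀ y R → 1 ≤ y → ∑ (λ r → inv² (y ℕ.+ r)) R ≤ℚ inv (ℕ→ℚ y) - inv (ℕ→ℚ (y ℕ.+ R))
inv²-tail y zero    1≤y = ≤-reflexive (sym (trans (cong (λ t → inv (ℕ→ℚ y) - inv (ℕ→ℚ t)) (ℕₚ.+-identityʳ y)) (+-inverseʳ (inv (ℕ→ℚ y)))))
inv²-tail y (suc R) 1≤y = ≤-trans (+-mono-≤ (inv²-tail y R 1≤y)
    (subst (λ t → inv² t ≤ℚ inv (ℕ→ℚ (y ℕ.+ R)) - inv (ℕ→ℚ t)) (sym (ℕₚ.+-suc y R)) (inv-telescope (y ℕ.+ R) (ℕₚ.≤-trans 1≤y (ℕₚ.m≤m+n y R)))))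
  (≤-reflexive (ring (inv (ℕ→ℚ y)) (inv (ℕ→ℚ (y ℕ.+ R))) (inv (ℕ→ℚ (y ℕ.+ suc R)))))
  where
  ring : ∀ a b c → (a - b) + (b - c) ≡ a - c
  ring = solve-∀ ringℚ

inv²-tail′ : ∀ y R → 1 ≤ y → ∑ (λ r → inv² (y ℕ.+ r)) R ≤ℚ inv (ℕ→ℚ y)
inv²-tail′ y R 1≤y = ≤-trans (inv²-tail y R 1≤y) (-‿≤ (inv (ℕ→ℚ y)) (inv-ℕ-≥0 (y ℕ.+ R)))

∑-above : ∀ (u : ℕ → ℚ) y S → y ≤ S → ∑ (λ s → 𝟙 (y ℕ.<? s) * u s) S ≡ ∑ (λ r → u (y ℕ.+ r)) (S ℕ.∸ y)
∑-above u y S y≤S = begin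
  ∑ v S                                              ≡⟨ cong (∑ v) (ℕₚ.m+[n∸m]≡n y≤S) ⟨
  ∑ v (y ℕ.+ R)                                      ≡⟨ ∑-split v y R ⟩
  ∑ v y + ∑ (λ r → v (y ℕ.+ r)) R                    ≡⟨ cong₂ _+_ (∑-0 y λ s _ s≤y → below s s≤y) (∑-cong R λ r 1≤r _ → above r 1≤r) ⟩
  0ℚ + ∑ (λ r → u (y ℕ.+ r)) R                       ≡⟨ +-identityˡ _ ⟩
  ∑ (λ r → u (y ℕ.+ r)) R                            ∎
  where
  open ≡-Reasoning
  R = S ℕ.∸ y
  v = λ s → 𝟙 (y ℕ.<? s) * u s
  below : ∀ s → s ≤ y → v s ≡ 0ℚ
  below s s≤y = 𝟙-no-* (y ℕ.<? s) (ℕₚ.≤⇒≯ s≤y) (u s)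
  above : ∀ r → 1 ≤ r → v (y ℕ.+ r) ≡ u (y ℕ.+ r)
  above r 1≤r = 𝟙-yes-* (y ℕ.<? (y ℕ.+ r)) (ℕₚ.m<m+n y 1≤r) (u (y ℕ.+ r))

∑-above-inv² : ∀ y S → 1 ≤ y → ∑ (λ s → 𝟙 (y ℕ.<? s) * inv² s) S ≤ℚ inv (ℕ→ℚ y)
∑-above-inv² y S 1≤y with ℕₚ.≤-total y S
... | inj₁ y≤S = subst (_≤ℚ inv (ℕ→ℚ y)) (sym (∑-above inv² y S y≤S)) (inv²-tail′ y (S ℕ.∸ y) 1≤y)
... | inj₂ S≤y = subst (_≤ℚ inv (ℕ→ℚ y)) (sym (∑-0 S λ s _ s≤S →
    𝟙-no-* (y ℕ.<? s) (ℕₚ.≤⇒≯ (ℕₚ.≤-trans s≤S S≤y)) (inv² s))) (inv-ℕ-≥0 y)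

-- A bound on a real holds for its approximations only from some index on, and that index varies
-- with n. For a sum of length N, finitely many thresholds are merged into one.
ev-all : ∀ {P : ℕ → ℕ → Set} → (∀ n → 1 ≤ n → Ev ev (P n)) → ∀ N → Ev ev (λ k → ∀ n → 1 ≤ n → n ≤ N → P n k)
ev-all h zero    = 0 , λ k _ n 1≤n n≤0 → contradiction (ℕₚ.≤-trans 1≤n n≤0) λ ()
ev-all {P} h (suc N) = Ev² ev
  (λ k a b n 1≤n n≤ → case k a b n 1≤n (ℕₚ.m≤n⇒m<n∨m≡n n≤)) (ev-all h N) (h (suc N) (s≤s z≤n))
  where
  case : ∀ k → (∀ n → 1 ≤ n → n ≤ N → P n k) → P (suc N) k → ∀ n → 1 ≤ n → n ℕ.< suc N ⊎ n ≡ suc N → P n k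
  case k a b n 1≤n (inj₁ (s≤s n≤N)) = a n 1≤n n≤N
  case k a b n 1≤n (inj₂ refl)      = b

avg-abs : ∀ {u v : ℕ → ℚ} N → (∀ n → 1 ≤ n → n ≤ N → abs (u n) ≤ℚ v n) →
          abs (inv (ℕ→ℚ N) * ∑ u N) ≤ℚ inv (ℕ→ℚ N) * ∑ v N
avg-abs {u} {v} N h = subst (_≤ℚ inv (ℕ→ℚ N) * ∑ v N)
  (sym (trans (∣p*q∣≡∣p∣*∣q∣ (inv (ℕ→ℚ N)) (∑ u N)) (cong (_* abs (∑ u N)) (abs-≥0 (inv-ℕ-≥0 N)))))
  (*-monoˡ (inv-ℕ-≥0 N) (≤-trans (∑-abs u N) (∑-mono N h)))

avg-≤ : ∀ {c} N → c ≥0 → inv (ℕ→ℚ N) * (ℕ→ℚ N * c) ≤ℚ c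
avg-≤ {c} zero    0≤c = subst (_≤ℚ c) (sym (trans (cong (inv 0ℚ *_) (*-zeroˡ c)) (*-zeroʳ (inv 0ℚ)))) 0≤c
avg-≤ {c} (suc N) 0≤c = ≤-reflexive (trans (sym (*-assoc (inv (ℕ→ℚ (suc N))) (ℕ→ℚ (suc N)) c))
  (trans (cong (_* c) (inv-inverseˡ (pos⇒≢0 (ℕ→ℚ-pos {suc N} (s≤s z≤n))))) (*-identityˡ c)))

avg-∑-≤ : ∀ {c x} N → c ≥0 → x ≤ℚ ℕ→ℚ N * c → inv (ℕ→ℚ N) * x ≤ℚ c
avg-∑-≤ N 0≤c h = ≤-trans (*-monoˡ (inv-ℕ-≥0 N) h) (avg-≤ N 0≤c)

-- The sieve only needs some limit of the Euler products; identifying it with 6/π² is a separate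
-- matter.
module Density (κ : ℕ → ℚ) (κ-lim : Lim ev² (λ (y , k) → eulerProduct y) (λ (y , k) → κ k)) where

  density : ℕ → ℕ → ℚ
  density f a = inv (σf f) * localFactor f a

  module _ {γ : ℕ → ℕ → ℚ} {α : ℕ → ℚ} {B : ℚ} (bα : Bdd ev α) (0≤B : B ≥0)
           (bγ : ∀ n → 1 ≤ n → Ev ev (λ k → abs (γ n k) ≤ℚ B))
           (h : ∀ m → 1 ≤ m → HasMean (λ n k → γ (m ℕ.* n) k) α)
           {f a : ℕ} (1≤f : 1 ≤ f) (full : Squarefull f) (1≤a : 1 ≤ a) where

    private
      good : ∀ n → Dec (Good 1≤f full 1≤a n)
      good = good? 1≤f full 1≤a
      D = inv (∏[1+1/p] f) * localFactor f a
      M = modulus f a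

    -- Compare with the sieve of level y, whose mean is known exactly. Replacing good numbers by
    -- sieved ones costs at most B times the sum of 1/s² over s > y, uniformly in N; replacing the
    -- finite Euler product by κ costs a multiple of ε.
    mean-good-multiples : HasMean (λ q k → 𝟙 (good (f ℕ.* q)) * γ (f ℕ.* q) k) (λ k → κ k * D * α k)
    mean-good-multiples = hasMean (lim (small-approx K 0≤K approx))
      where
      K = B + abs D * bd bα
      0≤K : K ≥0
      0≤K = +-≥0 0≤B (*-≥0 (0≤∣p∣ D) (<⇒≤ (bd-pos bα)))
      approx : ∀ ε → 0ℚ <ℚ ε → ∃[ w ] (Small ev² w × Ev ev² (λ i →
        abs ((avg (λ q k → 𝟙 (good (f ℕ.* q)) * γ (f ℕ.* q) k) i - κ (proj₂ i) * D * α (proj₂ i)) - w i) ≤ℚ K * ε))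
      approx ε 0<ε = w , diff (avg-lim sieved) , 0 , λ N _ → Ev² ev (λ k p (r , s) → bound N k p r s)
            (ev-all (λ q 1≤q → bγ (f ℕ.* q) (*-≥1 1≤f 1≤q)) N) (zip ev κ-close (bd-ev bα))
        where
        m = proj₁ (inv-small 0<ε)
        Y = proj₁ (at (diff κ-lim) ε 0<ε)
        -- One level meets every demand: 1/y ≤ ε, the Euler product is within ε of κ, and all primes
        -- of `f` and `a` are sieved.
        y = m ⊔ (Y ⊔ (f ⊔ a))
        1≤y : 1 ≤ y
        1≤y = ℕₚ.≤-trans (proj₁ (proj₂ (inv-small 0<ε))) (ℕₚ.m≤m⊔n m _)
        Y≤y : Y ≤ y
        Y≤y = ℕₚ.≤-trans (ℕₚ.m≤m⊔n Y _) (ℕₚ.m≤n⊔m m _)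
        fa≤y : f ⊔ a ≤ y
        fa≤y = ℕₚ.≤-trans (ℕₚ.m≤n⊔m Y _) (ℕₚ.m≤n⊔m m _)
        f≤y = ℕₚ.≤-trans (ℕₚ.m≤m⊔n f a) fa≤y
        a≤y = ℕₚ.≤-trans (ℕₚ.m≤n⊔m f a) fa≤y
        inv-y : inv (ℕ→ℚ y) ≤ℚ ε
        inv-y = ≤-trans (inv-ℕ-anti (proj₁ (proj₂ (inv-small 0<ε))) (ℕₚ.m≤m⊔n m _)) (proj₂ (proj₂ (inv-small 0<ε)))
        κ-close : Ev ev (λ k → abs (eulerProduct y - κ k) ≤ℚ ε)
        κ-close = proj₂ (at (diff κ-lim) ε 0<ε) y Y≤y
        sieved : HasMean (λ q k → sieve M y q * γ (f ℕ.* q) k) (λ k → eulerProduct y * D * α k)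
        sieved = mean-cong-α (λ k → cong (_* α k) (sieveDensity-modulus y 1≤f 1≤a f≤y a≤y))
          (CoprimeModuli.mean-sieve M (modulus-coprime f a) {γ} {α} bα h y f 1≤f)
        w : ℕ × ℕ → ℚ
        w i = avg (λ q k → sieve M y q * γ (f ℕ.* q) k) i - eulerProduct y * D * α (proj₂ i)
        bound : ∀ N k → (∀ q → 1 ≤ q → q ≤ N → abs (γ (f ℕ.* q) k) ≤ℚ B) → abs (eulerProduct y - κ k) ≤ℚ ε →
          abs (α k) ≤ℚ bd bα →
          abs ((avg (λ q k → 𝟙 (good (f ℕ.* q)) * γ (f ℕ.* q) k) (N , k) - κ k * D * α k) - w (N , k)) ≤ℚ K * ε
        bound N k γ≤ κ≤ α≤ = subst₂ _≤ℚ_ (cong abs (sym e)) (ring₃ B (abs D) (bd bα) ε)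
          (≤-trans (∣p+q∣≤∣p∣+∣q∣ (inv (ℕ→ℚ N) * ∑ d N) ((eulerProduct y - κ k) * (D * α k)))
            (+-mono-≤ first second))
          where
          g s : ℕ → ℚ
          g q = 𝟙 (good (f ℕ.* q)) * γ (f ℕ.* q) k
          s q = sieve M y q * γ (f ℕ.* q) k
          d : ℕ → ℚ
          d q = g q - s q
          ring₁ : ∀ i G S κ E D α → (i * G - κ * D * α) - (i * S - E * D * α) ≡ i * (G - S) + (E - κ) * (D * α)
          ring₁ = solve-∀ ringℚ
          e : (inv (ℕ→ℚ N) * ∑ g N - κ k * D * α k) - w (N , k) ≡ inv (ℕ→ℚ N) * ∑ d N + (eulerProduct y - κ k) * (D * α k)
          e = trans (ring₁ (inv (ℕ→ℚ N)) (∑ g N) (∑ s N) (κ k) (eulerProduct y) D (α k))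
                (cong (λ t → inv (ℕ→ℚ N) * t + (eulerProduct y - κ k) * (D * α k)) (sym (∑-- g s N)))
          ring₃ : ∀ B D b ε → B * ε + ε * (D * b) ≡ (B + D * b) * ε
          ring₃ = solve-∀ ringℚ
          ring₄ : ∀ x y z → x * z - y * z ≡ z * (x - y)
          ring₄ = solve-∀ ringℚ
          d≤ : ∀ q → 1 ≤ q → q ≤ N → abs (d q) ≤ℚ B * bigSquares 1≤f full 1≤a y N q
          d≤ q 1≤q q≤N = subst (_≤ℚ B * bigSquares 1≤f full 1≤a y N q)
            (sym (trans (cong abs (ring₄ (𝟙 (good (f ℕ.* q))) (sieve M y q) (γ (f ℕ.* q) k)))
              (∣p*q∣≡∣p∣*∣q∣ (γ (f ℕ.* q) k) (𝟙 (good (f ℕ.* q)) - sieve M y q))))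
            (*-mono (0≤∣p∣ _) 0≤B (γ≤ q 1≤q q≤N) (good-sieve 1≤f full 1≤a y N q f≤y a≤y 1≤q q≤N))
          T = ∑ (λ s → 𝟙 (y ℕ.<? s) * inv² s) N
          0≤T : T ≥0
          0≤T = ∑-≥0 N λ s _ _ → *-≥0 (𝟙-≥0 (y ℕ.<? s)) (inv²-≥0 s)
          first : abs (inv (ℕ→ℚ N) * ∑ d N) ≤ℚ B * ε
          first = ≤-trans (avg-abs N d≤) (≤-trans
            (avg-∑-≤ N (*-≥0 0≤B 0≤T) (subst₂ _≤ℚ_ (sym (∑-* B (bigSquares 1≤f full 1≤a y N) N)) (*-swap B (ℕ→ℚ N) T)
              (*-monoˡ 0≤B (∑-squares {λ s → 𝟙 (y ℕ.<? s)} N N (λ s _ → 𝟙-≥0 (y ℕ.<? s))))))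
            (*-monoˡ 0≤B (≤-trans (∑-above-inv² y N 1≤y) inv-y)))
          second : abs ((eulerProduct y - κ k) * (D * α k)) ≤ℚ ε * (abs D * bd bα)
          second = subst (_≤ℚ ε * (abs D * bd bα))
            (sym (trans (∣p*q∣≡∣p∣*∣q∣ (eulerProduct y - κ k) (D * α k))
              (cong (abs (eulerProduct y - κ k) *_) (∣p*q∣≡∣p∣*∣q∣ D (α k)))))
            (*-mono (*-≥0 (0≤∣p∣ D) (0≤∣p∣ (α k))) (<⇒≤ 0<ε) κ≤ (*-monoˡ (0≤∣p∣ D) α≤))

    -- Good numbers are multiples of f, so passing from q to n = fq divides the mean by f. Together
    -- with the product of 1 + 1/p over p ∣ f this makes the denominator σ_f.
    mean-good : Bdd ev κ → HasMean (λ n k → 𝟙 (good n) * γ n k) (λ k → κ k * density f a * α k)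
    mean-good bκ = mean-cong supported (mean-cong-α total
        (mean-multiples f {u = λ n k → 𝟙 (good n) * γ n k} (bdd-* (bdd-* bκ (bdd-const D)) bα) mean-good-multiples))
      where
      instance
        _ : ℕ.NonZero f
        _ = ℕ.>-nonZero 1≤f
      supported : ∀ n k → 1 ≤ n → 𝟙 (f ∣? n) * (𝟙 (good n) * γ n k) ≡ 𝟙 (good n) * γ n k
      supported n k 1≤n = trans (*-swap (𝟙 (f ∣? n)) (𝟙 (good n)) (γ n k))
        (𝟙-*-cong (good n) λ (e , _) → 𝟙-yes-* (f ∣? n) ((squarefullPart-∣ (subst (IsSquarefullPart n) e (squarefullPart-spec n 1≤n)))) (γ n k))
      total : ∀ k → inv (ℕ→ℚ f) * (κ k * D * α k) ≡ κ k * density f a * α k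
      total k = trans (ring (inv (ℕ→ℚ f)) (κ k) (inv (∏[1+1/p] f)) (localFactor f a) (α k))
        (cong (λ t → κ k * (t * localFactor f a) * α k)
          (sym (inv-* {ℕ→ℚ f} {∏[1+1/p] f} (ℕ→ℚ-pos 1≤f) (∏[1+1/p]-pos f))))
        where
        ring : ∀ i κ P L α → i * (κ * (P * L) * α) ≡ κ * ((i * P) * L) * α
        ring = solve-∀ ringℚ

-- The square of the Leibniz series

∑-reverse : ∀ (u : ℕ → ℚ) N → ∑ (λ m → u (suc N ℕ.∸ m)) N ≡ ∑ u N
∑-reverse u zero    = refl
∑-reverse u (suc N) = trans (∑-split (λ m → u (suc (suc N) ℕ.∸ m)) 1 N)
  (trans (cong₂ _+_ (+-identityˡ (u (suc N))) (∑-reverse u N)) (+-comm (u (suc N)) (∑ u N)))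

sgn : ℕ → ℚ
sgn n = (- 1ℚ) ^ℚ n

sgn-+ : ∀ m n → sgn (m ℕ.+ n) ≡ sgn m * sgn n
sgn-+ zero    n = sym (*-identityˡ (sgn n))
sgn-+ (suc m) n = trans (cong (- 1ℚ *_) (sgn-+ m n)) (sym (*-assoc (- 1ℚ) (sgn m) (sgn n)))

sgn² : ∀ n → sgn n * sgn n ≡ 1ℚ
sgn² zero    = refl
sgn² (suc n) = trans (ring (sgn n)) (sgn² n)
  where
  ring : ∀ s → (- 1ℚ * s) * (- 1ℚ * s) ≡ s * s
  ring = solve-∀ ringℚ

sgn-2* : ∀ n → sgn (2 ℕ.* n) ≡ 1ℚ
sgn-2* n = trans (sgn-+ n (n ℕ.+ 0)) (trans (cong (λ t → sgn n * sgn t) (ℕₚ.+-identityʳ n)) (sgn² n))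

odd⁻¹ : ℕ → ℚ
odd⁻¹ n = inv (ℕ→ℚ (suc (2 ℕ.* n)))

-- In the square of ∑ (-1)ⁿ/(2n+1) over -N ≤ n < N the off-diagonal part collapses by partial
-- fractions to -2 error N, a combination of tails of the alternating harmonic series.
altHarmonicTerm altHarmonic : ℕ → ℚ
altHarmonicTerm j = sgn j * inv (ℕ→ℚ j)
altHarmonic = ∑ altHarmonicTerm

error : ℕ → ℚ
error N = ∑ (λ m → odd⁻¹ (ℕ.pred m) * (altHarmonic (N ℕ.+ ℕ.pred m) - altHarmonic (N ℕ.∸ m))) N

oddInv² : ℕ → ℚ
oddInv² N = ∑ (λ m → odd⁻¹ (ℕ.pred m) * odd⁻¹ (ℕ.pred m)) N

4ℚ 8ℚ : ℚ
4ℚ = ℕ→ℚ 4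
8ℚ = ℕ→ℚ 8

leibnizTerm≡ : ∀ k → leibnizTerm k ≡ 4ℚ * odd⁻¹ k
leibnizTerm≡ k = *-cancelˡ {m} (ℕ→ℚ-pos {suc (2 ℕ.* k)} (s≤s z≤n)) (trans m*t (sym
    (trans (ring m 4ℚ (inv m)) (trans (cong (4ℚ *_) (inv-inverseʳ (pos⇒≢0 (ℕ→ℚ-pos {suc (2 ℕ.* k)} (s≤s z≤n))))) (*-identityʳ 4ℚ)))))
  where
  m = ℕ→ℚ (suc (2 ℕ.* k))
  ring : ∀ m f i → m * (f * i) ≡ f * (m * i)
  ring = solve-∀ ringℚ
  m*t : m * leibnizTerm k ≡ 4ℚ
  m*t = ℚₚ.toℚᵘ-injective (ℚᵘₚ.≃-trans (ℚₚ.toℚᵘ-homo-* m (leibnizTerm k))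
    (ℚᵘₚ.≃-trans (ℚᵘₚ.*-cong (ℕ→ℚ-toℚᵘ (suc (2 ℕ.* k))) (ℚₚ.toℚᵘ-fromℚᵘ (ℚᵘ.mkℚᵘ (ℤ.+ 4) (2 ℕ.* k))))
      (ℚᵘₚ.≃-trans (ℚᵘ.*≡* refl′) (ℚᵘₚ.≃-sym (ℕ→ℚ-toℚᵘ 4)))))
    where
    refl′ : ℤ.+ suc (2 ℕ.* k) ℤ.* ℤ.+ 4 ℤ.* ℤ.+ 1 ≡ ℤ.+ 4 ℤ.* (ℤ.+ 1 ℤ.* ℤ.+ suc (2 ℕ.* k))
    refl′ = trans (ℤₚ.*-identityʳ (ℤ.+ suc (2 ℕ.* k) ℤ.* ℤ.+ 4)) (trans (ℤₚ.*-comm (ℤ.+ suc (2 ℕ.* k)) (ℤ.+ 4))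
      (cong (ℤ.+ 4 ℤ.*_) (sym (ℤₚ.*-identityˡ (ℤ.+ suc (2 ℕ.* k))))))

alternating-suc : ∀ k n → alternating k (suc n) ≡ alternating k n + sgn n * leibnizTerm (k ℕ.+ n)
alternating-suc k zero    = trans (ring (leibnizTerm k)) (cong (λ t → 0ℚ + 1ℚ * leibnizTerm t) (sym (ℕₚ.+-identityʳ k)))
  where
  ring : ∀ t → t - 0ℚ ≡ 0ℚ + 1ℚ * t
  ring = solve-∀ ringℚ
alternating-suc k (suc n) = trans (cong (λ t → leibnizTerm k - t) (alternating-suc (suc k) n))
  (trans (ring (leibnizTerm k) (alternating (suc k) n) (sgn n) (leibnizTerm (suc k ℕ.+ n)))
    (cong (λ t → (leibnizTerm k - alternating (suc k) n) + (- 1ℚ * sgn n) * leibnizTerm t) (sym (ℕₚ.+-suc k n))))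
  where
  ring : ∀ t a s u → t - (a + s * u) ≡ (t - a) + (- 1ℚ * s) * u
  ring = solve-∀ ringℚ

leibniz : ℕ → ℚ
leibniz = alternating 0

leibniz-suc : ∀ N → leibniz (suc N) ≡ leibniz N + sgn N * (4ℚ * odd⁻¹ N)
leibniz-suc N = trans (alternating-suc 0 N) (cong (λ t → leibniz N + sgn N * t) (leibnizTerm≡ N))

leibniz≡∑ : ∀ N → leibniz N ≡ ∑ (λ m → sgn (ℕ.pred m) * (4ℚ * odd⁻¹ (ℕ.pred m))) N
leibniz≡∑ zero    = refl
leibniz≡∑ (suc N) = trans (leibniz-suc N) (cong (_+ sgn N * (4ℚ * odd⁻¹ N)) (leibniz≡∑ N))

-- With denominators cleared, this is (x + y)² = 4xy + (y - x)².
partialFractions : ∀ {x y p s} → 0ℚ <ℚ x → 0ℚ <ℚ y → 0ℚ <ℚ p → 0ℚ <ℚ s → p ≡ y - x → s ≡ x + y →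
  inv p * (inv y + inv x) ≡ inv s * (4ℚ * inv p + (inv x - inv y))
partialFractions {x} {y} {p} {s} 0<x 0<y 0<p 0<s ep es =
  *-cancelˡ (*-pos (*-pos 0<s 0<p) (*-pos 0<x 0<y)) (begin
    (s * p) * (x * y) * (inv p * (inv y + inv x))
      ≡⟨ ring₁ s p x y (inv p) (inv x) (inv y) ⟩
    s * (p * inv p) * (y * (x * inv x) + x * (y * inv y))
      ≡⟨ cong₂ (λ P Q → s * P * Q) (one 0<p) (cong₂ (λ X Y → y * X + x * Y) (one 0<x) (one 0<y)) ⟩
    s * 1ℚ * (y * 1ℚ + x * 1ℚ)
      ≡⟨ cong (λ t → t * 1ℚ * (y * 1ℚ + x * 1ℚ)) es ⟩
    (x + y) * 1ℚ * (y * 1ℚ + x * 1ℚ)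
      ≡⟨ ring₂ x y ⟩
    1ℚ * (4ℚ * 1ℚ * x * y + (y - x) * (y * 1ℚ - x * 1ℚ))
      ≡⟨ cong (λ t → 1ℚ * (4ℚ * 1ℚ * x * y + t * (y * 1ℚ - x * 1ℚ))) ep ⟨
    1ℚ * (4ℚ * 1ℚ * x * y + p * (y * 1ℚ - x * 1ℚ))
      ≡⟨ cong₂ _*_ (one 0<s) (cong₂ (λ P Q → 4ℚ * P * x * y + p * Q) (one 0<p) (cong₂ (λ X Y → y * X - x * Y) (one 0<x) (one 0<y))) ⟨
    s * inv s * (4ℚ * (p * inv p) * x * y + p * (y * (x * inv x) - x * (y * inv y)))
      ≡⟨ ring₃ s p x y (inv s) (inv p) (inv x) (inv y) 4ℚ ⟩
    (s * p) * (x * y) * (inv s * (4ℚ * inv p + (inv x - inv y))) ∎)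
  where
  open ≡-Reasoning
  one : ∀ {z} → 0ℚ <ℚ z → z * inv z ≡ 1ℚ
  one 0<z = inv-inverseʳ (pos⇒≢0 0<z)
  ring₁ : ∀ s p x y P X Y → (s * p) * (x * y) * (P * (Y + X)) ≡ s * (p * P) * (y * (x * X) + x * (y * Y))
  ring₁ = solve-∀ ringℚ
  ring₂ : ∀ x y → (x + y) * 1ℚ * (y * 1ℚ + x * 1ℚ) ≡ 1ℚ * (((1ℚ + 1ℚ) + (1ℚ + 1ℚ)) * 1ℚ * x * y + (y - x) * (y * 1ℚ - x * 1ℚ))
  ring₂ = solve-∀ ringℚ
  ring₃ : ∀ s p x y S P X Y f → s * S * (f * (p * P) * x * y + p * (y * (x * X) - x * (y * Y))) ≡
                                (s * p) * (x * y) * (S * (f * P + (X - Y)))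
  ring₃ = solve-∀ ringℚ

module _ (N n : ℕ) (n<N : n ℕ.< N) where

  private
    a = N ℕ.∸ n
    N≡ : N ≡ a ℕ.+ n
    N≡ = sym (ℕₚ.m∸n+n≡m (ℕₚ.<⇒≤ n<N))
    1≤a : 1 ≤ a
    1≤a = ℕₚ.m<n⇒0<n∸m n<N
    ℕ₁ : ∀ a n → a ℕ.+ n ℕ.+ suc n ≡ a ℕ.+ suc (2 ℕ.* n)
    ℕ₁ = solve-ℕ
    ℕ₂ : ∀ a n → suc (2 ℕ.* (a ℕ.+ n)) ≡ a ℕ.+ (a ℕ.+ n ℕ.+ suc n)
    ℕ₂ = solve-ℕ
    b≡ : N ℕ.+ suc n ≡ a ℕ.+ suc (2 ℕ.* n)
    b≡ = trans (cong (ℕ._+ suc n) N≡) (ℕ₁ a n)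
    s≡ : suc (2 ℕ.* N) ≡ a ℕ.+ (N ℕ.+ suc n)
    s≡ = trans (cong (λ t → suc (2 ℕ.* t)) N≡) (trans (ℕ₂ a n) (cong (λ t → a ℕ.+ (t ℕ.+ suc n)) (sym N≡)))
    x = ℕ→ℚ a
    y = ℕ→ℚ (N ℕ.+ suc n)
    h : ℕ → ℚ
    h = altHarmonicTerm
    sgn-b : sgn (N ℕ.+ suc n) ≡ - sgn a
    sgn-b = trans (cong sgn b≡) (trans (sgn-+ a (suc (2 ℕ.* n)))
      (trans (cong (λ t → sgn a * (- 1ℚ * t)) (sgn-2* n)) (ring (sgn a))))
      where
      ring : ∀ s → s * (- 1ℚ * 1ℚ) ≡ - s
      ring = solve-∀ ringℚ
    sgn-a : sgn a ≡ sgn N * sgn n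
    sgn-a = sym (trans (cong (λ t → sgn t * sgn n) N≡) (trans (cong (_* sgn n) (sgn-+ a n))
      (trans (*-assoc (sgn a) (sgn n) (sgn n)) (trans (cong (sgn a *_) (sgn² n)) (*-identityʳ (sgn a))))))
    p≡ : ℕ→ℚ (suc (2 ℕ.* n)) ≡ y - x
    p≡ = sym (trans (cong (_- x) (trans (cong ℕ→ℚ b≡) (ℕ→ℚ-+ a (suc (2 ℕ.* n))))) (ring x (ℕ→ℚ (suc (2 ℕ.* n)))))
      where
      ring : ∀ x z → (x + z) - x ≡ z
      ring = solve-∀ ringℚ

  -- Apply the partial fractions to x = N - n and y = N + n + 1: their difference is 2n + 1 and
  -- their sum 2N + 1. As the difference is odd, the two harmonic terms have opposite signs.
  error-term : odd⁻¹ n * (h (N ℕ.+ suc n) - h a) ≡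
               - odd⁻¹ N * (sgn N * (sgn n * (4ℚ * odd⁻¹ n)) + (h a + h (N ℕ.+ suc n)))
  error-term = begin
    odd⁻¹ n * (sgn (N ℕ.+ suc n) * inv y - sgn a * inv x)
      ≡⟨ cong (λ t → odd⁻¹ n * (t * inv y - sgn a * inv x)) sgn-b ⟩
    odd⁻¹ n * (- sgn a * inv y - sgn a * inv x)
      ≡⟨ ring₁ (odd⁻¹ n) (sgn a) (inv x) (inv y) ⟩
    - sgn a * (odd⁻¹ n * (inv y + inv x))
      ≡⟨ cong (- sgn a *_) (partialFractions (ℕ→ℚ-pos 1≤a) (ℕ→ℚ-pos 1≤b) (ℕ→ℚ-pos {suc (2 ℕ.* n)} (s≤s z≤n))
          (ℕ→ℚ-pos {suc (2 ℕ.* N)} (s≤s z≤n)) p≡ (trans (cong ℕ→ℚ s≡) (ℕ→ℚ-+ a (N ℕ.+ suc n)))) ⟩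
    - sgn a * (odd⁻¹ N * (4ℚ * odd⁻¹ n + (inv x - inv y)))
      ≡⟨ ring₂ (odd⁻¹ n) (odd⁻¹ N) (sgn a) (inv x) (inv y) 4ℚ ⟩
    - odd⁻¹ N * (sgn a * (4ℚ * odd⁻¹ n) + (sgn a * inv x + (- sgn a) * inv y))
      ≡⟨ cong₂ (λ u v → - odd⁻¹ N * (u * (4ℚ * odd⁻¹ n) + (sgn a * inv x + v * inv y))) sgn-a (sym sgn-b) ⟩
    - odd⁻¹ N * (sgn N * sgn n * (4ℚ * odd⁻¹ n) + (h a + h (N ℕ.+ suc n)))
      ≡⟨ cong (λ t → - odd⁻¹ N * (t + (h a + h (N ℕ.+ suc n)))) (*-assoc (sgn N) (sgn n) (4ℚ * odd⁻¹ n)) ⟩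
    - odd⁻¹ N * (sgn N * (sgn n * (4ℚ * odd⁻¹ n)) + (h a + h (N ℕ.+ suc n))) ∎
    where
    open ≡-Reasoning
    1≤b : 1 ≤ N ℕ.+ suc n
    1≤b = ℕₚ.≤-trans (s≤s z≤n) (ℕₚ.m≤n+m (suc n) N)
    ring₁ : ∀ o s X Y → o * (- s * Y - s * X) ≡ - s * (o * (Y + X))
    ring₁ = solve-∀ ringℚ
    ring₂ : ∀ o O s X Y f → - s * (O * (f * o + (X - Y))) ≡ - O * (s * (f * o) + (s * X + (- s) * Y))
    ring₂ = solve-∀ ringℚ

-- Passing to N + 1 changes each old summand by an `error-term`. The leftover harmonic terms run
-- through all indices from 1 to 2N, and their sum cancels against that in the new last summand.
error-suc : ∀ N → error (suc N) ≡ error N - odd⁻¹ N * (sgn N * leibniz N) - odd⁻¹ N * odd⁻¹ N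
error-suc N = begin
  ∑ (λ m → odd⁻¹ (p m) * (H (suc N ℕ.+ p m) - H (suc N ℕ.∸ m))) N + odd⁻¹ N * (H (suc N ℕ.+ N) - H (suc N ℕ.∸ suc N))
    ≡⟨ cong₂ _+_ (∑-cong N split) lastTerm ⟩
  ∑ (λ m → e m + - O * (sgn N * l m + (h (suc N ℕ.∸ m) + h (N ℕ.+ m)))) N + O * (H (N ℕ.+ N) + - O)
    ≡⟨ cong (_+ O * (H (N ℕ.+ N) + - O)) (trans (∑-+ e (λ m → - O * (sgn N * l m + (h (suc N ℕ.∸ m) + h (N ℕ.+ m)))) N)
        (cong (error N +_) (trans (∑-* (- O) (λ m → sgn N * l m + (h (suc N ℕ.∸ m) + h (N ℕ.+ m))) N)
          (cong (- O *_) (trans (∑-+ (λ m → sgn N * l m) (λ m → h (suc N ℕ.∸ m) + h (N ℕ.+ m)) N)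
            (cong₂ _+_ (trans (∑-* (sgn N) l N) (cong (sgn N *_) (sym (leibniz≡∑ N))))
              (trans (∑-+ (λ m → h (suc N ℕ.∸ m)) (λ m → h (N ℕ.+ m)) N)
                (trans (cong (_+ ∑ (λ m → h (N ℕ.+ m)) N) (∑-reverse h N)) (sym (∑-split h N N)))))))))) ⟩
  (error N + - O * (sgn N * leibniz N + H (N ℕ.+ N))) + O * (H (N ℕ.+ N) + - O)
    ≡⟨ ring (error N) O (sgn N * leibniz N) (H (N ℕ.+ N)) ⟩
  error N - O * (sgn N * leibniz N) - O * O ∎
  where
  open ≡-Reasoning
  O = odd⁻¹ N
  p = ℕ.pred
  H = altHarmonic
  h = altHarmonicTerm
  l : ℕ → ℚ
  l m = sgn (p m) * (4ℚ * odd⁻¹ (p m))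
  e : ℕ → ℚ
  e m = odd⁻¹ (p m) * (H (N ℕ.+ p m) - H (N ℕ.∸ m))
  ring : ∀ E O L H → (E + - O * (L + H)) + O * (H + - O) ≡ E - O * L - O * O
  ring = solve-∀ ringℚ
  lastTerm : odd⁻¹ N * (H (suc N ℕ.+ N) - H (suc N ℕ.∸ suc N)) ≡ O * (H (N ℕ.+ N) + - O)
  lastTerm = cong (O *_) (trans (cong (λ t → H (suc N ℕ.+ N) - H t) (ℕₚ.n∸n≡0 N))
    (trans (ring₀ (H (N ℕ.+ N)) (h (suc (N ℕ.+ N)))) (cong (H (N ℕ.+ N) +_)
      (trans (cong (λ t → h (suc t)) (sym 2N)) (trans (cong (λ t → - 1ℚ * t * O) (sgn-2* N)) (ring₁ O))))))
    where
    2N : 2 ℕ.* N ≡ N ℕ.+ N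
    2N = cong (N ℕ.+_) (ℕₚ.+-identityʳ N)
    ring₀ : ∀ a b → (a + b) - 0ℚ ≡ a + b
    ring₀ = solve-∀ ringℚ
    ring₁ : ∀ x → - 1ℚ * 1ℚ * x ≡ - x
    ring₁ = solve-∀ ringℚ
  split : ∀ m → 1 ≤ m → m ≤ N → odd⁻¹ (p m) * (H (suc N ℕ.+ p m) - H (suc N ℕ.∸ m)) ≡
          e m + - O * (sgn N * l m + (h (suc N ℕ.∸ m) + h (N ℕ.+ m)))
  split (suc n) _ n<N = begin
    odd⁻¹ n * ((H (N ℕ.+ n) + h (suc (N ℕ.+ n))) - H (N ℕ.∸ n))
      ≡⟨ cong₂ (λ u v → odd⁻¹ n * ((H (N ℕ.+ n) + h u) - H v)) (sym (ℕₚ.+-suc N n)) (∸-suc′ N n n<N) ⟩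
    odd⁻¹ n * ((H (N ℕ.+ n) + h (N ℕ.+ suc n)) - (H (N ℕ.∸ suc n) + h (suc (N ℕ.∸ suc n))))
      ≡⟨ ring₁ (odd⁻¹ n) (H (N ℕ.+ n)) (h (N ℕ.+ suc n)) (H (N ℕ.∸ suc n)) (h (suc (N ℕ.∸ suc n))) ⟩
    e (suc n) + odd⁻¹ n * (h (N ℕ.+ suc n) - h (suc (N ℕ.∸ suc n)))
      ≡⟨ cong (λ t → e (suc n) + odd⁻¹ n * (h (N ℕ.+ suc n) - h t)) (sym (∸-suc′ N n n<N)) ⟩
    e (suc n) + odd⁻¹ n * (h (N ℕ.+ suc n) - h (N ℕ.∸ n))
      ≡⟨ cong (e (suc n) +_) (error-term N n n<N) ⟩
    e (suc n) + - O * (sgn N * l (suc n) + (h (N ℕ.∸ n) + h (N ℕ.+ suc n))) ∎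
    where
    ∸-suc′ : ∀ N n → n ℕ.< N → N ℕ.∸ n ≡ suc (N ℕ.∸ suc n)
    ∸-suc′ (suc N) n (s≤s n≤N) = ℕₚ.+-∸-assoc 1 n≤N
    ring₁ : ∀ o a b c d → o * ((a + b) - (c + d)) ≡ o * (a - c) + o * (b - d)
    ring₁ = solve-∀ ringℚ

-- Let O = 1/(2N + 1), and let s and L be the sign and the partial sum at N. The square grows by
-- 8OsL + 16O²: `error` supplies 8OsL + 8O², and `oddInv²` the other 8O².
leibniz² : ∀ N → leibniz N * leibniz N ≡ 8ℚ * (oddInv² N - error N)
leibniz² zero    = refl
leibniz² (suc N) = begin
  leibniz (suc N) * leibniz (suc N)
    ≡⟨ cong₂ _*_ (leibniz-suc N) (leibniz-suc N) ⟩
  (L + s * (4ℚ * O)) * (L + s * (4ℚ * O))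
    ≡⟨ ring₁ L s O ⟩
  L * L + 8ℚ * (O * (s * L)) + (s * s) * (8ℚ * (O * O) + 8ℚ * (O * O))
    ≡⟨ cong₂ (λ u v → u + 8ℚ * (O * (s * L)) + v * (8ℚ * (O * O) + 8ℚ * (O * O))) (leibniz² N) (sgn² N) ⟩
  8ℚ * (oddInv² N - error N) + 8ℚ * (O * (s * L)) + 1ℚ * (8ℚ * (O * O) + 8ℚ * (O * O))
    ≡⟨ ring₂ 8ℚ (oddInv² N) (error N) (O * (s * L)) (O * O) ⟩
  8ℚ * ((oddInv² N + O * O) - (error N - O * (s * L) - O * O))
    ≡⟨ cong (λ t → 8ℚ * ((oddInv² N + O * O) - t)) (error-suc N) ⟨
  8ℚ * (oddInv² (suc N) - error (suc N)) ∎
  where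
  open ≡-Reasoning
  L = leibniz N
  s = sgn N
  O = odd⁻¹ N
  ring₀ : ∀ f L s O → (L + s * (f * O)) * (L + s * (f * O)) ≡ L * L + (f + f) * (O * (s * L)) + (s * s) * (f * f * (O * O))
  ring₀ = solve-∀ ringℚ
  ring₁ : ∀ L s O → (L + s * (4ℚ * O)) * (L + s * (4ℚ * O)) ≡ L * L + 8ℚ * (O * (s * L)) + (s * s) * (8ℚ * (O * O) + 8ℚ * (O * O))
  ring₁ L s O = trans (ring₀ 4ℚ L s O) (cong (λ t → L * L + 8ℚ * (O * (s * L)) + (s * s) * t) (*-distribʳ-+ (O * O) 8ℚ 8ℚ))
  ring₂ : ∀ f a b c d → f * (a - b) + f * c + 1ℚ * (f * d + f * d) ≡ f * ((a + d) - (b - c - d))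
  ring₂ = solve-∀ ringℚ

-- The Euler product of ζ(2)

lim-reindex₁ : ∀ {u v : ℕ → ℚ} {φ} → Unbounded φ → Lim ev u v → Lim ev (λ n → u (φ n)) (λ n → v (φ n))
lim-reindex₁ {φ = φ} h l = lim (small λ ε 0<ε →
  let M , s = at (diff l) ε 0<ε
      N , t = h M
  in N , λ n p → s (φ n) (t n p))

-- The alternating series estimate, normalised by the sign of the leading term. Removing that term
-- leaves the same situation with `suc a`, so the two bounds are proved together.
altHarmonic-bounds : ∀ r a → let d = sgn (suc a) * ∑ (λ j → altHarmonicTerm (a ℕ.+ j)) r in
                     d ≥0 × d ≤ℚ inv (ℕ→ℚ (suc a))
altHarmonic-bounds zero    a = ≤-reflexive (sym (*-zeroʳ (sgn (suc a)))) ,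
  subst (_≤ℚ inv (ℕ→ℚ (suc a))) (sym (*-zeroʳ (sgn (suc a)))) (inv-ℕ-≥0 (suc a))
altHarmonic-bounds (suc r) a =
    subst (0ℚ ≤ℚ_) (sym e) (≤⇒0≤- (≤-trans (proj₂ ih) (inv-ℕ-anti {suc a} (s≤s z≤n) (ℕₚ.n≤1+n (suc a))))) ,
    subst (_≤ℚ i) (sym e) (-‿≤ i (proj₁ ih))
  where
  ih = altHarmonic-bounds r (suc a)
  i = inv (ℕ→ℚ (suc a))
  S = ∑ (λ j → altHarmonicTerm (suc a ℕ.+ j)) r
  ring : ∀ s i S → s * (s * i + S) ≡ (s * s) * i - (- 1ℚ * s) * S
  ring = solve-∀ ringℚ
  e : sgn (suc a) * ∑ (λ j → altHarmonicTerm (a ℕ.+ j)) (suc r) ≡ i - sgn (suc (suc a)) * S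
  e = trans (cong (sgn (suc a) *_) (trans (∑-split (λ j → altHarmonicTerm (a ℕ.+ j)) 1 r)
        (cong₂ _+_ (trans (+-identityˡ (altHarmonicTerm (a ℕ.+ 1))) (cong altHarmonicTerm (ℕₚ.+-comm a 1)))
          (∑-cong r λ j _ _ → cong altHarmonicTerm (ℕₚ.+-suc a j)))))
      (trans (ring (sgn (suc a)) i S) (trans (cong (λ t → t * i - sgn (suc (suc a)) * S) (sgn² (suc a)))
        (cong (_- sgn (suc (suc a)) * S) (*-identityˡ i))))

altHarmonic-diff : ∀ a r → abs (altHarmonic (a ℕ.+ r) - altHarmonic a) ≤ℚ inv (ℕ→ℚ (suc a))
altHarmonic-diff a r = subst (_≤ℚ inv (ℕ→ℚ (suc a))) (sym e) (subst (_≤ℚ inv (ℕ→ℚ (suc a))) (sym (abs-≥0 (proj₁ b))) (proj₂ b))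
  where
  b = altHarmonic-bounds r a
  S = ∑ (λ j → altHarmonicTerm (a ℕ.+ j)) r
  ring : ∀ x y → (x + y) - x ≡ y
  ring = solve-∀ ringℚ
  abs-sgn : ∀ n → abs (sgn n) ≡ 1ℚ
  abs-sgn zero    = refl
  abs-sgn (suc n) = trans (∣p*q∣≡∣p∣*∣q∣ (- 1ℚ) (sgn n)) (trans (cong (abs (- 1ℚ) *_) (abs-sgn n)) refl)
  e : abs (altHarmonic (a ℕ.+ r) - altHarmonic a) ≡ abs (sgn (suc a) * S)
  e = trans (cong (λ t → abs (t - altHarmonic a)) (∑-split altHarmonicTerm a r))
    (trans (cong abs (ring (altHarmonic a) S))
      (sym (trans (∣p*q∣≡∣p∣*∣q∣ (sgn (suc a)) S) (trans (cong (_* abs S) (abs-sgn (suc a))) (*-identityˡ (abs S))))))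

harmonic : ℕ → ℚ
harmonic = ∑ (λ m → inv (ℕ→ℚ m))

-- Here 1/(2m - 1) ≤ 1/m, and the alternating tail is at most 1/(N + 1 - m). The product of the two
-- bounds is (1/m + 1/(N + 1 - m))/(N + 1), and the second fraction runs through the first one
-- backwards.
error-bound : ∀ N → abs (error N) ≤ℚ inv (ℕ→ℚ (suc N)) * (harmonic N + harmonic N)
error-bound N = ≤-trans (∑-abs _ N) (≤-trans (∑-mono N term) (≤-reflexive (begin
    ∑ (λ m → I * (i m + i (suc N ℕ.∸ m))) N  ≡⟨ ∑-* I (λ m → i m + i (suc N ℕ.∸ m)) N ⟩
    I * ∑ (λ m → i m + i (suc N ℕ.∸ m)) N    ≡⟨ cong (I *_) (∑-+ i (λ m → i (suc N ℕ.∸ m)) N) ⟩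
    I * (harmonic N + ∑ (λ m → i (suc N ℕ.∸ m)) N) ≡⟨ cong (λ t → I * (harmonic N + t)) (∑-reverse i N) ⟩
    I * (harmonic N + harmonic N) ∎)))
  where
  open ≡-Reasoning
  i : ℕ → ℚ
  i m = inv (ℕ→ℚ m)
  I = i (suc N)
  term : ∀ m → 1 ≤ m → m ≤ N → abs (odd⁻¹ (ℕ.pred m) * (altHarmonic (N ℕ.+ ℕ.pred m) - altHarmonic (N ℕ.∸ m))) ≤ℚ
         I * (i m + i (suc N ℕ.∸ m))
  term m@(suc n) 1≤m m≤N = subst₂ _≤ℚ_ (sym (trans (∣p*q∣≡∣p∣*∣q∣ (odd⁻¹ n) D) (cong (_* abs D) (abs-≥0 (inv-ℕ-≥0 (suc (2 ℕ.* n))))))) split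
      (*-mono (0≤∣p∣ D) (inv-ℕ-≥0 m) (inv-ℕ-anti {m} 1≤m (s≤s (ℕₚ.m≤m+n n (n ℕ.+ 0))))
        (subst₂ (λ u v → abs (altHarmonic u - altHarmonic a) ≤ℚ inv (ℕ→ℚ v)) N+n (sym (ℕₚ.+-∸-assoc 1 m≤N))
          (altHarmonic-diff a (suc (2 ℕ.* n)))))
    where
    a = N ℕ.∸ m
    D = altHarmonic (N ℕ.+ n) - altHarmonic a
    ringℕ : ∀ a n → a ℕ.+ suc (2 ℕ.* n) ≡ a ℕ.+ suc n ℕ.+ n
    ringℕ = solve-ℕ
    N+n : a ℕ.+ suc (2 ℕ.* n) ≡ N ℕ.+ n
    N+n = trans (ringℕ a n) (cong (ℕ._+ n) (ℕₚ.m∸n+n≡m m≤N))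
    b = suc N ℕ.∸ m
    1≤b : 1 ≤ b
    1≤b = ℕₚ.m<n⇒0<n∸m (s≤s m≤N)
    m+b : ℕ→ℚ (suc N) ≡ ℕ→ℚ m + ℕ→ℚ b
    m+b = trans (cong ℕ→ℚ (sym (ℕₚ.m+[n∸m]≡n (ℕₚ.m≤n⇒m≤1+n m≤N)))) (ℕ→ℚ-+ m b)
    ring : ∀ M B X Y → (M + B) * (X * Y) ≡ (M * X) * Y + (B * Y) * X
    ring = solve-∀ ringℚ
    split : i m * i b ≡ I * (i m + i b)
    split = *-cancelˡ (ℕ→ℚ-pos {suc N} (s≤s z≤n)) (begin
      ℕ→ℚ (suc N) * (i m * i b)              ≡⟨ cong (_* (i m * i b)) m+b ⟩
      (ℕ→ℚ m + ℕ→ℚ b) * (i m * i b)          ≡⟨ ring (ℕ→ℚ m) (ℕ→ℚ b) (i m) (i b) ⟩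
      (ℕ→ℚ m * i m) * i b + (ℕ→ℚ b * i b) * i m
        ≡⟨ cong₂ (λ u v → u * i b + v * i m) (inv-inverseʳ (pos⇒≢0 (ℕ→ℚ-pos {m} 1≤m))) (inv-inverseʳ (pos⇒≢0 (ℕ→ℚ-pos 1≤b))) ⟩
      1ℚ * i b + 1ℚ * i m                    ≡⟨ ring₂ (i m) (i b) ⟩
      1ℚ * (i m + i b)                       ≡⟨ cong (_* (i m + i b)) (inv-inverseʳ (pos⇒≢0 (ℕ→ℚ-pos {suc N} (s≤s z≤n)))) ⟨
      (ℕ→ℚ (suc N) * I) * (i m + i b)        ≡⟨ *-assoc (ℕ→ℚ (suc N)) I (i m + i b) ⟩
      ℕ→ℚ (suc N) * (I * (i m + i b)) ∎)
      where
      ring₂ : ∀ x y → 1ℚ * y + 1ℚ * x ≡ 1ℚ * (x + y)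
      ring₂ = solve-∀ ringℚ

harmonic-mean : Small ev (λ N → inv (ℕ→ℚ (suc N)) * harmonic N)
harmonic-mean = small-scale 2ℚ (positive⁻¹ 2ℚ) λ ε 0<ε →
  let y , 1≤y , iy≤ε = inv-small 0<ε
  in Ev² ev (λ N y≤N b → bound ε y 1≤y iy≤ε N y≤N b) (y , λ N y≤N → y≤N)
       (at (small-* (bdd-const (harmonic y)) (small-dom (pure ev λ N →
          subst (_≤ℚ inv (ℕ→ℚ (suc N))) (sym (abs-≥0 (inv-ℕ-≥0 (suc N)))) ≤-refl) small-inv-suc)) ε 0<ε)
  where
  small-inv-suc : Small ev (λ N → inv (ℕ→ℚ (suc N)))
  small-inv-suc = small λ ε 0<ε → let N , h = at small-inv ε 0<ε in N , λ n p → h (suc n) (ℕₚ.m≤n⇒m≤1+n p)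
  bound : ∀ ε y → 1 ≤ y → inv (ℕ→ℚ y) ≤ℚ ε → ∀ N → y ≤ N → abs (harmonic y * inv (ℕ→ℚ (suc N))) ≤ℚ ε →
          abs (inv (ℕ→ℚ (suc N)) * harmonic N) ≤ℚ 2ℚ * ε
  bound ε y 1≤y iy≤ε N y≤N b = subst₂ _≤ℚ_ (sym e) (two ε)
      (+-mono-≤ (≤-trans (≤-abs (harmonic y * I)) b)
        (avg-∑-≤ (suc N) 0≤ε (≤-trans (∑-mono R λ r 1≤r _ → ≤-trans (inv-ℕ-anti 1≤y (ℕₚ.m≤m+n y r)) iy≤ε)
          (subst (_≤ℚ ℕ→ℚ (suc N) * ε) (sym (∑-const ε R)) (*-monoʳ 0≤ε (ℕ→ℚ-mono (ℕₚ.≤-trans (ℕₚ.m∸n≤m N y) (ℕₚ.n≤1+n N))))))))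
    where
    I = inv (ℕ→ℚ (suc N))
    R = N ℕ.∸ y
    T = ∑ (λ r → inv (ℕ→ℚ (y ℕ.+ r))) R
    0≤ε : ε ≥0
    0≤ε = ≤-trans (inv-ℕ-≥0 y) iy≤ε
    two : ∀ x → x + x ≡ 2ℚ * x
    two = solve-∀ ringℚ
    ring : ∀ I a b → I * (a + b) ≡ a * I + I * b
    ring = solve-∀ ringℚ
    e : abs (I * harmonic N) ≡ harmonic y * I + I * T
    e = trans (abs-≥0 (*-≥0 (inv-ℕ-≥0 (suc N)) (∑-≥0 N λ m _ _ → inv-ℕ-≥0 m)))
          (trans (cong (I *_) (trans (cong harmonic (sym (ℕₚ.m+[n∸m]≡n y≤N))) (∑-split (λ m → inv (ℕ→ℚ m)) y R)))
            (ring I (harmonic y) T))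

error-small : Small ev error
error-small = small-dom (pure ev error-bound)
  (small-cong (λ N → sym (*-distribˡ-+ (inv (ℕ→ℚ (suc N))) (harmonic N) (harmonic N))) (small-+ harmonic-mean harmonic-mean))

ζ : ℕ → ℚ
ζ = ∑ inv²

ζ-close : ∀ {m n} → 1 ≤ m → m ≤ n → abs (ζ n - ζ m) ≤ℚ inv (ℕ→ℚ m)
ζ-close {m} {n} 1≤m m≤n = subst (_≤ℚ inv (ℕ→ℚ m)) (sym (trans (cong abs e) (abs-≥0 (∑-≥0 (n ℕ.∸ m) λ r _ _ → inv²-≥0 (m ℕ.+ r)))))
    (inv²-tail′ m (n ℕ.∸ m) 1≤m)
  where
  ring : ∀ x y → (x + y) - x ≡ y
  ring = solve-∀ ringℚ
  e : ζ n - ζ m ≡ ∑ (λ r → inv² (m ℕ.+ r)) (n ℕ.∸ m)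
  e = trans (cong (_- ζ m) (trans (cong ζ (sym (ℕₚ.m+[n∸m]≡n m≤n))) (∑-split inv² m (n ℕ.∸ m))))
        (ring (ζ m) (∑ (λ r → inv² (m ℕ.+ r)) (n ℕ.∸ m)))

ζ-reindex : ∀ {φ} → Unbounded φ → Lim ev (λ n → ζ (φ n)) ζ
ζ-reindex {φ} h = lim (small λ ε 0<ε →
  let m , 1≤m , im≤ε = inv-small 0<ε
      N , g = h m
  in N ⊔ m , λ n p → close ε m 1≤m im≤ε (g n (ℕₚ.m⊔n≤o⇒m≤o N m p)) (ℕₚ.m⊔n≤o⇒n≤o N m p))
  where
  close : ∀ ε m → 1 ≤ m → inv (ℕ→ℚ m) ≤ℚ ε → ∀ {a b} → m ≤ a → m ≤ b → abs (ζ a - ζ b) ≤ℚ ε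
  close ε m 1≤m h {a} {b} m≤a m≤b with ℕₚ.≤-total a b
  ... | inj₁ a≤b = subst (_≤ℚ ε) (abs-sym (ζ b) (ζ a)) (≤-trans (ζ-close (ℕₚ.≤-trans 1≤m m≤a) a≤b) (≤-trans (inv-ℕ-anti 1≤m m≤a) h))
  ... | inj₂ b≤a = ≤-trans (ζ-close (ℕₚ.≤-trans 1≤m m≤b) b≤a) (≤-trans (inv-ℕ-anti 1≤m m≤b) h)

ζ-odd : ∀ N → ζ (2 ℕ.* N) ≡ oddInv² N + inv 4ℚ * ζ N
ζ-odd zero    = sym (trans (+-identityˡ (inv 4ℚ * 0ℚ)) (*-zeroʳ (inv 4ℚ)))
ζ-odd (suc N) = trans (cong ζ (cong suc (ℕₚ.+-suc N (N ℕ.+ 0))))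
  (trans (cong₂ _+_ (cong (_+ inv² (suc (2 ℕ.* N))) (ζ-odd N)) even)
    (ring (oddInv² N) (inv 4ℚ) (ζ N) (inv² (suc (2 ℕ.* N))) (inv² (suc N))))
  where
  ring : ∀ O q Z o e → (O + q * Z + o) + q * e ≡ (O + o) + q * (Z + e)
  ring = solve-∀ ringℚ
  m = ℕ→ℚ (suc N)
  inv2* : inv (ℕ→ℚ (suc (suc (2 ℕ.* N)))) ≡ inv (ℕ→ℚ 2) * inv m
  inv2* = trans (cong (inv ∘ ℕ→ℚ) (sym (cong suc (ℕₚ.+-suc N (N ℕ.+ 0)))))
    (trans (cong inv (ℕ→ℚ-* 2 (suc N))) (inv-* {ℕ→ℚ 2} {m} (ℕ→ℚ-pos {2} (s≤s z≤n)) (ℕ→ℚ-pos {suc N} (s≤s z≤n))))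
  swap : ∀ a b → (a * b) * (a * b) ≡ (a * a) * (b * b)
  swap = solve-∀ ringℚ
  even : inv² (suc (suc (2 ℕ.* N))) ≡ inv 4ℚ * inv² (suc N)
  even = trans (cong₂ _*_ inv2* inv2*) (swap (inv (ℕ→ℚ 2)) (inv m))

-- The even squares account for a quarter of ζ, so the odd ones for three quarters, and 8 · 3/4 = 6.
lim-leibniz² : Lim ev (λ k → leibniz k * leibniz k) (λ k → ℕ→ℚ 6 * ζ k)
lim-leibniz² = lim-cong (λ k → sym (leibniz² k)) (λ k → trans (ring 8ℚ (inv 4ℚ) (ζ k)) (cong (_* ζ k) 6≡))
  (lim-*ˡ (bdd-const 8ℚ) (lim-cong (λ k → cong (_- error k) (odd k)) (λ k → +-identityʳ (ζ k - inv 4ℚ * ζ k))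
    (lim-- (lim-- (ζ-reindex {2 ℕ.*_} λ M → M , λ n p → ℕₚ.≤-trans p (ℕₚ.m≤m+n n (n ℕ.+ 0))) lim-refl) error-lim)))
  where
  6≡ : 8ℚ - 8ℚ * inv 4ℚ ≡ ℕ→ℚ 6
  6≡ = refl
  ring : ∀ a b c → a * (c - b * c) ≡ (a - a * b) * c
  ring = solve-∀ ringℚ
  ring₀ : ∀ x → x ≡ x - 0ℚ
  ring₀ = solve-∀ ringℚ
  error-lim : Lim ev error (λ _ → 0ℚ)
  error-lim = lim (small-cong (λ k → ring₀ (error k)) error-small)
  ring₁ : ∀ x y → (x + y) - y ≡ x
  ring₁ = solve-∀ ringℚ
  odd : ∀ k → ζ (2 ℕ.* k) - inv 4ℚ * ζ k ≡ oddInv² k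
  odd k = trans (cong (_- inv 4ℚ * ζ k) (ζ-odd k)) (ring₁ (oddInv² k) (inv 4ℚ * ζ k))

-- modulus 0 1 p is p at primes and 0 elsewhere.
primeModulus : ℕ → ℕ
primeModulus = modulus 0 1

primeModulus-prime : ∀ {p} → Prime p → primeModulus p ≡ p
primeModulus-prime {p} pp = go (proj₂ (hasModulus 0 1 p))
  where
  go : ∀ {M} → Modulus 0 1 p M → M ≡ p
  go (notPrime ¬pp)    = contradiction pp ¬pp
  go (inBoth _ _ d)    = contradiction (subst Prime (Div.∣1⇒≡1 d) pp) ¬prime[1]
  go (inLeft _ _ _)    = refl
  go (inRight _ ¬d _)  = refl
  go (inNone _ ¬d _)   = contradiction (Div._∣0 p) ¬d

primeModulus-nonprime : ∀ {p} → ¬ Prime p → primeModulus p ≡ 0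
primeModulus-nonprime {p} ¬pp with modulus-prime 0 1 (proj₂ (hasModulus 0 1 p))
... | inj₁ e  = e
... | inj₂ pp = contradiction pp ¬pp

rough : ℕ → ℕ → ℚ
rough = sieve primeModulus

roughζ : ℕ → ℕ → ℚ
roughζ y = ∑ (λ n → rough y n * inv² n)

-- Sieving by a prime p removes its multiples, which contribute 1/p² times the same sum cut off at N
-- / p. That sum has the same limit, so the limit is multiplied by 1 - 1/p².
lim-roughζ : ∀ y → Lim ev (roughζ y) (λ N → eulerProduct y * ζ N)
lim-roughζ zero    = lim-≡ λ N → trans (∑-* 1ℚ inv² N) refl
lim-roughζ (suc y) = case (prime? (suc y))
  where
  p = suc y
  case : Dec (Prime p) → Lim ev (roughζ p) (λ N → eulerProduct p * ζ N)
  case (no ¬pp) = lim-cong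
    (λ N → ∑-cong N λ n 1≤n _ → cong (_* inv² n) (sym (trans (cong (λ t → rough y n * (1ℚ - 𝟙 (t ∣? n))) (primeModulus-nonprime ¬pp))
       (trans (cong (λ t → rough y n * (1ℚ - t)) (𝟙-no (0 ∣? n) λ d → ℕₚ.<⇒≢ 1≤n (sym (Div.0∣⇒≡0 d)))) (*-identityʳ (rough y n))))))
    (λ N → cong (_* ζ N) (sym (trans (cong (eulerProduct y *_) (if-no (prime? p) ¬pp)) (*-identityʳ (eulerProduct y)))))
    (lim-roughζ y)
  case (yes pp) = lim-cong (λ N → sym (recursion N)) (λ N → trans (ring (eulerProduct y) (inv² p) (ζ N))
      (cong (_* ζ N) (cong (eulerProduct y *_) (sym (if-yes (prime? p) pp)))))
    (lim-- (lim-roughζ y) (lim-*ˡ (bdd-const (inv² p)) (lim-trans (lim-reindex₁ (/-unbounded p) (lim-roughζ y))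
      (lim-*ˡ (bdd-const (eulerProduct y)) (ζ-reindex (/-unbounded p))))))
    where
    ring : ∀ E i Z → E * Z - i * (E * Z) ≡ E * (1ℚ - i) * Z
    ring = solve-∀ ringℚ
    M≡ : primeModulus p ≡ p
    M≡ = primeModulus-prime pp
    recursion : ∀ N → roughζ p N ≡ roughζ y N - inv² p * roughζ y (N / p)
    recursion N = trans (∑-cong N λ n _ _ → split n)
      (trans (∑-- (λ n → rough y n * inv² n) (λ n → 𝟙 (p ∣? n) * (rough y n * inv² n)) N)
        (cong (λ t → roughζ y N - t) (trans (∑-multiples p (λ n → rough y n * inv² n) N)
          (trans (∑-cong (N / p) λ q 1≤q _ → dilate q 1≤q) (∑-* (inv² p) (λ n → rough y n * inv² n) (N / p))))))
      where
      ring₁ : ∀ r t i → r * (1ℚ - t) * i ≡ r * i - t * (r * i)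
      ring₁ = solve-∀ ringℚ
      split : ∀ n → rough p n * inv² n ≡ rough y n * inv² n - 𝟙 (p ∣? n) * (rough y n * inv² n)
      split n = trans (cong (λ t → rough y n * (1ℚ - 𝟙 (t ∣? n)) * inv² n) M≡) (ring₁ (rough y n) (𝟙 (p ∣? n)) (inv² n))
      dilate : ∀ q → 1 ≤ q → rough y (p ℕ.* q) * inv² (p ℕ.* q) ≡ inv² p * (rough y q * inv² q)
      dilate q 1≤q = trans (cong₂ _*_
          (subst (λ t → rough y (t ℕ.* q) ≡ rough y q) M≡
            (CoprimeModuli.sieve-* primeModulus (modulus-coprime 0 1) y q λ z → ℕₚ.1+n≢0 (trans (sym M≡) z)))
          (cong₂ _*_ inv-pq inv-pq))
        (ring₂ (rough y q) (inv (ℕ→ℚ p)) (inv (ℕ→ℚ q)))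
        where
        inv-pq : inv (ℕ→ℚ (p ℕ.* q)) ≡ inv (ℕ→ℚ p) * inv (ℕ→ℚ q)
        inv-pq = trans (cong inv (ℕ→ℚ-* p q)) (inv-* {ℕ→ℚ p} {ℕ→ℚ q} (ℕ→ℚ-pos {p} (s≤s z≤n)) (ℕ→ℚ-pos 1≤q))
        ring₂ : ∀ r i j → r * ((i * j) * (i * j)) ≡ (i * i) * (r * (j * j))
        ring₂ = solve-∀ ringℚ

-- A number n > 1 without prime factors up to y exceeds y. So only n = 1 and a part of the tail of
-- the sum of 1/n² beyond y remain.
roughζ-bounds : ∀ y N → 1 ≤ y → 1 ≤ N → abs (roughζ y N - 1ℚ) ≤ℚ inv (ℕ→ℚ y)
roughζ-bounds y N 1≤y 1≤N = abs-≤ upper lower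
  where
  cases : ∀ n → rough y n ≡ 1ℚ × (∀ i → 1 ≤ i → i ≤ y → ¬ (primeModulus i ∣ n)) ⊎ rough y n ≡ 0ℚ
  cases n with sieve-dichotomy primeModulus y n
  ... | inj₁ h = inj₁ (sieve≡1 primeModulus y n h , h)
  ... | inj₂ e = inj₂ e
  rough-≥0 : ∀ n → rough y n ≥0
  rough-≥0 n with cases n
  ... | inj₁ (e , _) = subst (0ℚ ≤ℚ_) (sym e) 0≤1
  ... | inj₂ e       = ≤-reflexive (sym e)
  rough1 : rough y 1 * inv² 1 ≡ 1ℚ
  rough1 = cong (_* 1ℚ) (sieve≡1 primeModulus y 1 λ i _ _ d → go i (proj₂ (hasModulus 0 1 i)) (Div.∣1⇒≡1 d))
    where
    go : ∀ i {M} → Modulus 0 1 i M → M ≢ 1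
    go i (notPrime _)     ()
    go i (inBoth pi _ d)  _ = ¬prime[1] (subst Prime (Div.∣1⇒≡1 d) pi)
    go i (inLeft pi _ _)  e = ¬prime[1] (subst Prime e pi)
    go i (inRight pi _ _) e = ¬prime[1] (subst Prime e pi)
    go i (inNone _ ¬d _)  _ = ¬d (Div._∣0 i)
  T≥1 : 1ℚ ≤ℚ roughζ y N
  T≥1 = subst (_≤ℚ roughζ y N) rough1 (∑-term {λ n → rough y n * inv² n} N 1 (λ n _ _ → *-≥0 (rough-≥0 n) (inv²-≥0 n)) (s≤s z≤n) 1≤N)
  neg-sub : ∀ a b → - (a - b) ≡ b - a
  neg-sub = solve-∀ ringℚ
  lower : - (roughζ y N - 1ℚ) ≤ℚ inv (ℕ→ℚ y)
  lower = ≤-trans (subst (_≤ℚ 0ℚ) (sym (neg-sub (roughζ y N) 1ℚ))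
    (0≤-⇒≤ (subst (0ℚ ≤ℚ_) (ring (roughζ y N)) (≤⇒0≤- T≥1)))) (inv-ℕ-≥0 y)
    where
    ring : ∀ T → T - 1ℚ ≡ 0ℚ - (1ℚ - T)
    ring = solve-∀ ringℚ
  term : ∀ n → 1 ≤ n → n ≤ N → rough y n * inv² n ≤ℚ 𝟙 (n ℕₚ.≟ 1) + 𝟙 (y ℕ.<? n) * inv² n
  term n 1≤n _ = case (n ℕₚ.≟ 1) (cases n)
    where
    t = 𝟙 (y ℕ.<? n) * inv² n
    0≤t : t ≥0
    0≤t = *-≥0 (𝟙-≥0 (y ℕ.<? n)) (inv²-≥0 n)
    case : Dec (n ≡ 1) → rough y n ≡ 1ℚ × (∀ i → 1 ≤ i → i ≤ y → ¬ (primeModulus i ∣ n)) ⊎ rough y n ≡ 0ℚ →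
           rough y n * inv² n ≤ℚ 𝟙 (n ℕₚ.≟ 1) + t
    case (yes e) _ = subst (λ z → rough y n * inv² n ≤ℚ z + t) (sym (𝟙-yes (n ℕₚ.≟ 1) e))
      (subst (_≤ℚ 1ℚ + t) (sym (trans (cong (λ z → rough y z * inv² z) e) rough1)) (≤-+ʳ {1ℚ} {t} 0≤t))
    case (no n≢1) (inj₂ e) = subst (_≤ℚ 𝟙 (n ℕₚ.≟ 1) + t) (sym (trans (cong (_* inv² n) e) (*-zeroˡ (inv² n))))
      (+-≥0 (𝟙-≥0 (n ℕₚ.≟ 1)) 0≤t)
    case (no n≢1) (inj₁ (e , h)) = ≤-trans
      (≤-reflexive (cong (_* inv² n) (trans e (sym (𝟙-yes (y ℕ.<? n) y<n))))) (≤-+ˡ {t} (𝟙-≥0 (n ℕₚ.≟ 1)))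
      where
      y<n : y ℕ.< n
      y<n = ℕₚ.≰⇒> λ n≤y → let q , pq , q∣n = primeDivisor (ℕₚ.≤∧≢⇒< 1≤n (n≢1 ∘ sym)) in
        h q (prime-≥1 pq) (ℕₚ.≤-trans (∣⇒≤′ 1≤n q∣n) n≤y) (subst (_∣ n) (sym (primeModulus-prime pq)) q∣n)
  upper : roughζ y N - 1ℚ ≤ℚ inv (ℕ→ℚ y)
  upper = 0≤-⇒≤ (subst (0ℚ ≤ℚ_) (ring (inv (ℕ→ℚ y)) (roughζ y N)) (≤⇒0≤- (≤-trans (∑-mono N term)
      (subst (_≤ℚ 1ℚ + inv (ℕ→ℚ y)) (sym (∑-+ (λ n → 𝟙 (n ℕₚ.≟ 1)) (λ n → 𝟙 (y ℕ.<? n) * inv² n) N))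
        (+-mono-≤ (≤-reflexive (trans (∑-single {λ n → 𝟙 (n ℕₚ.≟ 1)} N 1 (λ n _ _ n≢1 → 𝟙-no (n ℕₚ.≟ 1) n≢1) (s≤s z≤n) 1≤N) refl))
          (∑-above-inv² y N 1≤y))))))
    where
    ring : ∀ i T → (1ℚ + i) - T ≡ i - (T - 1ℚ)
    ring = solve-∀ ringℚ

lim-euler-ζ : Lim ev² (λ (y , k) → eulerProduct y * ζ k) (λ _ → 1ℚ)
lim-euler-ζ = lim-trans {v = λ (y , k) → roughζ y k} (lim-sym (lim (small λ ε 0<ε → 0 , λ y _ → at (diff (lim-roughζ y)) ε 0<ε)))
  (lim (small λ ε 0<ε → let m , 1≤m , h = inv-small 0<ε in
    m , λ y m≤y → 1 , λ N 1≤N → ≤-trans (roughζ-bounds y N (ℕₚ.≤-trans 1≤m m≤y) 1≤N) (≤-trans (inv-ℕ-anti 1≤m m≤y) h)))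

eulerFactor-bounds : ∀ i → eulerFactor i ≥0 × eulerFactor i ≤ℚ 1ℚ
eulerFactor-bounds i = case (prime? i)
  where
  case : Dec (Prime i) → eulerFactor i ≥0 × eulerFactor i ≤ℚ 1ℚ
  case (no ¬pi) = subst (λ t → t ≥0 × t ≤ℚ 1ℚ) (sym (if-no (prime? i) ¬pi)) (0≤1 , ≤-refl)
  case (yes pi) = subst (λ t → t ≥0 × t ≤ℚ 1ℚ) (sym (if-yes (prime? i) pi))
    (≤⇒0≤- (*-mono {inv (ℕ→ℚ i)} {1ℚ} {inv (ℕ→ℚ i)} {1ℚ} (inv-ℕ-≥0 i) 0≤1 i≤1 i≤1) , -‿≤ 1ℚ (inv²-≥0 i))
    where
    i≤1 : inv (ℕ→ℚ i) ≤ℚ 1ℚ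
    i≤1 = inv-ℕ-anti {1} (s≤s z≤n) (prime-≥1 pi)

eulerProduct-bounds : ∀ y → eulerProduct y ≥0 × eulerProduct y ≤ℚ 1ℚ
eulerProduct-bounds zero    = 0≤1 , ≤-refl
eulerProduct-bounds (suc y) = let a , b = eulerProduct-bounds y ; c , d = eulerFactor-bounds (suc y) in
  *-≥0 a c , subst (eulerProduct (suc y) ≤ℚ_) refl (*-mono {eulerProduct y} {1ℚ} {eulerFactor (suc y)} {1ℚ} c 0≤1 b d)

-- The constant 6/π² as the limit of the Euler products

κ : ℕ → ℚ
κ = seq 6/π²

private
  πₗ = proj₁ π-positive
  0<πₗ = proj₁ (proj₂ π-positive)

  leibniz-large : Ev ev (λ k → πₗ ≤ℚ leibniz k)
  leibniz-large = proj₂ (proj₂ π-positive)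

  leibniz⁻² : ℕ → ℚ
  leibniz⁻² k = inv (leibniz k * (leibniz k * 1ℚ))

  leibniz⁻²-≤ : ∀ {l} → πₗ ≤ℚ l → 0ℚ <ℚ l * (l * 1ℚ) × abs (inv (l * (l * 1ℚ))) ≤ℚ inv (πₗ * πₗ)
  leibniz⁻²-≤ {l} h = 0<ll , subst (_≤ℚ inv (πₗ * πₗ)) (sym (abs-≥0 (<⇒≤ (inv-pos 0<ll))))
      (inv-anti (*-pos 0<πₗ 0<πₗ) (subst (λ t → πₗ * πₗ ≤ℚ l * t) (sym (*-identityʳ l))
        (*-mono (<⇒≤ 0<πₗ) (<⇒≤ 0<l) h h)))
    where
    0<l : 0ℚ <ℚ l
    0<l = <-≤-trans 0<πₗ h
    0<ll : 0ℚ <ℚ l * (l * 1ℚ)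
    0<ll = *-pos 0<l (*-pos 0<l 0<1)

bdd-leibniz⁻² : Bdd ev leibniz⁻²
bdd-leibniz⁻² = bdd (inv (πₗ * πₗ)) (inv-pos (*-pos 0<πₗ 0<πₗ)) (map ev (λ k h → proj₂ (leibniz⁻²-≤ h)) leibniz-large)

κ-bdd : Bdd ev κ
κ-bdd = bdd-* (bdd-const (ℕ→ℚ 6)) bdd-leibniz⁻²

-- Once the Leibniz sum ℓ is bounded below, E - 6/ℓ² = (Eℓ² - 6)/ℓ², and Eℓ² is close to 6Eζ, hence
-- to 6.
lim-euler : Lim ev² (λ (y , k) → eulerProduct y) (λ (y , k) → κ k)
lim-euler = lim (small-dom {v = v} (pure ev λ y → map ev (λ k h → ≤-reflexive (cong abs (e y k h))) leibniz-large)
    (small-abs (small-* (bdd-∘proj₂ bdd-leibniz⁻²) (diff toSix))))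
  where
  v : ℕ × ℕ → ℚ
  v (y , k) = abs (leibniz⁻² k * (eulerProduct y * (leibniz k * leibniz k) - ℕ→ℚ 6))
  small-abs : ∀ {I} {F : Filter I} {u : I → ℚ} → Small F u → Small F (λ i → abs (u i))
  small-abs {F = F} {u} s = small λ ε 0<ε → map F (λ i → subst (_≤ℚ ε) (sym (ℚₚ.∣∣p∣∣≡∣p∣ (u i)))) (at s ε 0<ε)
  toSix : Lim ev² (λ (y , k) → eulerProduct y * (leibniz k * leibniz k)) (λ _ → ℕ→ℚ 6)
  toSix = lim-trans (lim-*ˡ (bdd-≤ 1ℚ λ (y , k) → subst (_≤ℚ 1ℚ) (sym (abs-≥0 (proj₁ (eulerProduct-bounds y)))) (proj₂ (eulerProduct-bounds y)))
      (lim-∘proj₂ lim-leibniz²))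
    (lim-cong (λ (y , k) → ring (ℕ→ℚ 6) (eulerProduct y) (ζ k)) (λ _ → *-identityʳ (ℕ→ℚ 6)) (lim-*ˡ (bdd-const (ℕ→ℚ 6)) lim-euler-ζ))
    where
    ring : ∀ a b c → a * (b * c) ≡ b * (a * c)
    ring = solve-∀ ringℚ
  e : ∀ y k → πₗ ≤ℚ leibniz k → eulerProduct y - κ k ≡ leibniz⁻² k * (eulerProduct y * (leibniz k * leibniz k) - ℕ→ℚ 6)
  e y k h = trans (cong (_- κ k) (trans (sym (*-identityʳ (eulerProduct y))) (cong (eulerProduct y *_) (sym (inv-inverseʳ (pos⇒≢0 (proj₁ (leibniz⁻²-≤ h))))))))
    (ring (eulerProduct y) (leibniz k) (leibniz⁻² k) (ℕ→ℚ 6))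
    where
    ring : ∀ E l j s → E * (l * (l * 1ℚ) * j) - s * j ≡ j * (E * (l * l) - s)
    ring = solve-∀ ringℚ

-- A positive lower bound is what turns the frequency of a squarefull part f into an upper bound for
-- 1/σ_f.
κ-positive : ∃[ η ] (0ℚ <ℚ η × Ev ev (λ k → η ≤ℚ κ k))
κ-positive = ℕ→ℚ 6 * inv (B * B) , *-pos {ℕ→ℚ 6} (ℕ→ℚ-pos {6} (s≤s z≤n)) (inv-pos (*-pos 0<B 0<B)) ,
    Ev² ev (λ k h b → *-monoˡ {ℕ→ℚ 6} (ℕ→ℚ-≥0 6) (inv-anti (proj₁ (leibniz⁻²-≤ h)) (subst (λ t → leibniz k * t ≤ℚ B * B) (sym (*-identityʳ (leibniz k)))
      (*-mono (<⇒≤ (<-≤-trans 0<πₗ h)) (<⇒≤ 0<B) (≤-trans (≤-abs (leibniz k)) b) (≤-trans (≤-abs (leibniz k)) b)))))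
      leibniz-large leibniz-bdd
  where
  N₀ = proj₁ (cauchy π 1ℚ 0<1)
  B = 1ℚ + abs (leibniz N₀)
  0<B : 0ℚ <ℚ B
  0<B = +-pos 0<1 (0≤∣p∣ (leibniz N₀))
  leibniz-bdd : Ev ev (λ k → abs (leibniz k) ≤ℚ B)
  leibniz-bdd = N₀ , λ k h → subst (λ t → abs t ≤ℚ B) (p-q+q (leibniz k) (leibniz N₀))
    (≤-trans (∣p+q∣≤∣p∣+∣q∣ (leibniz k - leibniz N₀) (leibniz N₀))
      (+-monoˡ-≤ (abs (leibniz N₀)) (proj₂ (cauchy π 1ℚ 0<1) k N₀ h ℕₚ.≤-refl)))

-- Large squarefull parts

^ℚ-≥0 : ∀ {x} → x ≥0 → ∀ k → x ^ℚ k ≥0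
^ℚ-≥0 0≤x zero    = 0≤1
^ℚ-≥0 0≤x (suc k) = *-≥0 0≤x (^ℚ-≥0 0≤x k)

^ℚ-+ : ∀ x m n → x ^ℚ (m ℕ.+ n) ≡ x ^ℚ m * x ^ℚ n
^ℚ-+ x zero    n = sym (*-identityˡ (x ^ℚ n))
^ℚ-+ x (suc m) n = trans (cong (x *_) (^ℚ-+ x m n)) (sym (*-assoc x (x ^ℚ m) (x ^ℚ n)))

*-^ℚ : ∀ x y k → (x * y) ^ℚ k ≡ x ^ℚ k * y ^ℚ k
*-^ℚ x y zero    = refl
*-^ℚ x y (suc k) = trans (cong (x * y *_) (*-^ℚ x y k)) (ring x y (x ^ℚ k) (y ^ℚ k))
  where
  ring : ∀ a b c d → a * b * (c * d) ≡ (a * c) * (b * d)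
  ring = solve-∀ ringℚ

^ℚ-* : ∀ x m n → x ^ℚ (m ℕ.* n) ≡ (x ^ℚ m) ^ℚ n
^ℚ-* x m zero    = cong (x ^ℚ_) (ℕₚ.*-zeroʳ m)
^ℚ-* x m (suc n) = trans (cong (x ^ℚ_) (ℕₚ.*-suc m n)) (trans (^ℚ-+ x m (m ℕ.* n)) (cong (x ^ℚ m *_) (^ℚ-* x m n)))

^ℚ-mono : ∀ {x y} → x ≥0 → x ≤ℚ y → ∀ k → x ^ℚ k ≤ℚ y ^ℚ k
^ℚ-mono 0≤x x≤y zero    = ≤-refl
^ℚ-mono 0≤x x≤y (suc k) = *-mono (^ℚ-≥0 0≤x k) (≤-trans 0≤x x≤y) x≤y (^ℚ-mono 0≤x x≤y k)

1≤^ℚ : ∀ {x} → 1ℚ ≤ℚ x → ∀ k → 1ℚ ≤ℚ x ^ℚ k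
1≤^ℚ 1≤x zero    = ≤-refl
1≤^ℚ {x} 1≤x (suc k) = *-mono {1ℚ} {x} {1ℚ} {x ^ℚ k} 0≤1 (≤-trans 0≤1 1≤x) 1≤x (1≤^ℚ 1≤x k)

^ℚ-monoʳ : ∀ {x} → 1ℚ ≤ℚ x → ∀ {m n} → m ≤ n → x ^ℚ m ≤ℚ x ^ℚ n
^ℚ-monoʳ {x} 1≤x {m} {n} m≤n = subst₂ _≤ℚ_ (*-identityʳ (x ^ℚ m))
  (trans (sym (^ℚ-+ x m (n ℕ.∸ m))) (cong (x ^ℚ_) (ℕₚ.m+[n∸m]≡n m≤n)))
  (*-monoˡ (^ℚ-≥0 (≤-trans 0≤1 1≤x) m) (1≤^ℚ 1≤x (n ℕ.∸ m)))

ℕ→ℚ-^ : ∀ m k → ℕ→ℚ (m ℕ.^ k) ≡ ℕ→ℚ m ^ℚ k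
ℕ→ℚ-^ m zero    = refl
ℕ→ℚ-^ m (suc k) = trans (ℕ→ℚ-* m (m ℕ.^ k)) (cong (ℕ→ℚ m *_) (ℕ→ℚ-^ m k))

-- The binary length of n. Powers q^(bits n) with q rational stand in for fractional powers of n.
bits : ℕ → ℕ
bits zero    = 0
bits (suc n) = if does (suc n ℕ.<? 2 ℕ.^ bits n) then bits n else suc (bits n)

n<2^bits : ∀ n → n ℕ.< 2 ℕ.^ bits n
n<2^bits zero    = s≤s z≤n
n<2^bits (suc n) = case (suc n ℕ.<? 2 ℕ.^ bits n)
  where
  case : Dec (suc n ℕ.< 2 ℕ.^ bits n) → suc n ℕ.< 2 ℕ.^ bits (suc n)
  case (yes h) = subst (λ t → suc n ℕ.< 2 ℕ.^ t) (sym (if-yes (suc n ℕ.<? 2 ℕ.^ bits n) h)) h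
  case (no h)  = subst (λ t → suc n ℕ.< 2 ℕ.^ t) (sym (if-no (suc n ℕ.<? 2 ℕ.^ bits n) h))
    (ℕₚ.<-≤-trans (s≤s (n<2^bits n)) (ℕₚ.≤-trans (ℕₚ.≤-reflexive (ℕₚ.+-comm 1 (2 ℕ.^ bits n)))
      (ℕₚ.+-monoʳ-≤ (2 ℕ.^ bits n) (ℕₚ.≤-trans (ℕₚ.m^n>0 2 (bits n)) (ℕₚ.m≤m+n (2 ℕ.^ bits n) 0)))))

bits-least : ∀ n {j} → n ℕ.< 2 ℕ.^ j → bits n ≤ j
bits-least zero    h = z≤n
bits-least (suc n) {j} h = case (suc n ℕ.<? 2 ℕ.^ bits n)
  where
  ih : bits n ≤ j
  ih = bits-least n (ℕₚ.<-trans (ℕₚ.n<1+n n) h)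
  case : Dec (suc n ℕ.< 2 ℕ.^ bits n) → bits (suc n) ≤ j
  case (yes g) = subst (_≤ j) (sym (if-yes (suc n ℕ.<? 2 ℕ.^ bits n) g)) ih
  case (no g)  = subst (_≤ j) (sym (if-no (suc n ℕ.<? 2 ℕ.^ bits n) g))
    (ℕₚ.≤∧≢⇒< ih λ e → g (subst (λ t → suc n ℕ.< 2 ℕ.^ t) (sym e) h))

bits-cube : ∀ {n} s → n ≤ s ℕ.* s ℕ.* s → bits n ≤ 3 ℕ.* bits s
bits-cube {n} s h = bits-least n (ℕₚ.≤-<-trans h (subst (s ℕ.* s ℕ.* s ℕ.<_) e
    (ℕₚ.*-mono-< (ℕₚ.*-mono-< (n<2^bits s) (n<2^bits s)) (n<2^bits s))))
  where
  b = bits s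
  ring : ∀ b → b ℕ.+ b ℕ.+ b ≡ 3 ℕ.* b
  ring = solve-ℕ
  e : 2 ℕ.^ b ℕ.* 2 ℕ.^ b ℕ.* 2 ℕ.^ b ≡ 2 ℕ.^ (3 ℕ.* b)
  e = trans (cong (ℕ._* 2 ℕ.^ b) (sym (ℕₚ.^-distribˡ-+-* 2 b b)))
    (trans (sym (ℕₚ.^-distribˡ-+-* 2 (b ℕ.+ b) b)) (cong (2 ℕ.^_) (ring b)))

-- Since (17/16)^16 ≥ 2 and (17/16)^6 ≤ 3/2, a bound n^(1/16) for each of ∣b(n)∣ and a(n) makes their
-- product at most (3/2)^(bits s) for n ≤ s³, which is summable against 1/s².
≤-check : ∀ {p q} → {Bool.T (p ℚ.≤ᵇ q)} → p ≤ℚ q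
≤-check {p} {q} {t} = ℚₚ.≤ᵇ⇒≤ t

cubeBase ratio : ℚ
cubeBase = ℤ.+ 3 ℚ./ 2
ratio    = ℤ.+ 3 ℚ./ 4

-- Abstract, because the powers of 17/16 must not be evaluated.
abstract
  growthBase : ℚ
  growthBase = ℤ.+ 17 ℚ./ 16

  1≤growthBase : 1ℚ ≤ℚ growthBase
  1≤growthBase = ≤-check

  growthBase²-≥ : ℤ.+ 9 ℚ./ 8 ≤ℚ growthBase * growthBase
  growthBase²-≥ = ≤-check

  growthBase²-≤ : growthBase * growthBase ≤ℚ ℤ.+ 8 ℚ./ 7
  growthBase²-≤ = ≤-check

1≤growthBase² : 1ℚ ≤ℚ growthBase * growthBase
1≤growthBase² = ≤-trans (≤-check {1ℚ} {ℤ.+ 9 ℚ./ 8}) growthBase²-≥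

growth weight : ℕ → ℚ
growth n = growthBase ^ℚ bits n
weight n = cubeBase ^ℚ bits n

growth-≥1 : ∀ n → 1ℚ ≤ℚ growth n
growth-≥1 n = 1≤^ℚ 1≤growthBase (bits n)

growth²-≥0 : ∀ n → growth n * growth n ≥0
growth²-≥0 n = *-≥0 (≤-trans 0≤1 (growth-≥1 n)) (≤-trans 0≤1 (growth-≥1 n))

weight-≥0 : ∀ s → weight s ≥0
weight-≥0 s = ^ℚ-≥0 {cubeBase} ≤-check (bits s)

square-≤ : ∀ {x z} y → x ≥0 → z ≤ℚ x * x → x ≤ℚ y → z ≤ℚ y * y
square-≤ y 0≤x z≤ x≤y = ≤-trans z≤ (*-mono 0≤x (≤-trans 0≤x x≤y) x≤y x≤y)

-- Repeated squaring, rounding down to a simple fraction at each stage: 9/8, 5/4, 3/2, 2.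
2≤^16 : ∀ x → ℤ.+ 9 ℚ./ 8 ≤ℚ x * x → ℕ→ℚ 2 ≤ℚ x ^ℚ 16
2≤^16 x h = subst (ℕ→ℚ 2 ≤ℚ_) (sym (trans (^ℚ-+ x 8 8) (cong₂ _*_ (eight x) (eight x))))
  (square-≤ ((x * x) * (x * x) * ((x * x) * (x * x))) (≤-check {0ℚ} {cubeBase}) ≤-check
    (square-≤ ((x * x) * (x * x)) (≤-check {0ℚ} {ℤ.+ 5 ℚ./ 4}) ≤-check
      (square-≤ (x * x) (≤-check {0ℚ} {ℤ.+ 9 ℚ./ 8}) ≤-check h)))
  where
  eight : ∀ x → x * (x * (x * (x * (x * (x * (x * (x * 1ℚ))))))) ≡ (x * x) * (x * x) * ((x * x) * (x * x))
  eight = solve-∀ ringℚ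

growth-16 : ∀ n → ℕ→ℚ n ≤ℚ growth n ^ℚ 16
growth-16 n = ≤-trans (ℕ→ℚ-mono {n} (ℕₚ.<⇒≤ (n<2^bits n)))
  (subst₂ _≤ℚ_ (sym (ℕ→ℚ-^ 2 (bits n)))
    (trans (sym (^ℚ-* growthBase 16 (bits n))) (trans (cong (growthBase ^ℚ_) (ℕₚ.*-comm 16 (bits n))) (^ℚ-* growthBase (bits n) 16)))
    (^ℚ-mono {ℕ→ℚ 2} {growthBase ^ℚ 16} (ℕ→ℚ-≥0 2) (2≤^16 growthBase growthBase²-≥) (bits n)))

growth²-cube : ∀ {n} s → n ≤ s ℕ.* s ℕ.* s → growth n * growth n ≤ℚ weight s
growth²-cube {n} s h = subst (_≤ℚ weight s) (*-^ℚ growthBase growthBase (bits n))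
  (≤-trans (^ℚ-monoʳ 1≤growthBase² (bits-cube s h))
    (subst (_≤ℚ weight s) (sym (^ℚ-* ω 3 (bits s))) (^ℚ-mono {ω ^ℚ 3} {cubeBase} (^ℚ-≥0 0≤ω 3) ω³≤ (bits s))))
  where
  ω = growthBase * growthBase
  0≤ω : ω ≥0
  0≤ω = ≤-trans 0≤1 1≤growthBase²
  ω³≤ : ω ^ℚ 3 ≤ℚ cubeBase
  ω³≤ = ≤-trans (^ℚ-mono 0≤ω growthBase²-≤ 3) (≤-check {(ℤ.+ 8 ℚ./ 7) ^ℚ 3} {cubeBase})

-- Dyadic cut points: adding r with 1 ≤ r ≤ 2^j to `2^-1 j` runs through 2^j, ..., 2^(j+1) - 1, the
-- numbers of binary length j + 1.
2^-1 : ℕ → ℕ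
2^-1 zero    = 0
2^-1 (suc j) = 2^-1 j ℕ.+ 2 ℕ.^ j

suc-2^-1 : ∀ j → suc (2^-1 j) ≡ 2 ℕ.^ j
suc-2^-1 zero    = refl
suc-2^-1 (suc j) = trans (cong (ℕ._+ 2 ℕ.^ j) (suc-2^-1 j)) (cong (2 ℕ.^ j ℕ.+_) (sym (ℕₚ.+-identityʳ (2 ℕ.^ j))))

n≤2^-1 : ∀ n → n ≤ 2^-1 n
n≤2^-1 zero    = z≤n
n≤2^-1 (suc n) = ℕₚ.≤-trans (ℕₚ.≤-reflexive (ℕₚ.+-comm 1 n)) (ℕₚ.+-mono-≤ (n≤2^-1 n) (ℕₚ.m^n>0 2 n))

summand : ℕ → ℚ
summand s = weight s * inv² s

summand-≥0 : ∀ s → summand s ≥0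
summand-≥0 s = *-≥0 (weight-≥0 s) (inv²-≥0 s)

-- There are 2^j terms, each at most (3/2)^(j+1)/4^j. Hence the ratio 3/4, which is half of
-- `cubeBase`.
block : ∀ j → ∑ (λ r → summand (2^-1 j ℕ.+ r)) (2 ℕ.^ j) ≤ℚ cubeBase * ratio ^ℚ j
block j = ≤-trans (∑-mono (2 ℕ.^ j) term) (≤-reflexive (trans (∑-const c (2 ℕ.^ j)) total))
  where
  i = inv (ℕ→ℚ (2 ℕ.^ j))
  c = cubeBase ^ℚ suc j * (i * i)
  term : ∀ r → 1 ≤ r → r ≤ 2 ℕ.^ j → summand (2^-1 j ℕ.+ r) ≤ℚ c
  term r 1≤r r≤ = *-mono (inv²-≥0 s) (^ℚ-≥0 {cubeBase} ≤-check (suc j)) (^ℚ-monoʳ {cubeBase} ≤-check (bits-least s {suc j} s<))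
      (*-mono (inv-ℕ-≥0 s) (inv-ℕ-≥0 (2 ℕ.^ j)) i≤ i≤)
    where
    s = 2^-1 j ℕ.+ r
    s< : s ℕ.< 2 ℕ.^ suc j
    s< = subst (s ℕ.<_) (suc-2^-1 (suc j)) (s≤s (ℕₚ.+-monoʳ-≤ (2^-1 j) r≤))
    2^j≤s : 2 ℕ.^ j ≤ s
    2^j≤s = subst (_≤ s) (trans (ℕₚ.+-comm (2^-1 j) 1) (suc-2^-1 j)) (ℕₚ.+-monoʳ-≤ (2^-1 j) 1≤r)
    i≤ : inv (ℕ→ℚ s) ≤ℚ i
    i≤ = inv-ℕ-anti (ℕₚ.m^n>0 2 j) 2^j≤s
  half : ∀ j → inv (ℕ→ℚ (2 ℕ.^ j)) ≡ (inv (ℕ→ℚ 2)) ^ℚ j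
  half zero    = refl
  half (suc j) = trans (cong inv (ℕ→ℚ-* 2 (2 ℕ.^ j))) (trans (inv-* {ℕ→ℚ 2} {ℕ→ℚ (2 ℕ.^ j)} (ℕ→ℚ-pos {2} (s≤s z≤n)) (ℕ→ℚ-pos (ℕₚ.m^n>0 2 j)))
    (cong (inv (ℕ→ℚ 2) *_) (half j)))
  total : ℕ→ℚ (2 ℕ.^ j) * c ≡ cubeBase * ratio ^ℚ j
  total = trans (ring (ℕ→ℚ (2 ℕ.^ j)) cubeBase (cubeBase ^ℚ j) i)
    (trans (cong (_* (cubeBase * (cubeBase ^ℚ j * i))) (inv-inverseʳ (pos⇒≢0 (ℕ→ℚ-pos (ℕₚ.m^n>0 2 j)))))
      (trans (*-identityˡ (cubeBase * (cubeBase ^ℚ j * i))) (cong (cubeBase *_) (trans (cong (cubeBase ^ℚ j *_) (half j)) (trans (sym (*-^ℚ cubeBase (inv (ℕ→ℚ 2)) j)) refl)))))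
    where
    ring : ∀ N b B i → N * (b * B * (i * i)) ≡ (N * i) * (b * (B * i))
    ring = solve-∀ ringℚ

6ℚ : ℚ
6ℚ = ℕ→ℚ 6

-- The geometric sum of the block bounds in telescoped form; the constant 6 comes from 6(1 - 3/4) =
-- 3/2.
blocks : ∀ J i → ∑ summand (2^-1 (J ℕ.+ i)) - ∑ summand (2^-1 J) ≤ℚ 6ℚ * (ratio ^ℚ J - ratio ^ℚ (J ℕ.+ i))
blocks J zero    = ≤-reflexive (trans (cong (λ t → ∑ summand (2^-1 t) - ∑ summand (2^-1 J)) (ℕₚ.+-identityʳ J))
  (trans (+-inverseʳ (∑ summand (2^-1 J))) (sym (trans (cong (λ t → 6ℚ * (ratio ^ℚ J - ratio ^ℚ t)) (ℕₚ.+-identityʳ J))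
    (trans (cong (6ℚ *_) (+-inverseʳ (ratio ^ℚ J))) (*-zeroʳ 6ℚ))))))
blocks J (suc i) = subst₂ _≤ℚ_ (sym left) (sym right) (+-mono-≤ (blocks J i) (block (J ℕ.+ i)))
  where
  j = J ℕ.+ i
  left : ∑ summand (2^-1 (J ℕ.+ suc i)) - ∑ summand (2^-1 J) ≡ (∑ summand (2^-1 j) - ∑ summand (2^-1 J)) + ∑ (λ r → summand (2^-1 j ℕ.+ r)) (2 ℕ.^ j)
  left = trans (cong (λ t → ∑ summand (2^-1 t) - ∑ summand (2^-1 J)) (ℕₚ.+-suc J i))
    (trans (cong (_- ∑ summand (2^-1 J)) (∑-split summand (2^-1 j) (2 ℕ.^ j)))
      (ring (∑ summand (2^-1 j)) (∑ (λ r → summand (2^-1 j ℕ.+ r)) (2 ℕ.^ j)) (∑ summand (2^-1 J))))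
    where
    ring : ∀ a b c → (a + b) - c ≡ (a - c) + b
    ring = solve-∀ ringℚ
  right : 6ℚ * (ratio ^ℚ J - ratio ^ℚ (J ℕ.+ suc i)) ≡ 6ℚ * (ratio ^ℚ J - ratio ^ℚ j) + cubeBase * ratio ^ℚ j
  right = trans (cong (λ t → 6ℚ * (ratio ^ℚ J - ratio ^ℚ t)) (ℕₚ.+-suc J i))
    (trans (ring 6ℚ (ratio ^ℚ J) ratio (ratio ^ℚ j)) (cong (λ t → 6ℚ * (ratio ^ℚ J - ratio ^ℚ j) + t * ratio ^ℚ j) 6/4))
    where
    ring : ∀ a x r y → a * (x - r * y) ≡ a * (x - y) + (a - a * r) * y
    ring = solve-∀ ringℚ
    6/4 : 6ℚ - 6ℚ * ratio ≡ cubeBase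
    6/4 = refl

summand-tail : ∀ J S → ∑ (λ s → 𝟙 (2^-1 J ℕ.<? s) * summand s) S ≤ℚ 6ℚ * ratio ^ℚ J
summand-tail J S = ≤-trans (∑-monoN {λ s → 𝟙 (2^-1 J ℕ.<? s) * summand s} (λ s _ → *-≥0 (𝟙-≥0 (2^-1 J ℕ.<? s)) (summand-≥0 s)) S≤N)
  (subst (_≤ℚ 6ℚ * ratio ^ℚ J) (sym (trans (∑-above summand (2^-1 J) N G≤N) e))
    (≤-trans (blocks J S) (*-monoˡ {6ℚ} (ℕ→ℚ-≥0 6) (-‿≤ (ratio ^ℚ J) (^ℚ-≥0 {ratio} ≤-check (J ℕ.+ S))))))
  where
  N = 2^-1 (J ℕ.+ S)
  mono : ∀ J i → 2^-1 J ≤ 2^-1 (J ℕ.+ i)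
  mono J zero    = ℕₚ.≤-reflexive (cong 2^-1 (sym (ℕₚ.+-identityʳ J)))
  mono J (suc i) = ℕₚ.≤-trans (mono J i) (subst (λ t → 2^-1 (J ℕ.+ i) ≤ 2^-1 t) (sym (ℕₚ.+-suc J i)) (ℕₚ.m≤m+n (2^-1 (J ℕ.+ i)) (2 ℕ.^ (J ℕ.+ i))))
  S≤N : S ≤ N
  S≤N = ℕₚ.≤-trans (ℕₚ.m≤n+m S J) (n≤2^-1 (J ℕ.+ S))
  G≤N : 2^-1 J ≤ N
  G≤N = mono J S
  ring : ∀ a b → b ≡ (a + b) - a
  ring = solve-∀ ringℚ
  e : ∑ (λ r → summand (2^-1 J ℕ.+ r)) (N ℕ.∸ 2^-1 J) ≡ ∑ summand N - ∑ summand (2^-1 J)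
  e = trans (ring (∑ summand (2^-1 J)) (∑ (λ r → summand (2^-1 J ℕ.+ r)) (N ℕ.∸ 2^-1 J)))
    (cong (_- ∑ summand (2^-1 J)) (sym (trans (cong (∑ summand) (sym (ℕₚ.m+[n∸m]≡n G≤N))) (∑-split summand (2^-1 J) (N ℕ.∸ 2^-1 J)))))

-- Decay of the geometric sequence by comparison with 3/(j + 3). The induction step is 3(j + 4)/4 ≤
-- j + 3.
ratio-decay : ∀ j → ratio ^ℚ j * (ℕ→ℚ j + ℕ→ℚ 3) ≤ℚ ℕ→ℚ 3
ratio-decay zero    = ≤-check
ratio-decay (suc j) = ≤-trans (subst₂ _≤ℚ_ (sym (trans (cong (λ t → ratio * R * (t + 3ℚ)) (ℕ→ℚ-suc j)) (ring ratio R (ℕ→ℚ j) 3ℚ))) refl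
    (*-monoˡ (^ℚ-≥0 {ratio} ≤-check j) step)) (ratio-decay j)
  where
  R = ratio ^ℚ j
  3ℚ = ℕ→ℚ 3
  ring : ∀ q R j t → q * R * (j + 1ℚ + t) ≡ R * (q * j + q * (1ℚ + t))
  ring = solve-∀ ringℚ
  step : ratio * ℕ→ℚ j + ratio * (1ℚ + 3ℚ) ≤ℚ ℕ→ℚ j + 3ℚ
  step = +-mono-≤ (subst (ratio * ℕ→ℚ j ≤ℚ_) (*-identityˡ (ℕ→ℚ j)) (*-monoʳ {ℕ→ℚ j} {ratio} {1ℚ} (ℕ→ℚ-≥0 j) ≤-check)) (≤-check {ratio * (1ℚ + 3ℚ)} {3ℚ})

ratio-small : ∀ {ε} → 0ℚ <ℚ ε → ∃[ j ] (ratio ^ℚ j ≤ℚ ε)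
ratio-small {ε} 0<ε = proj₁ j-small , bound (proj₁ j-small) (proj₁ (proj₂ j-small)) (proj₂ (proj₂ j-small))
  where
  0<3 : 0ℚ <ℚ ℕ→ℚ 3
  0<3 = ℕ→ℚ-pos {3} (s≤s z≤n)
  j-small : ∃[ n ] (1 ≤ n × inv (ℕ→ℚ n) ≤ℚ inv (ℕ→ℚ 3) * ε)
  j-small = inv-small (*-pos (inv-pos 0<3) 0<ε)
  open ℚₚ.≤-Reasoning
  bound : ∀ j → 1 ≤ j → inv (ℕ→ℚ j) ≤ℚ inv (ℕ→ℚ 3) * ε → ratio ^ℚ j ≤ℚ ε
  bound j 1≤j h = begin
    R                                  ≡⟨ *-identityʳ R ⟨
    R * 1ℚ                             ≡⟨ cong (R *_) (inv-inverseʳ (pos⇒≢0 (ℕ→ℚ-pos 1≤j))) ⟨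
    R * (ℕ→ℚ j * inv (ℕ→ℚ j))          ≤⟨ *-monoˡ 0≤R (*-monoʳ (inv-ℕ-≥0 j) (≤-+ʳ {ℕ→ℚ j} {ℕ→ℚ 3} (ℕ→ℚ-≥0 3))) ⟩
    R * ((ℕ→ℚ j + ℕ→ℚ 3) * inv (ℕ→ℚ j)) ≡⟨ *-assoc R (ℕ→ℚ j + ℕ→ℚ 3) (inv (ℕ→ℚ j)) ⟨
    R * (ℕ→ℚ j + ℕ→ℚ 3) * inv (ℕ→ℚ j)   ≤⟨ *-mono (inv-ℕ-≥0 j) (ℕ→ℚ-≥0 3) (ratio-decay j) h ⟩
    ℕ→ℚ 3 * (inv (ℕ→ℚ 3) * ε)           ≡⟨ *-scale 0<3 ε ⟩
    ε                                  ∎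
    where
    R = ratio ^ℚ j
    0≤R : R ≥0
    0≤R = ^ℚ-≥0 {ratio} ≤-check j

module _ {K : ℚ} (0<K : 0ℚ <ℚ K) where

  -- One factor `growth` accounts for b(n), the other for 1 + a(n).
  majorant : ℕ → ℚ
  majorant n = K * (growth n * growth n)

  majorant-≥0 : ∀ n → majorant n ≥0
  majorant-≥0 n = *-≥0 (<⇒≤ 0<K) (growth²-≥0 n)

  -- If f = squarefullPart n > G³, then some s > G has s² ∣ n and f ≤ s³.
  majorant-tail : ∀ ε → 0ℚ <ℚ ε → ∃[ F ] (∀ N →
    ∑ (λ n → 𝟙 (F ℕ.<? squarefullPart n) * majorant (squarefullPart n)) N ≤ℚ ℕ→ℚ N * ε)
  majorant-tail ε 0<ε = G ℕ.* G ℕ.* G , λ N → ≤-trans (∑-mono N λ n 1≤n n≤N → term N n 1≤n n≤N)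
      (≤-trans (∑-squares {w} N N (λ s _ → 0≤w s)) (*-monoˡ (ℕ→ℚ-≥0 N) (tail N)))
    where
    small-J = ratio-small {inv (K * 6ℚ) * ε} (*-pos (inv-pos (*-pos {K} {6ℚ} 0<K (ℕ→ℚ-pos {6} (s≤s z≤n)))) 0<ε)
    J = proj₁ small-J
    G = 2^-1 J
    F = G ℕ.* G ℕ.* G
    w : ℕ → ℚ
    w s = 𝟙 (G ℕ.<? s) * (K * weight s)
    0≤w : ∀ s → w s ≥0
    0≤w s = *-≥0 (𝟙-≥0 (G ℕ.<? s)) (*-≥0 (<⇒≤ 0<K) (weight-≥0 s))
    tail : ∀ N → ∑ (λ s → w s * inv² s) N ≤ℚ ε
    tail N = subst (_≤ℚ ε) (sym (trans (∑-cong N λ s _ _ → ring (𝟙 (G ℕ.<? s)) K (weight s) (inv² s)) (∑-* K (λ s → 𝟙 (G ℕ.<? s) * summand s) N)))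
      (≤-trans (*-monoˡ (<⇒≤ 0<K) (summand-tail J N))
        (subst₂ _≤ℚ_ (*-assoc K 6ℚ (ratio ^ℚ J)) (*-scale (*-pos {K} {6ℚ} 0<K (ℕ→ℚ-pos {6} (s≤s z≤n))) ε)
          (*-monoˡ {K * 6ℚ} (<⇒≤ (*-pos {K} {6ℚ} 0<K (ℕ→ℚ-pos {6} (s≤s z≤n)))) (proj₂ small-J))))
      where
      ring : ∀ t K w i → t * (K * w) * i ≡ K * (t * (w * i))
      ring = solve-∀ ringℚ
    term : ∀ N n → 1 ≤ n → n ≤ N → 𝟙 (F ℕ.<? squarefullPart n) * majorant (squarefullPart n) ≤ℚ ∑ (λ s → w s * 𝟙 (s ℕ.* s ∣? n)) N
    term N n 1≤n n≤N = case (F ℕ.<? f)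
      where
      f = squarefullPart n
      spec = squarefullPart-spec n 1≤n
      f∣n : f ∣ n
      f∣n = squarefullPart-∣ spec
      0≤t : ∀ s → w s * 𝟙 (s ℕ.* s ∣? n) ≥0
      0≤t s = *-≥0 (0≤w s) (𝟙-≥0 (s ℕ.* s ∣? n))
      case : Dec (F ℕ.< f) → 𝟙 (F ℕ.<? f) * majorant f ≤ℚ ∑ (λ s → w s * 𝟙 (s ℕ.* s ∣? n)) N
      case (no h) = subst (_≤ℚ ∑ (λ s → w s * 𝟙 (s ℕ.* s ∣? n)) N) (sym (𝟙-no-* (F ℕ.<? f) h (majorant f)))
        (∑-≥0 N λ s _ _ → 0≤t s)
      case (yes F<f) with squarefull⇒bigSquare (∣-≥1 1≤n f∣n) (proj₁ (proj₂ (proj₂ (proj₂ spec))))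
      ... | s , 1≤s , s²∣f , f≤s³ = ≤-trans
          (subst₂ _≤ℚ_ (sym (𝟙-yes-* (F ℕ.<? f) F<f (majorant f)))
            (sym (trans (cong₂ (λ x y → x * (K * weight s) * y) (𝟙-yes (G ℕ.<? s) G<s) (𝟙-yes (s ℕ.* s ∣? n) (∣-trans s²∣f f∣n)))
              (ring (K * weight s))))
            (*-monoˡ (<⇒≤ 0<K) (growth²-cube s f≤s³)))
          (∑-term {λ s → w s * 𝟙 (s ℕ.* s ∣? n)} N s (λ s _ _ → 0≤t s) 1≤s
            (ℕₚ.≤-trans (∣⇒≤′ 1≤n (∣-trans (m∣m*n s) (∣-trans s²∣f f∣n))) n≤N))
        where
        ring : ∀ x → 1ℚ * x * 1ℚ ≡ x
        ring = solve-∀ ringℚ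
        G<s : G ℕ.< s
        G<s = ℕₚ.≰⇒> λ s≤G → ℕₚ.<⇒≱ F<f (ℕₚ.≤-trans f≤s³ (ℕₚ.*-mono-≤ (ℕₚ.*-mono-≤ s≤G s≤G) s≤G))

-- Convergence

open Density κ lim-euler

ev-witness : ∀ {P : ℕ → Set} → Ev ev P → ∃[ k ] P k
ev-witness (N , h) = N , h N ℕₚ.≤-refl

mean-one : HasMean (λ _ _ → 1ℚ) (λ _ → 1ℚ)
mean-one = hasMean (lim (small λ ε 0<ε → 1 , λ N 1≤N → pure ev λ k →
  subst (λ t → abs t ≤ℚ ε) (sym (trans (cong (_- 1ℚ) (trans (cong (inv (ℕ→ℚ N) *_) (trans (∑-const 1ℚ N) (*-identityʳ (ℕ→ℚ N))))
    (inv-inverseˡ (pos⇒≢0 (ℕ→ℚ-pos 1≤N))))) (+-inverseʳ 1ℚ))) (<⇒≤ 0<ε)))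

frequency : ℕ → ℕ → ℚ
frequency f N = inv (ℕ→ℚ N) * ∑ (λ n → 𝟙 (squarefullPart n ℕₚ.≟ f)) N

frequency-≥0 : ∀ f N → frequency f N ≥0
frequency-≥0 f N = *-≥0 (inv-ℕ-≥0 N) (∑-≥0 N λ n _ _ → 𝟙-≥0 (squarefullPart n ℕₚ.≟ f))

-- For c = 1 and a = 1, `mean-good` says that the frequency tends to κ/σ_f. Half of the lower bound
-- for κ absorbs the error, and the resulting constant does not depend on f.
frequency-lower : ∃[ η ] (0ℚ <ℚ η × (∀ f → 1 ≤ f → Squarefull f → Ev ev (λ N → η * inv (σf f) ≤ℚ frequency f N)))
frequency-lower = half , 0<half , lower
  where
  η = proj₁ κ-positive
  half = inv 2ℚ * η
  0<half : 0ℚ <ℚ half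
  0<half = *-pos {inv 2ℚ} (inv-pos {2ℚ} (positive⁻¹ 2ℚ)) (proj₁ (proj₂ κ-positive))
  lower : ∀ f → 1 ≤ f → Squarefull f → Ev ev (λ N → half * inv (σf f) ≤ℚ frequency f N)
  lower f 1≤f full = proj₁ close , λ N N≥ → bound N (ev-witness (zip ev (proj₂ close N N≥) (proj₂ (proj₂ κ-positive))))
    where
    1≤1 : 1 ≤ 1
    1≤1 = s≤s z≤n
    i = inv (σf f)
    0<i : 0ℚ <ℚ i
    0<i = inv-pos (σf-pos 1≤f)
    good = good? 1≤f full 1≤1
    close = at (diff (avg-lim (mean-good {λ _ _ → 1ℚ} {λ _ → 1ℚ} {1ℚ} (bdd-const 1ℚ) 0≤1 (λ _ _ → pure ev λ _ → ≤-refl)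
      (λ _ _ → mean-one) 1≤f full 1≤1 κ-bdd))) (half * i) (*-pos 0<half 0<i)
    freq≡ : ∀ N → inv (ℕ→ℚ N) * ∑ (λ n → 𝟙 (good n) * 1ℚ) N ≡ frequency f N
    freq≡ N = cong (inv (ℕ→ℚ N) *_) (∑-cong N λ n _ _ → trans (*-identityʳ (𝟙 (good n)))
      (𝟙-⇔ (good n) (squarefullPart n ℕₚ.≟ f) proj₁ λ e → e , Div.∣1⇒≡1 (gcd[m,n]∣n n 1)))
    dens : density f 1 ≡ i
    dens = trans (cong (i *_) (∏ₚ-1 (λ p → 1ℚ + atPrime f p))) (*-identityʳ i)
    bound : ∀ N → ∃[ k ] (abs (inv (ℕ→ℚ N) * ∑ (λ n → 𝟙 (good n) * 1ℚ) N - κ k * density f 1 * 1ℚ) ≤ℚ half * i × η ≤ℚ κ k) →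
            half * i ≤ℚ frequency f N
    bound N (k , h , η≤) = 0≤-⇒≤ (subst (0ℚ ≤ℚ_) (ring (κ k) η i (frequency f N) (inv 2ℚ) two)
        (+-≥0 (≤⇒0≤- (≤-trans (≤-abs (κ k * i * 1ℚ - frequency f N))
            (subst (_≤ℚ half * i) (trans (cong₂ (λ x y → abs (x - κ k * y * 1ℚ)) (freq≡ N) dens) (abs-sym (frequency f N) (κ k * i * 1ℚ))) h)))
          (*-≥0 (≤⇒0≤- η≤) (<⇒≤ 0<i))))
      where
      two : inv 2ℚ + inv 2ℚ ≡ 1ℚ
      two = refl
      ring : ∀ κ η i x t → t + t ≡ 1ℚ → (t * η * i - (κ * i * 1ℚ - x)) + (κ - η) * i ≡ x - t * η * i
      ring κ η i x t e = trans (ring₁ κ η i x t) (trans (cong (λ z → x + z * η * i - t * η * i - η * i) e) (ring₂ η i x t))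
        where
        ring₁ : ∀ κ η i x t → (t * η * i - (κ * i * 1ℚ - x)) + (κ - η) * i ≡ x + (t + t) * η * i - t * η * i - η * i
        ring₁ = solve-∀ ringℚ
        ring₂ : ∀ η i x t → x + 1ℚ * η * i - t * η * i - η * i ≡ x - t * η * i
        ring₂ = solve-∀ ringℚ

fullWeight : ℕ → ℚ
fullWeight f = 𝟙 (squarefull? f) * inv (σf f)

σf-≥0 : ∀ f → σf f ≥0
σf-≥0 f = *-≥0 (ℕ→ℚ-≥0 f) (<⇒≤ (∏[1+1/p]-pos f))

fullWeight-≥0 : ∀ f → fullWeight f ≥0
fullWeight-≥0 f = *-≥0 (𝟙-≥0 (squarefull? f)) (inv-≥0 (σf-≥0 f))

module _ {K : ℚ} (0<K : 0ℚ <ℚ K) where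

  private v = majorant 0<K

  -- n ↦ squarefullPart n takes the value f with frequency about 6/(π² σf f), so the tail of the
  -- series is controlled by the tail of the mean value.
  series-tail : ∀ ε → 0ℚ <ℚ ε → ∃[ F ] (∀ S → ∑ (λ f → 𝟙 (F ℕ.<? f) * (fullWeight f * v f)) S ≤ℚ ε)
  -- For a given S, one N is taken at which all frequencies with f ≤ S are large enough. The final
  -- bound does not involve this N.
  series-tail ε 0<ε = F , λ S → bound S (ev-witness (ev-all {λ f N → η * fullWeight f ≤ℚ frequency f N} freq S))
    where
    η = proj₁ frequency-lower
    0<η = proj₁ (proj₂ frequency-lower)
    tail = majorant-tail 0<K (η * ε) (*-pos 0<η 0<ε)
    F = proj₁ tail
    freq : ∀ f → 1 ≤ f → Ev ev (λ N → η * fullWeight f ≤ℚ frequency f N)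
    freq f 1≤f = case (squarefull? f)
      where
      case : Dec (Squarefull f) → Ev ev (λ N → η * fullWeight f ≤ℚ frequency f N)
      case (yes h) = map ev (λ N → subst (_≤ℚ frequency f N) (cong (η *_) (sym (𝟙-yes-* (squarefull? f) h (inv (σf f))))))
        (proj₂ (proj₂ frequency-lower) f 1≤f h)
      case (no h) = pure ev λ N → subst (_≤ℚ frequency f N) (sym (trans (cong (λ t → η * (t * inv (σf f))) (𝟙-no (squarefull? f) h))
        (trans (cong (η *_) (*-zeroˡ (inv (σf f)))) (*-zeroʳ η)))) (frequency-≥0 f N)
    bound : ∀ S → ∃[ N ] (∀ f → 1 ≤ f → f ≤ S → η * fullWeight f ≤ℚ frequency f N) →
            ∑ (λ f → 𝟙 (F ℕ.<? f) * (fullWeight f * v f)) S ≤ℚ ε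
    bound S (N , h) = ℚₚ.*-cancelˡ-≤-pos η {{ℚ.positive 0<η}} (≤-trans (≤-reflexive (sym (∑-* η (λ f → 𝟙 (F ℕ.<? f) * (fullWeight f * v f)) S)))
        (≤-trans (∑-mono S term) (subst (_≤ℚ η * ε) (sym e)
          (avg-∑-≤ N (<⇒≤ (*-pos 0<η 0<ε)) (≤-trans (∑-mono N λ n 1≤n _ → collapse n 1≤n) (proj₂ tail N))))))
      where
      I = inv (ℕ→ℚ N)
      w : ℕ → ℚ
      w f = 𝟙 (F ℕ.<? f) * v f
      0≤w : ∀ f → w f ≥0
      0≤w f = *-≥0 (𝟙-≥0 (F ℕ.<? f)) (majorant-≥0 0<K f)
      term : ∀ f → 1 ≤ f → f ≤ S → η * (𝟙 (F ℕ.<? f) * (fullWeight f * v f)) ≤ℚ I * ∑ (λ n → w f * 𝟙 (squarefullPart n ℕₚ.≟ f)) N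
      term f 1≤f f≤S = subst₂ _≤ℚ_ (ring₁ (w₁) η (fullWeight f) (v f))
          (trans (ring₂ w₁ I (∑ (λ n → 𝟙 (squarefullPart n ℕₚ.≟ f)) N) (v f)) (cong (I *_) (sym (∑-* (w f) (λ n → 𝟙 (squarefullPart n ℕₚ.≟ f)) N))))
          (*-monoˡ (0≤w f) (h f 1≤f f≤S))
        where
        w₁ = 𝟙 (F ℕ.<? f)
        ring₁ : ∀ w η i v → w * v * (η * i) ≡ η * (w * (i * v))
        ring₁ = solve-∀ ringℚ
        ring₂ : ∀ w I s v → w * v * (I * s) ≡ I * (w * v * s)
        ring₂ = solve-∀ ringℚ
      e : ∑ (λ f → I * ∑ (λ n → w f * 𝟙 (squarefullPart n ℕₚ.≟ f)) N) S ≡ I * ∑ (λ n → ∑ (λ f → w f * 𝟙 (squarefullPart n ℕₚ.≟ f)) S) N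
      e = trans (∑-* I (λ f → ∑ (λ n → w f * 𝟙 (squarefullPart n ℕₚ.≟ f)) N) S)
            (cong (I *_) (∑-swap (λ f n → w f * 𝟙 (squarefullPart n ℕₚ.≟ f)) S N))
      -- Each n has a single squarefull part, so at most one f contributes.
      collapse : ∀ n → 1 ≤ n → ∑ (λ f → w f * 𝟙 (squarefullPart n ℕₚ.≟ f)) S ≤ℚ w (squarefullPart n)
      collapse n 1≤n = case (squarefullPart n ℕ.≤? S)
        where
        g = squarefullPart n
        off : ∀ f → f ≢ g → w f * 𝟙 (g ℕₚ.≟ f) ≡ 0ℚ
        off f f≢g = trans (cong (w f *_) (𝟙-no (g ℕₚ.≟ f) (f≢g ∘ sym))) (*-zeroʳ (w f))
        case : Dec (g ≤ S) → ∑ (λ f → w f * 𝟙 (g ℕₚ.≟ f)) S ≤ℚ w g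
        case (yes g≤S) = ≤-reflexive (trans (∑-single {λ f → w f * 𝟙 (g ℕₚ.≟ f)} S g (λ f _ _ f≢g → off f f≢g)
            (∣-≥1 1≤n (squarefullPart-∣ (squarefullPart-spec n 1≤n))) g≤S)
          (trans (cong (w g *_) (𝟙-yes (g ℕₚ.≟ g) refl)) (*-identityʳ (w g))))
        case (no g≰S) = subst (_≤ℚ w g) (sym (∑-0 S λ f _ f≤S → off f λ e → g≰S (subst (_≤ S) e f≤S))) (0≤w g)

module _ (z : ℕ → ℝ) (z-cauchy : ∀ ε → 0ℚ <ℚ ε → ∃[ F ] (∀ F′ → F ≤ F′ → Ev ev (λ k → abs (seq (z F′) k - seq (z F) k) ≤ℚ ε))) where

  private
    tol : ℕ → ℚ
    tol j = inv (ℕ→ℚ (suc j))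
    0<tol : ∀ j → 0ℚ <ℚ tol j
    0<tol j = inv-pos (ℕ→ℚ-pos {suc j} (s≤s z≤n))
    tol-anti : ∀ {i j} → i ≤ j → tol j ≤ℚ tol i
    tol-anti {i} i≤j = inv-ℕ-anti {suc i} (s≤s z≤n) (s≤s i≤j)
    F : ℕ → ℕ
    F j = proj₁ (z-cauchy (tol j) (0<tol j))
    K : ℕ → ℕ
    K j = proj₁ (cauchy (z (F j)) (tol j) (0<tol j))
    -- A diagonal sequence: from index `F j` on the given reals vary by at most 1/(j + 1), and `l j`
    -- is an approximation of the real at `F j` with the same accuracy.
    l : ℕ → ℚ
    l j = seq (z (F j)) (K j)

    near : ∀ j G → F j ≤ G → Ev ev (λ k → abs (seq (z G) k - l j) ≤ℚ 2ℚ * tol j)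
    near j G F≤G = Ev² ev (λ k a b → ≤-trans (abs-tri (seq (z G) k) (seq (z (F j)) k) (l j))
        (subst (abs (seq (z G) k - seq (z (F j)) k) + abs (seq (z (F j)) k - l j) ≤ℚ_) (two (tol j)) (+-mono-≤ a b)))
      (proj₂ (z-cauchy (tol j) (0<tol j)) G F≤G)
      (K j , λ k K≤k → proj₂ (cauchy (z (F j)) (tol j) (0<tol j)) k (K j) K≤k ℕₚ.≤-refl)
      where
      two : ∀ x → x + x ≡ 2ℚ * x
      two = solve-∀ ringℚ

    close : ∀ i j → i ≤ j → abs (l i - l j) ≤ℚ 4ℚ * tol i
    close i j i≤j = bound (ev-witness (zip ev (near i G (ℕₚ.m≤m⊔n (F i) (F j))) (near j G (ℕₚ.m≤n⊔m (F i) (F j)))))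
      where
      G = F i ⊔ F j
      bound : ∃[ k ] (abs (seq (z G) k - l i) ≤ℚ 2ℚ * tol i × abs (seq (z G) k - l j) ≤ℚ 2ℚ * tol j) → abs (l i - l j) ≤ℚ 4ℚ * tol i
      bound (k , a , b) = ≤-trans (abs-tri (l i) (seq (z G) k) (l j))
        (subst (abs (l i - seq (z G) k) + abs (seq (z G) k - l j) ≤ℚ_) (four (tol i))
          (+-mono-≤ (subst (_≤ℚ 2ℚ * tol i) (abs-sym (seq (z G) k) (l i)) a)
            (≤-trans b (*-monoˡ {2ℚ} (<⇒≤ (positive⁻¹ 2ℚ)) (tol-anti i≤j)))))
        where
        four : ∀ x → 2ℚ * x + 2ℚ * x ≡ 4ℚ * x
        four x = sym (*-distribʳ-+ x 2ℚ 2ℚ)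

    0<8 : 0ℚ <ℚ 8ℚ
    0<8 = ℕ→ℚ-pos {8} (s≤s z≤n)

    index : ∀ ε → 0ℚ <ℚ ε → ∃[ j ] (8ℚ * tol j ≤ℚ ε)
    index ε 0<ε = let n , 1≤n , h = inv-small (*-pos (inv-pos 0<8) 0<ε) in
      n , subst (8ℚ * tol n ≤ℚ_) (*-scale 0<8 ε) (*-monoˡ {8ℚ} (<⇒≤ 0<8) (≤-trans (inv-ℕ-anti 1≤n (ℕₚ.n≤1+n n)) h))

    l-cauchy : IsCauchy l
    l-cauchy ε 0<ε = let j , h = index ε 0<ε in j , λ m n j≤m j≤n →
      ≤-trans (abs-tri (l m) (l j) (l n)) (≤-trans (+-mono-≤ (subst (_≤ℚ 4ℚ * tol j) (abs-sym (l j) (l m)) (close j m j≤m)) (close j n j≤n))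
        (subst (_≤ℚ ε) (*-distribʳ-+ (tol j) 4ℚ 4ℚ) h))

  complete : ∃[ L ] Lim ev² (λ (F , k) → seq (z F) k) (λ (F , k) → seq L k)
  complete = mkℝ l l-cauchy , lim (small λ ε 0<ε → let j , h = index ε 0<ε in
    F j , λ G F≤G → Ev² ev (λ k j≤k a → ≤-trans (abs-tri (seq (z G) k) (l j) (l k))
        (≤-trans (+-mono-≤ a (close j k j≤k)) (≤-trans (subst (_≤ℚ 8ℚ * tol j) (*-distribʳ-+ (tol j) 2ℚ 4ℚ)
          (*-monoʳ {tol j} {2ℚ + 4ℚ} {8ℚ} (<⇒≤ (0<tol j)) ≤-check)) h)))
      (j , λ k j≤k → j≤k) (near j G F≤G))

-- The double series

sumᴿ : (ℕ → ℝ) → ℕ → ℝ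
sumᴿ u zero    = ℚ→ℝ 0ℚ
sumᴿ u (suc N) = sumᴿ u N +ᴿ u (suc N)

seq-sumᴿ : ∀ u N k → seq (sumᴿ u N) k ≡ ∑ (λ n → seq (u n) k) N
seq-sumᴿ u zero    k = refl
seq-sumᴿ u (suc N) k = cong (_+ seq (u (suc N)) k) (seq-sumᴿ u N k)

∑-diff : ∀ (u : ℕ → ℚ) {M N} → M ≤ N → ∑ u N - ∑ u M ≡ ∑ (λ f → 𝟙 (M ℕ.<? f) * u f) N
∑-diff u {M} {N} M≤N = trans (cong (_- ∑ u M) (trans (cong (∑ u) (sym (ℕₚ.m+[n∸m]≡n M≤N))) (∑-split u M (N ℕ.∸ M))))
  (trans (ring (∑ u M) (∑ (λ r → u (M ℕ.+ r)) (N ℕ.∸ M))) (sym (∑-above u M N M≤N)))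
  where
  ring : ∀ a b → (a + b) - a ≡ b
  ring = solve-∀ ringℚ

primeFactorOr1-case : ∀ (P : ℚ → Set) φ n i → P 1ℚ → (Prime i → i ∣ n → P (φ i)) → P (primeFactorOr1 φ n i)
primeFactorOr1-case P φ n i p q = case (prime? i ×-dec i ∣? n)
  where
  case : Dec (Prime i × i ∣ n) → P (primeFactorOr1 φ n i)
  case (yes (pi , d)) = subst P (sym (primeFactorOr1-yes φ pi d)) (q pi d)
  case (no h)         = subst P (sym (primeFactorOr1-no φ h)) p

∏-bounds : ∀ {u : ℕ → ℚ} N → (∀ i → u i ≥0 × u i ≤ℚ 1ℚ) → ∏ u N ≥0 × ∏ u N ≤ℚ 1ℚ
∏-bounds zero    h = 0≤1 , ≤-refl
∏-bounds {u} (suc N) h = let a , b = ∏-bounds N h ; c , d = h (suc N) in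
  *-≥0 a c , *-mono {∏ u N} {1ℚ} {u (suc N)} {1ℚ} c 0≤1 b d

∏-mono : ∀ {u v : ℕ → ℚ} N → (∀ i → u i ≥0 × u i ≤ℚ v i) → ∏ u N ≥0 × ∏ u N ≤ℚ ∏ v N
∏-mono zero    h = 0≤1 , ≤-refl
∏-mono {u} {v} (suc N) h = let a , b = ∏-mono N h ; c , d = h (suc N) in
  *-≥0 a c , *-mono {∏ u N} {∏ v N} {u (suc N)} {v (suc N)} c (≤-trans a b) b d

localFactor-bounds : ∀ f a → localFactor f a ≥0 × localFactor f a ≤ℚ 1ℚ
localFactor-bounds f a = ∏-bounds a λ i →
  primeFactorOr1-case (λ x → x ≥0 × x ≤ℚ 1ℚ) φ a i (0≤1 , ≤-refl) λ pi _ → at-i i (i ∣? f)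
  where
  φ : ℕ → ℚ
  φ p = 1ℚ + atPrime f p
  at-i : ∀ i → Dec (i ∣ f) → φ i ≥0 × φ i ≤ℚ 1ℚ
  at-i i (yes d) = subst (λ t → 1ℚ + t ≥0 × 1ℚ + t ≤ℚ 1ℚ) (sym (if-yes (i ∣? f) d)) (≤-refl , 0≤1)
  at-i i (no ¬d) = subst (λ t → 1ℚ + t ≥0 × 1ℚ + t ≤ℚ 1ℚ) (sym (if-no (i ∣? f) ¬d))
    (≤⇒0≤- (inv-anti {1ℚ} {1ℚ + ℕ→ℚ i} 0<1 (≤-+ʳ {1ℚ} (ℕ→ℚ-≥0 i))) , -‿≤ 1ℚ (inv-≥0 (+-≥0 {1ℚ} 0≤1 (ℕ→ℚ-≥0 i))))

∏[1+1/p]-mono : ∀ {m n} → 1 ≤ n → m ∣ n → ∏[1+1/p] m ≤ℚ ∏[1+1/p] n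
∏[1+1/p]-mono {m} {n} 1≤n m∣n = subst₂ _≤ℚ_
  (trans (∏ₚ-extend 1+1/ n (∣-≥1 1≤n m∣n) (∣⇒≤′ 1≤n m∣n)) (sym (∏[1+1/p]≡∏ₚ m))) (sym (∏[1+1/p]≡∏ₚ n))
  (proj₂ (∏-mono n λ i → primeFactorOr1-case (λ x → x ≥0 × x ≤ℚ primeFactorOr1 1+1/ n i) 1+1/ m i
    (0≤1 , primeFactorOr1-case (1ℚ ≤ℚ_) 1+1/ n i ≤-refl λ _ _ → ≤-+ʳ {1ℚ} (inv-ℕ-≥0 i))
    λ pi d → +-≥0 {1ℚ} 0≤1 (inv-ℕ-≥0 i) , ≤-reflexive (sym (primeFactorOr1-yes 1+1/ pi (∣-trans d m∣n)))))

ψ-≥0 : ∀ n → ψ n ≥0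
ψ-≥0 n = *-≥0 (ℕ→ℚ-≥0 n) (<⇒≤ (∏[1+1/p]-pos n))

ψ-mono : ∀ {m n} → 1 ≤ n → m ∣ n → ψ m ≤ℚ ψ n
ψ-mono {m} {n} 1≤n m∣n = *-mono (<⇒≤ (∏[1+1/p]-pos m)) (ℕ→ℚ-≥0 n) (ℕ→ℚ-mono (∣⇒≤′ 1≤n m∣n)) (∏[1+1/p]-mono 1≤n m∣n)

abs-μ : ∀ n → abs (μ n) ≤ℚ 𝟙 (squarefree? n)
abs-μ n = subst (_≤ℚ 𝟙 (squarefree? n)) (sym (trans (cong abs (μ≡∏ₚ n)) (∣p*q∣≡∣p∣*∣q∣ (𝟙 (squarefree? n)) (∏ₚ φ n))))
  (subst₂ _≤ℚ_ refl (*-identityʳ (𝟙 (squarefree? n)))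
    (*-mono {abs (𝟙 (squarefree? n))} {𝟙 (squarefree? n)} {abs (∏ₚ φ n)} {1ℚ} (0≤∣p∣ (∏ₚ φ n)) (𝟙-≥0 (squarefree? n))
      (≤-reflexive (abs-≥0 (𝟙-≥0 (squarefree? n)))) (≤-reflexive (go n))))
  where
  φ : ℕ → ℚ
  φ _ = - 1ℚ
  go : ∀ y → abs (∏ (primeFactorOr1 φ n) y) ≡ 1ℚ
  go zero    = refl
  go (suc y) = trans (∣p*q∣≡∣p∣*∣q∣ (∏ (primeFactorOr1 φ n) y) (primeFactorOr1 φ n (suc y)))
    (trans (cong₂ _*_ (go y) (primeFactorOr1-case (λ x → abs x ≡ 1ℚ) φ n (suc y) refl (λ _ _ → refl))) refl)

-- ψ is monotone for divisibility, so ψ((d, f)) ≤ ψ(d), which equals σ(d) for squarefree d; for the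
-- other d, μ vanishes.
abs-coefficient : ∀ f d → 1 ≤ d → abs (coefficient f d) ≤ℚ 1ℚ
abs-coefficient f d 1≤d = subst (_≤ℚ 1ℚ)
    (sym (trans (∣p*q∣≡∣p∣*∣q∣ (μ d * i) (ψ (gcd d f))) (cong₂ _*_ (trans (∣p*q∣≡∣p∣*∣q∣ (μ d) i) (cong (abs (μ d) *_) (abs-≥0 0≤i))) (abs-≥0 (ψ-≥0 (gcd d f))))))
    (≤-trans (*-mono (ψ-≥0 (gcd d f)) (*-≥0 (𝟙-≥0 (squarefree? d)) 0≤i) (*-monoʳ 0≤i (abs-μ d)) (ψ-mono 1≤d (gcd[m,n]∣m d f)))
      (case (squarefree? d)))
  where
  i = inv (ℕ→ℚ (σ d))
  0≤i : i ≥0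
  0≤i = inv-ℕ-≥0 (σ d)
  case : Dec (Squarefree d) → 𝟙 (squarefree? d) * i * ψ d ≤ℚ 1ℚ
  case (yes sf) = ≤-reflexive (trans (cong₂ (λ x y → x * i * y) (𝟙-yes (squarefree? d) sf) (sym (σ≡ψ d 1≤d sf)))
    (trans (cong (_* ℕ→ℚ (σ d)) (*-identityˡ i)) (inv-inverseˡ (pos⇒≢0 (σ-pos 1≤d)))))
  case (no ¬sf) = subst (_≤ℚ 1ℚ) (sym (trans (cong (λ t → t * i * ψ d) (𝟙-no (squarefree? d) ¬sf))
    (trans (cong (_* ψ d) (*-zeroˡ i)) (*-zeroˡ (ψ d))))) 0≤1

-- There are at most a divisors. That the bound is uniform in `D` allows the tail in f to be cut off
-- before D grows.
∑-divisors-≤ : ∀ {u : ℕ → ℚ} a D → 1 ≤ a → (∀ d → 1 ≤ d → abs (u d) ≤ℚ 1ℚ) → abs (∑ (λ d → 𝟙 (d ∣? a) * u d) D) ≤ℚ ℕ→ℚ a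
∑-divisors-≤ {u} a D 1≤a h = ≤-trans (∑-abs (λ d → 𝟙 (d ∣? a) * u d) D) (≤-trans (∑-mono D λ d 1≤d _ → term d 1≤d)
    (≤-trans (∑-monoN {λ d → 𝟙 (d ∣? a)} (λ d _ → 𝟙-≥0 (d ∣? a)) (ℕₚ.m≤m⊔n D a))
      (≤-trans (≤-reflexive (∑-tail (ℕₚ.m≤n⊔m D a) λ i a<i → 𝟙-no (i ∣? a) λ d → ℕₚ.<⇒≱ a<i (∣⇒≤′ 1≤a d)))
        (≤-trans (∑-mono a λ d _ _ → 𝟙-≤1 (d ∣? a)) (≤-reflexive (trans (∑-const 1ℚ a) (*-identityʳ (ℕ→ℚ a))))))))
  where
  term : ∀ d → 1 ≤ d → abs (𝟙 (d ∣? a) * u d) ≤ℚ 𝟙 (d ∣? a)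
  term d 1≤d = subst₂ _≤ℚ_ (sym (trans (∣p*q∣≡∣p∣*∣q∣ (𝟙 (d ∣? a)) (u d)) (cong (_* abs (u d)) (abs-≥0 (𝟙-≥0 (d ∣? a))))))
    (*-identityʳ (𝟙 (d ∣? a))) (*-monoˡ {𝟙 (d ∣? a)} (𝟙-≥0 (d ∣? a)) (h d 1≤d))

maxTo : (ℕ → ℕ) → ℕ → ℕ
maxTo a zero    = 0
maxTo a (suc F) = maxTo a F ⊔ a (suc F)

≤-maxTo : ∀ a F f → 1 ≤ f → f ≤ F → a f ≤ maxTo a F
≤-maxTo a zero    f 1≤f f≤F = contradiction (ℕₚ.≤-trans 1≤f f≤F) λ ()
≤-maxTo a (suc F) f 1≤f f≤F with ℕₚ.m≤n⇒m<n∨m≡n f≤F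
... | inj₁ (s≤s f≤F′) = ℕₚ.≤-trans (≤-maxTo a F f 1≤f f≤F′) (ℕₚ.m≤m⊔n (maxTo a F) (a (suc F)))
... | inj₂ refl       = ℕₚ.m≤n⊔m (maxTo a F) (a (suc F))

squarefull⇒¬squarefree : ∀ {f} → 2 ≤ f → Squarefull f → ¬ Squarefree f
squarefull⇒¬squarefree 2≤f full sf = let p , pp , p∣f = primeDivisor 2≤f in sf pp (full pp p∣f)

admissible : (ℕ → ℕ) → ℕ → ℚ
admissible a f = 𝟙 (1[a1=0] a ℕ.<? f)

admissible⇒a≥1 : ∀ a → (∀ n → 1 ≤ n → ¬ Squarefree n → 1 ≤ a n) → ∀ f → 1 ≤ f → 1[a1=0] a ℕ.< f → Squarefull f → 1 ≤ a f
admissible⇒a≥1 a a-pos f 1≤f h full with f ℕₚ.≟ 1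
... | no f≢1 = a-pos f 1≤f (squarefull⇒¬squarefree (ℕₚ.≤∧≢⇒< 1≤f (f≢1 ∘ sym)) full)
... | yes refl = ℕₚ.n≢0⇒n>0 λ e → ℕₚ.<-irrefl refl (subst (ℕ._< 1) (if-yes (a 1 ℕₚ.≟ 0) e) h)

-- To be applied with β the real and the imaginary part of b. The factor 1 + a(n) in the bound pays
-- for the divisors d of a(f) when the sums are exchanged.
module Series (a : ℕ → ℕ) (a-pos : ∀ n → 1 ≤ n → ¬ Squarefree n → 1 ≤ a n) {K : ℚ} (0<K : 0ℚ <ℚ K) (β : ℕ → ℝ)
  (β-bound : ∀ n → 1 ≤ n → Ev ev (λ k → abs (seq (β n) k) * (1ℚ + ℕ→ℚ (a n)) ≤ℚ majorant 0<K n)) where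

  b : ℕ → ℕ → ℚ
  b n k = seq (β n) k

  private v = majorant 0<K

  b≤v : ∀ n k → abs (b n k) * (1ℚ + ℕ→ℚ (a n)) ≤ℚ v n → abs (b n k) ≤ℚ v n
  b≤v n k h = ≤-trans (subst (_≤ℚ abs (b n k) * (1ℚ + ℕ→ℚ (a n))) (*-identityʳ (abs (b n k)))
    (*-monoˡ (0≤∣p∣ (b n k)) (≤-+ʳ {1ℚ} (ℕ→ℚ-≥0 (a n))))) h

  module _ {u : ℕ → ℚ} {c : ℚ} (0<c : 0ℚ <ℚ c) (u-bound : ∀ f → 1 ≤ f → abs (u f) ≤ℚ c * fullWeight f) where

    private
      partial : ℕ → ℝ
      partial = sumᴿ (λ f → ℚ→ℝ (u f) *ᴿ β f)

    partial-cauchy : ∀ ε → 0ℚ <ℚ ε → ∃[ F ] (∀ F′ → F ≤ F′ → Ev ev (λ k → abs (seq (partial F′) k - seq (partial F) k) ≤ℚ ε))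
    partial-cauchy ε 0<ε = F , λ F′ F≤F′ → map ev (λ k h → bound F′ F≤F′ k h) (ev-all β-bound F′)
      where
      tail = series-tail 0<K (inv c * ε) (*-pos (inv-pos 0<c) 0<ε)
      F = proj₁ tail
      bound : ∀ F′ → F ≤ F′ → ∀ k → (∀ f → 1 ≤ f → f ≤ F′ → abs (b f k) * (1ℚ + ℕ→ℚ (a f)) ≤ℚ v f) →
              abs (seq (partial F′) k - seq (partial F) k) ≤ℚ ε
      bound F′ F≤F′ k h = subst₂ _≤ℚ_ (sym (cong abs e)) (*-scale 0<c ε)
          (≤-trans (∑-abs _ F′) (≤-trans (∑-mono F′ term) (subst (_≤ℚ c * (inv c * ε)) (sym (∑-* c _ F′)) (*-monoˡ (<⇒≤ 0<c) (proj₂ tail F′)))))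
        where
        e : seq (partial F′) k - seq (partial F) k ≡ ∑ (λ f → 𝟙 (F ℕ.<? f) * (u f * b f k)) F′
        e = trans (cong₂ _-_ (seq-sumᴿ (λ f → ℚ→ℝ (u f) *ᴿ β f) F′ k) (seq-sumᴿ (λ f → ℚ→ℝ (u f) *ᴿ β f) F k)) (∑-diff (λ f → u f * b f k) F≤F′)
        term : ∀ f → 1 ≤ f → f ≤ F′ → abs (𝟙 (F ℕ.<? f) * (u f * b f k)) ≤ℚ c * (𝟙 (F ℕ.<? f) * (fullWeight f * v f))
        term f 1≤f f≤F′ = subst₂ _≤ℚ_ (sym (trans (∣p*q∣≡∣p∣*∣q∣ t (u f * b f k)) (cong₂ _*_ (abs-≥0 (𝟙-≥0 (F ℕ.<? f))) (∣p*q∣≡∣p∣*∣q∣ (u f) (b f k)))))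
            (ring t c (fullWeight f) (v f))
            (*-monoˡ {t} (𝟙-≥0 (F ℕ.<? f)) (*-mono (0≤∣p∣ (b f k)) (*-≥0 (<⇒≤ 0<c) (fullWeight-≥0 f)) (u-bound f 1≤f) (b≤v f k (h f 1≤f f≤F′))))
          where
          t = 𝟙 (F ℕ.<? f)
          ring : ∀ t c w v → t * (c * w * v) ≡ c * (t * (w * v))
          ring = solve-∀ ringℚ

    converges : ∃[ L ] Lim ev² (λ (F , k) → ∑ (λ f → u f * b f k) F) (λ (F , k) → seq L k)
    converges = let L , l = complete partial partial-cauchy in
      L , lim-cong (λ (F , k) → seq-sumᴿ (λ f → ℚ→ℝ (u f) *ᴿ β f) F k) (λ _ → refl) l

  -- The coefficient of b(f) once the sum over d has been carried out. Up to the factor 6/π² it is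
  -- the density of the n with squarefull part f and (n, a(f)) = 1.
  g : ℕ → ℚ
  g f = admissible a f * (fullWeight f * localFactor f (a f))

  0≤adm : ∀ f → admissible a f ≥0
  0≤adm f = 𝟙-≥0 (1[a1=0] a ℕ.<? f)

  g-bound : ∀ f → 1 ≤ f → abs (g f) ≤ℚ 1ℚ * fullWeight f
  g-bound f 1≤f = subst (_≤ℚ 1ℚ * fullWeight f) (sym (abs-≥0 (*-≥0 (0≤adm f) (*-≥0 (fullWeight-≥0 f) 0≤l))))
    (*-mono (*-≥0 (fullWeight-≥0 f) 0≤l) 0≤1 (𝟙-≤1 (1[a1=0] a ℕ.<? f))
      (subst (fullWeight f * localFactor f (a f) ≤ℚ_) (*-identityʳ (fullWeight f)) (*-monoˡ (fullWeight-≥0 f) (proj₂ (localFactor-bounds f (a f))))))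
    where
    0≤l = proj₁ (localFactor-bounds f (a f))

  S : ℝ
  S = proj₁ (converges 0<1 g-bound)

  S-lim : Lim ev² (λ (F , k) → ∑ (λ f → g f * b f k) F) (λ (F , k) → seq S k)
  S-lim = proj₂ (converges 0<1 g-bound)

  innerCoefficient : ℕ → ℕ → ℚ
  innerCoefficient d f = 𝟙 (1[a1=0] a ℕ.<? f ×-dec squarefull? f ×-dec d ∣? a f)
    * (ℕ→ℚ (gcd d f) * inv (σf f) * ∏[1+1/p] (gcd d f))

  innerCoefficient≡ : ∀ d f → innerCoefficient d f ≡ admissible a f * fullWeight f * (𝟙 (d ∣? a f) * ψ (gcd d f))
  innerCoefficient≡ d f = trans (cong (_* (ℕ→ℚ (gcd d f) * inv (σf f) * ∏[1+1/p] (gcd d f)))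
      (trans (𝟙-× (1[a1=0] a ℕ.<? f) (squarefull? f ×-dec d ∣? a f)) (cong (admissible a f *_) (𝟙-× (squarefull? f) (d ∣? a f)))))
    (ring (admissible a f) (𝟙 (squarefull? f)) (𝟙 (d ∣? a f)) (ℕ→ℚ (gcd d f)) (inv (σf f)) (∏[1+1/p] (gcd d f)))
    where
    ring : ∀ A B C g i p → A * (B * C) * (g * i * p) ≡ A * (B * i) * (C * (g * p))
    ring = solve-∀ ringℚ

  innerCoefficient-bound : ∀ d → 1 ≤ d → ∀ f → 1 ≤ f → abs (innerCoefficient d f) ≤ℚ ψ d * fullWeight f
  innerCoefficient-bound d 1≤d f 1≤f = subst₂ _≤ℚ_ (sym (trans (cong abs (innerCoefficient≡ d f)) (abs-≥0 (*-≥0 (*-≥0 (0≤adm f) (fullWeight-≥0 f)) (*-≥0 (𝟙-≥0 (d ∣? a f)) (ψ-≥0 (gcd d f)))))))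
    (ring (fullWeight f) (ψ d))
    (*-mono (*-≥0 (𝟙-≥0 (d ∣? a f)) (ψ-≥0 (gcd d f))) (*-≥0 0≤1 (fullWeight-≥0 f))
      (*-monoʳ (fullWeight-≥0 f) (𝟙-≤1 (1[a1=0] a ℕ.<? f)))
      (*-mono (ψ-≥0 (gcd d f)) 0≤1 (𝟙-≤1 (d ∣? a f)) (ψ-mono 1≤d (gcd[m,n]∣m d f))))
    where
    ring : ∀ w p → 1ℚ * w * (1ℚ * p) ≡ p * w
    ring = solve-∀ ringℚ

  ψ-pos : ∀ {d} → 1 ≤ d → 0ℚ <ℚ ψ d
  ψ-pos {d} 1≤d = *-pos (ℕ→ℚ-pos {d} 1≤d) (∏[1+1/p]-pos d)

  inner : ℕ → ℝ
  inner zero      = ℚ→ℝ 0ℚ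
  inner d@(suc _) = proj₁ (converges (ψ-pos {d} (s≤s z≤n)) (innerCoefficient-bound d (s≤s z≤n)))

  inner-lim : ∀ d → 1 ≤ d → Lim ev² (λ (F , k) → ∑ (λ f → innerCoefficient d f * b f k) F) (λ (F , k) → seq (inner d) k)
  inner-lim d@(suc _) (s≤s z≤n) = proj₂ (converges (ψ-pos {d} (s≤s z≤n)) (innerCoefficient-bound d (s≤s z≤n)))

  outerWeight : ℕ → ℚ
  outerWeight d = μ d * inv (ℕ→ℚ (σ d))

  outerPartial : ℕ → ℕ → ℚ
  outerPartial D f = ∑ (λ d → outerWeight d * innerCoefficient d f) D

  outerPartial≡ : ∀ D f → outerPartial D f ≡ admissible a f * fullWeight f * ∑ (λ d → 𝟙 (d ∣? a f) * coefficient f d) D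
  outerPartial≡ D f = trans (∑-cong D λ d _ _ → trans (cong (outerWeight d *_) (innerCoefficient≡ d f))
      (ring (μ d) (inv (ℕ→ℚ (σ d))) (admissible a f * fullWeight f) (𝟙 (d ∣? a f)) (ψ (gcd d f))))
    (∑-* (admissible a f * fullWeight f) (λ d → 𝟙 (d ∣? a f) * coefficient f d) D)
    where
    ring : ∀ m i W t p → m * i * (W * (t * p)) ≡ W * (t * (m * i * p))
    ring = solve-∀ ringℚ

  -- For f ≤ F₀ all divisors of a(f) are already among the d ≤ D, so the two coefficients agree. For
  -- f > F₀ the divisor sum is at most a(f) and the local factor at most 1.
  outerPartial-close : ∀ F₀ D → maxTo a F₀ ≤ D → ∀ f → 1 ≤ f →
    abs (outerPartial D f - g f) ≤ℚ 𝟙 (F₀ ℕ.<? f) * (fullWeight f * (1ℚ + ℕ→ℚ (a f)))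
  outerPartial-close F₀ D max≤D f 1≤f = subst (λ x → abs x ≤ℚ 𝟙 (F₀ ℕ.<? f) * (fullWeight f * (1ℚ + ℕ→ℚ (a f)))) (sym e)
      (case (1[a1=0] a ℕ.<? f) (squarefull? f) (F₀ ℕ.<? f))
    where
    A = admissible a f
    W = fullWeight f
    Σd = ∑ (λ d → 𝟙 (d ∣? a f) * coefficient f d) D
    L = localFactor f (a f)
    R = 𝟙 (F₀ ℕ.<? f) * (W * (1ℚ + ℕ→ℚ (a f)))
    0≤R : R ≥0
    0≤R = *-≥0 (𝟙-≥0 (F₀ ℕ.<? f)) (*-≥0 (fullWeight-≥0 f) (+-≥0 0≤1 (ℕ→ℚ-≥0 (a f))))
    e : outerPartial D f - g f ≡ A * (W * (Σd - L))
    e = trans (cong (_- g f) (outerPartial≡ D f)) (ring A W Σd L)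
      where
      ring : ∀ A W s l → A * W * s - A * (W * l) ≡ A * (W * (s - l))
      ring = solve-∀ ringℚ
    isZero : A * (W * (Σd - L)) ≡ 0ℚ → abs (A * (W * (Σd - L))) ≤ℚ R
    isZero z = subst (_≤ℚ R) (sym (cong abs z)) 0≤R
    case : Dec (1[a1=0] a ℕ.< f) → Dec (Squarefull f) → Dec (F₀ ℕ.< f) → abs (A * (W * (Σd - L))) ≤ℚ R
    case (no h) _ _ = isZero (𝟙-no-* (1[a1=0] a ℕ.<? f) h (W * (Σd - L)))
    case (yes _) (no h) _ = isZero (trans (cong (λ t → A * (t * inv (σf f) * (Σd - L))) (𝟙-no (squarefull? f) h))
      (ring A (inv (σf f)) (Σd - L)))
      where
      ring : ∀ A i x → A * (0ℚ * i * x) ≡ 0ℚ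
      ring = solve-∀ ringℚ
    case (yes h) (yes full) (no F₀≮f) = isZero (trans (cong (λ t → A * (W * (t - L)))
        (∑-coefficient f D (admissible⇒a≥1 a a-pos f 1≤f h full) (ℕₚ.≤-trans (≤-maxTo a F₀ f 1≤f (ℕₚ.≮⇒≥ F₀≮f)) max≤D)))
      (trans (cong (λ t → A * (W * t)) (+-inverseʳ L)) (trans (cong (A *_) (*-zeroʳ W)) (*-zeroʳ A))))
    case (yes h) (yes full) (yes F₀<f) = subst₂ _≤ℚ_
        (sym (trans (∣p*q∣≡∣p∣*∣q∣ A (W * (Σd - L))) (cong₂ _*_ (abs-≥0 (0≤adm f))
          (trans (∣p*q∣≡∣p∣*∣q∣ W (Σd - L)) (cong (_* abs (Σd - L)) (abs-≥0 (fullWeight-≥0 f)))))))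
        (cong (_* (W * (1ℚ + ℕ→ℚ (a f)))) (trans refl (sym (𝟙-yes (F₀ ℕ.<? f) F₀<f))))
        (*-mono (*-≥0 (fullWeight-≥0 f) (0≤∣p∣ (Σd - L))) 0≤1 (𝟙-≤1 (1[a1=0] a ℕ.<? f)) (*-monoˡ (fullWeight-≥0 f)
          (≤-trans (ℚₚ.∣p-q∣≤∣p∣+∣q∣ Σd L) (subst (abs Σd + abs L ≤ℚ_) (+-comm (ℕ→ℚ (a f)) 1ℚ)
            (+-mono-≤ (∑-divisors-≤ (a f) D (admissible⇒a≥1 a a-pos f 1≤f h full) (abs-coefficient f))
              (subst (_≤ℚ 1ℚ) (sym (abs-≥0 (proj₁ (localFactor-bounds f (a f))))) (proj₂ (localFactor-bounds f (a f)))))))))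

  -- For fixed D only finitely many inner series occur, so all can be cut off at a common F, after
  -- which the sums are finite and may be exchanged. The three errors come from the cut-off of the
  -- inner series, the coefficients at f > F₀, and the cut-off of S.
  outer-lim : Lim ev² (λ (D , k) → ∑ (λ d → outerWeight d * seq (inner d) k) D) (λ (D , k) → seq S k)
  outer-lim = lim (small-scale 3ℚ (positive⁻¹ 3ℚ) λ ε 0<ε → let F₀ , tail = series-tail 0<K ε 0<ε in
    maxTo a F₀ , λ D max≤D → atD ε 0<ε F₀ tail D max≤D)
    where
    3ℚ = 1ℚ + 2ℚ
    atD : ∀ ε → 0ℚ <ℚ ε → ∀ F₀ → (∀ S → ∑ (λ f → 𝟙 (F₀ ℕ.<? f) * (fullWeight f * v f)) S ≤ℚ ε) → ∀ D → maxTo a F₀ ≤ D →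
          Ev ev (λ k → abs (∑ (λ d → outerWeight d * seq (inner d) k) D - seq S k) ≤ℚ 3ℚ * ε)
    atD ε 0<ε F₀ tail D max≤D = Ev² ev (λ k (p , q) h → bound k p q h) (proj₂ both F ℕₚ.≤-refl) (ev-all β-bound F)
      where
      inners : Lim ev² (λ (F , k) → ∑ (λ d → outerWeight d * ∑ (λ f → innerCoefficient d f * b f k) F) D)
                       (λ (F , k) → ∑ (λ d → outerWeight d * seq (inner d) k) D)
      inners = lim-∑ D λ d 1≤d _ → lim-*ˡ (bdd-const (outerWeight d)) (inner-lim d 1≤d)
      both = zip ev² (at (diff inners) ε 0<ε) (at (diff S-lim) ε 0<ε)
      F = proj₁ both
      exchange : ∀ k → ∑ (λ d → outerWeight d * ∑ (λ f → innerCoefficient d f * b f k) F) D ≡ ∑ (λ f → outerPartial D f * b f k) F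
      exchange k = trans (∑-cong D λ d _ _ → sym (∑-* (outerWeight d) (λ f → innerCoefficient d f * b f k) F))
        (trans (∑-swap (λ d f → outerWeight d * (innerCoefficient d f * b f k)) D F)
          (∑-cong F λ f _ _ → trans (∑-cong D λ d _ _ → ring (outerWeight d) (innerCoefficient d f) (b f k))
            (trans (∑-* (b f k) (λ d → outerWeight d * innerCoefficient d f) D) (ℚₚ.*-comm (b f k) (outerPartial D f)))))
        where
        ring : ∀ w c b → w * (c * b) ≡ b * (w * c)
        ring = solve-∀ ringℚ
      bound : ∀ k → abs (∑ (λ d → outerWeight d * ∑ (λ f → innerCoefficient d f * b f k) F) D - ∑ (λ d → outerWeight d * seq (inner d) k) D) ≤ℚ ε →
              abs (∑ (λ f → g f * b f k) F - seq S k) ≤ℚ ε →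
              (∀ f → 1 ≤ f → f ≤ F → abs (b f k) * (1ℚ + ℕ→ℚ (a f)) ≤ℚ v f) →
              abs (∑ (λ d → outerWeight d * seq (inner d) k) D - seq S k) ≤ℚ 3ℚ * ε
      bound k p q h = ≤-trans (abs-tri O I s) (≤-trans (+-monoʳ-≤ (abs (O - I)) (abs-tri I P s))
          (subst (abs (O - I) + (abs (I - P) + abs (P - s)) ≤ℚ_) (three ε)
            (+-mono-≤ (subst (_≤ℚ ε) (abs-sym I O) p) (+-mono-≤ middle q))))
        where
        O = ∑ (λ d → outerWeight d * seq (inner d) k) D
        I = ∑ (λ d → outerWeight d * ∑ (λ f → innerCoefficient d f * b f k) F) D
        P = ∑ (λ f → g f * b f k) F
        s = seq S k
        three : ∀ x → x + (x + x) ≡ 3ℚ * x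
        three = solve-∀ ringℚ
        term : ∀ f → 1 ≤ f → f ≤ F → abs ((outerPartial D f - g f) * b f k) ≤ℚ 𝟙 (F₀ ℕ.<? f) * (fullWeight f * v f)
        term f 1≤f f≤F = subst (_≤ℚ 𝟙 (F₀ ℕ.<? f) * (fullWeight f * v f)) (sym (∣p*q∣≡∣p∣*∣q∣ (outerPartial D f - g f) (b f k)))
          (≤-trans (*-monoʳ (0≤∣p∣ (b f k)) (outerPartial-close F₀ D max≤D f 1≤f))
            (subst (_≤ℚ t * (W * v f)) (ring t W (1ℚ + ℕ→ℚ (a f)) (abs (b f k)))
              (*-monoˡ {t} (𝟙-≥0 (F₀ ℕ.<? f)) (*-monoˡ (fullWeight-≥0 f) (h f 1≤f f≤F)))))
          where
          t = 𝟙 (F₀ ℕ.<? f)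
          W = fullWeight f
          ring : ∀ t W x y → t * (W * (y * x)) ≡ t * (W * x) * y
          ring = solve-∀ ringℚ
        middle : abs (I - P) ≤ℚ ε
        middle = subst (_≤ℚ ε) (cong abs (sym (trans (cong (_- P) (exchange k)) (trans (sym (∑-- (λ f → outerPartial D f * b f k) (λ f → g f * b f k) F))
            (∑-cong F λ f _ _ → ring (outerPartial D f) (g f) (b f k))))))
          (≤-trans (∑-abs _ F) (≤-trans (∑-mono F term) (tail F)))
          where
          ring : ∀ x y z → x * z - y * z ≡ (x - y) * z
          ring = solve-∀ ringℚ

-- The mean value for real functions

real-bdd : ∀ x → Bdd ev (seq x)
real-bdd x = let N , h = cauchy x 1ℚ 0<1 in
  bdd (1ℚ + abs (seq x N)) (+-pos 0<1 (0≤∣p∣ (seq x N))) (N , λ n N≤n →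
    subst (λ t → abs t ≤ℚ 1ℚ + abs (seq x N)) (p-q+q (seq x n) (seq x N))
      (≤-trans (∣p+q∣≤∣p∣+∣q∣ (seq x n - seq x N) (seq x N)) (+-monoˡ-≤ (abs (seq x N)) (h n N N≤n ℕₚ.≤-refl))))

-- Equal reals may have different approximations, so replacing b(n) by b(f) needs a limit argument.
-- It is enough to have closeness for each n separately, since only n ≤ N occur before k grows.
mean-approx : ∀ {u v : ℕ → ℕ → ℚ} {α} → (∀ n → 1 ≤ n → Lim ev (u n) (v n)) → HasMean v α → HasMean u α
mean-approx {u} {v} h (hasMean l) = hasMean (lim-trans (lim (small λ ε 0<ε → 0 , λ N _ →
    map ev (λ k c → bound ε 0<ε N k c) (ev-all {λ n k → abs (u n k - v n k) ≤ℚ ε} (λ n 1≤n → at (diff (h n 1≤n)) ε 0<ε) N))) l)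
  where
  bound : ∀ ε → 0ℚ <ℚ ε → ∀ N k → (∀ n → 1 ≤ n → n ≤ N → abs (u n k - v n k) ≤ℚ ε) → abs (avg u (N , k) - avg v (N , k)) ≤ℚ ε
  bound ε 0<ε N k c = subst (λ t → abs t ≤ℚ ε) e
      (≤-trans (avg-abs {λ n → u n k - v n k} {λ _ → ε} N c) (avg-∑-≤ N (<⇒≤ 0<ε) (≤-reflexive (∑-const ε N))))
    where
    e : inv (ℕ→ℚ N) * ∑ (λ n → u n k - v n k) N ≡ avg u (N , k) - avg v (N , k)
    e = trans (cong (inv (ℕ→ℚ N) *_) (∑-- (λ n → u n k) (λ n → v n k) N)) (ring (inv (ℕ→ℚ N)) (∑ (λ n → u n k) N) (∑ (λ n → v n k) N))
      where
      ring : ∀ i a b → i * (a - b) ≡ i * a - i * b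
      ring = solve-∀ ringℚ

-- The exception at n = 1 is needed when a(1) = 0: then (1, a(1)) = 1, although f = 1 does not occur
-- in ρ.
mean-0 : ∀ {u : ℕ → ℕ → ℚ} {B} → B ≥0 → (∀ n k → 2 ≤ n → u n k ≡ 0ℚ) → Ev ev (λ k → abs (u 1 k) ≤ℚ B) → HasMean u (λ _ → 0ℚ)
mean-0 {u} {B} 0≤B h b₁ = hasMean (lim (small-dom {v = λ (N , k) → inv (ℕ→ℚ N) * B} (1 , λ N 1≤N → map ev (λ k → bound N 1≤N k) b₁)
    (small-cong (λ (N , k) → ℚₚ.*-comm B (inv (ℕ→ℚ N))) (small-* (bdd-const B) (small-∘proj₁ small-inv)))))
  where
  bound : ∀ N → 1 ≤ N → ∀ k → abs (u 1 k) ≤ℚ B → abs (avg u (N , k) - 0ℚ) ≤ℚ inv (ℕ→ℚ N) * B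
  bound N 1≤N k c = subst (_≤ℚ inv (ℕ→ℚ N) * B) (sym (trans (cong abs e) (trans (∣p*q∣≡∣p∣*∣q∣ (inv (ℕ→ℚ N)) (u 1 k)) (cong (_* abs (u 1 k)) (abs-≥0 (inv-ℕ-≥0 N))))))
      (*-monoˡ (inv-ℕ-≥0 N) c)
    where
    e : avg u (N , k) - 0ℚ ≡ inv (ℕ→ℚ N) * u 1 k
    e = trans (ring (avg u (N , k))) (cong (inv (ℕ→ℚ N) *_) (∑-single {λ n → u n k} N 1 (λ n 1≤n _ n≢1 → h n k (ℕₚ.≤∧≢⇒< 1≤n (n≢1 ∘ sym))) (s≤s z≤n) 1≤N))
      where
      ring : ∀ x → x - 0ℚ ≡ x
      ring = solve-∀ ringℚ

module MeanValue (a : ℕ → ℕ) (a-pos : ∀ n → 1 ≤ n → ¬ Squarefree n → 1 ≤ a n)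
  (a-part : ∀ n → 1 ≤ n → a n ≡ a (squarefullPart n))
  {K : ℚ} (0<K : 0ℚ <ℚ K) (β : ℕ → ℝ)
  (β-part : ∀ n → 1 ≤ n → Lim ev (seq (β n)) (seq (β (squarefullPart n))))
  (β-bound : ∀ n → 1 ≤ n → Ev ev (λ k → abs (seq (β n) k) * (1ℚ + ℕ→ℚ (a n)) ≤ℚ majorant 0<K n))
  {γ : ℕ → ℕ → ℚ} {α : ℕ → ℚ} {B : ℚ} (bα : Bdd ev α) (0≤B : B ≥0)
  (γ-bound : ∀ n → 1 ≤ n → Ev ev (λ k → abs (γ n k) ≤ℚ B))
  (γ-mean : ∀ m → 1 ≤ m → HasMean (λ n k → γ (m ℕ.* n) k) α) where

  open Series a a-pos 0<K β β-bound

  private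
    v = majorant 0<K
    coprime : ∀ n f → ℚ
    coprime n f = 𝟙 (gcd n (a f) ℕₚ.≟ 1)
    part-≥1 : ∀ n → 1 ≤ n → 1 ≤ squarefullPart n
    part-≥1 n 1≤n = ∣-≥1 1≤n (squarefullPart-∣ (squarefullPart-spec n 1≤n))

  selected : ℕ → ℕ → ℚ
  selected f n = 𝟙 ((squarefullPart n ℕₚ.≟ f) ×-dec (gcd n (a f) ℕₚ.≟ 1))

  mean-selected : ∀ f → 1 ≤ f → HasMean (λ n k → selected f n * γ n k) (λ k → κ k * g f * α k)
  mean-selected f 1≤f = case (1[a1=0] a ℕ.<? f) (squarefull? f)
    where
    Goal = HasMean (λ n k → selected f n * γ n k) (λ k → κ k * g f * α k)
    vanishing : g f ≡ 0ℚ → (∀ n → 2 ≤ n → selected f n ≡ 0ℚ) → Goal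
    vanishing g0 h = mean-cong-α (λ k → sym (trans (cong (λ t → κ k * t * α k) g0) (ring (κ k) (α k))))
      (mean-0 0≤B (λ n k 2≤n → trans (cong (_* γ n k) (h n 2≤n)) (*-zeroˡ (γ n k)))
        (map ev (λ k c → ≤-trans (subst₂ _≤ℚ_
            (sym (trans (∣p*q∣≡∣p∣*∣q∣ (selected f 1) (γ 1 k)) (cong (_* abs (γ 1 k)) (abs-≥0 (𝟙-≥0 (good 1))))))
            (*-identityˡ (abs (γ 1 k))) (*-monoʳ (0≤∣p∣ (γ 1 k)) (𝟙-≤1 (good 1)))) c) (γ-bound 1 (s≤s z≤n))))
      where
      good : ∀ n → Dec (squarefullPart n ≡ f × gcd n (a f) ≡ 1)
      good n = (squarefullPart n ℕₚ.≟ f) ×-dec (gcd n (a f) ℕₚ.≟ 1)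
      ring : ∀ x y → x * 0ℚ * y ≡ 0ℚ
      ring = solve-∀ ringℚ
    case : Dec (1[a1=0] a ℕ.< f) → Dec (Squarefull f) → Goal
    case _ (no h) = vanishing
      (trans (cong (λ t → admissible a f * (t * inv (σf f) * localFactor f (a f))) (𝟙-no (squarefull? f) h))
        (ring (admissible a f) (inv (σf f)) (localFactor f (a f))))
      (λ n 2≤n → 𝟙-no ((squarefullPart n ℕₚ.≟ f) ×-dec (gcd n (a f) ℕₚ.≟ 1)) λ (e , _) →
        h (subst Squarefull e (proj₁ (proj₂ (proj₂ (proj₂ (squarefullPart-spec n (ℕₚ.<⇒≤ 2≤n))))))))
      where
      ring : ∀ A i l → A * (0ℚ * i * l) ≡ 0ℚ
      ring = solve-∀ ringℚ
    -- Here f = 1 and a(1) = 0, so the gcd is n itself and no n ≥ 2 is selected.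
    case (no h) (yes _) = vanishing
      (𝟙-no-* (1[a1=0] a ℕ.<? f) h (fullWeight f * localFactor f (a f)))
      (λ n 2≤n → 𝟙-no ((squarefullPart n ℕₚ.≟ f) ×-dec (gcd n (a f) ℕₚ.≟ 1)) λ (_ , e) →
        ℕₚ.<⇒≢ 2≤n (sym (trans (sym (gcd-n0 n (ℕₚ.<⇒≤ 2≤n))) (subst (λ t → gcd n t ≡ 1) af≡0 e))))
      where
      gcd-n0 : ∀ n → 1 ≤ n → gcd n 0 ≡ n
      gcd-n0 n 1≤n = ∣-antisym (gcd[m,n]∣m n 0) (gcd-greatest ∣-refl (Div._∣0 n))
      f≤ : f ≤ 1[a1=0] a
      f≤ = ℕₚ.≮⇒≥ h
      af≡0 : a f ≡ 0
      af≡0 = go (a 1 ℕₚ.≟ 0)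
        where
        go : Dec (a 1 ≡ 0) → a f ≡ 0
        go (yes e) = trans (cong a (ℕₚ.≤-antisym (subst (f ≤_) (if-yes (a 1 ℕₚ.≟ 0) e) f≤) 1≤f)) e
        go (no ¬e) = contradiction (ℕₚ.≤-trans 1≤f (subst (f ≤_) (if-no (a 1 ℕₚ.≟ 0) ¬e) f≤)) λ ()
    case (yes h) (yes full) = mean-cong-α (λ k → cong (λ t → κ k * t * α k) (sym g≡))
        (mean-good bα 0≤B γ-bound γ-mean 1≤f full (admissible⇒a≥1 a a-pos f 1≤f h full) κ-bdd)
      where
      g≡ : g f ≡ density f (a f)
      g≡ = trans (cong₂ (λ x y → x * (y * inv (σf f) * localFactor f (a f))) (𝟙-yes (1[a1=0] a ℕ.<? f) h) (𝟙-yes (squarefull? f) full))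
        (ring (inv (σf f)) (localFactor f (a f)))
        where
        ring : ∀ i l → 1ℚ * (1ℚ * i * l) ≡ i * l
        ring = solve-∀ ringℚ

  truncated : ℕ → ℕ → ℕ → ℚ
  truncated F n k = ∑ (λ f → b f k * (selected f n * γ n k)) F

  mean-truncated : ∀ F → HasMean (truncated F) (λ k → κ k * ∑ (λ f → g f * b f k) F * α k)
  mean-truncated F = mean-cong-α (λ k → trans (∑-cong F λ f _ _ → ring (b f k) (κ k) (g f) (α k))
      (trans (∑-* (κ k * α k) (λ f → g f * b f k) F) (ring₂ (κ k) (α k) (∑ (λ f → g f * b f k) F))))
    (mean-∑ {λ f n k → b f k * (selected f n * γ n k)} {λ f k → b f k * (κ k * g f * α k)} F
      λ f 1≤f _ → mean-*ˡ (real-bdd (β f)) (mean-selected f 1≤f))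
    where
    ring : ∀ b κ g α → b * (κ * g * α) ≡ κ * α * (g * b)
    ring = solve-∀ ringℚ
    ring₂ : ∀ κ α s → κ * α * s ≡ κ * s * α
    ring₂ = solve-∀ ringℚ

  partTerm : ℕ → ℕ → ℚ
  partTerm n k = coprime n (squarefullPart n) * (b (squarefullPart n) k * γ n k)

  truncated-error : ∀ F n k → 1 ≤ n → partTerm n k - truncated F n k ≡ 𝟙 (F ℕ.<? squarefullPart n) * partTerm n k
  truncated-error F n k 1≤n = case (F ℕ.<? f)
    where
    f = squarefullPart n
    t = partTerm n k
    off : ∀ e → e ≢ f → b e k * (selected e n * γ n k) ≡ 0ℚ
    off e e≢f = trans (cong (λ x → b e k * (x * γ n k)) (𝟙-no ((f ℕₚ.≟ e) ×-dec (gcd n (a e) ℕₚ.≟ 1)) (λ (p , _) → e≢f (sym p)))) (ring (b e k) (γ n k))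
      where
      ring : ∀ x y → x * (0ℚ * y) ≡ 0ℚ
      ring = solve-∀ ringℚ
    case : Dec (F ℕ.< f) → t - truncated F n k ≡ 𝟙 (F ℕ.<? f) * t
    case (yes F<f) = trans (cong (λ x → t - x) (∑-0 F λ e _ e≤F → off e (ℕₚ.<⇒≢ (ℕₚ.≤-<-trans e≤F F<f))))
      (trans (ring t) (cong (_* t) (sym (𝟙-yes (F ℕ.<? f) F<f))))
      where
      ring : ∀ t → t - 0ℚ ≡ 1ℚ * t
      ring = solve-∀ ringℚ
    case (no F≮f) = trans (cong (λ x → t - x) (trans (∑-single {λ e → b e k * (selected e n * γ n k)} F f (λ e _ _ → off e) (part-≥1 n 1≤n) (ℕₚ.≮⇒≥ F≮f))
        (trans (cong (λ x → b f k * (x * γ n k)) (trans (𝟙-× (f ℕₚ.≟ f) (gcd n (a f) ℕₚ.≟ 1)) (𝟙-yes-* (f ℕₚ.≟ f) refl (coprime n f))))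
          (ring (b f k) (coprime n f) (γ n k)))))
      (trans (+-inverseʳ t) (sym (𝟙-no-* (F ℕ.<? f) F≮f t)))
      where
      ring : ∀ b c g → b * (c * g) ≡ c * (b * g)
      ring = solve-∀ ringℚ

  -- Cutting off at squarefull part F leaves a finite sum of known means. The n with larger
  -- squarefull part contribute at most Bε to the average, uniformly in N, by `majorant-tail`.
  mean-partTerm : HasMean partTerm (λ k → κ k * seq S k * α k)
  mean-partTerm = hasMean (lim (small-approx C 0≤C approx))
    where
    C = B + bd κ-bdd * bd bα
    0≤C : C ≥0
    0≤C = +-≥0 0≤B (*-≥0 (<⇒≤ (bd-pos κ-bdd)) (<⇒≤ (bd-pos bα)))
    approx : ∀ ε → 0ℚ <ℚ ε → ∃[ w ] (Small ev² w × Ev ev² (λ i →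
      abs ((avg partTerm i - κ (proj₂ i) * seq S (proj₂ i) * α (proj₂ i)) - w i) ≤ℚ C * ε))
    approx ε 0<ε = w , diff (avg-lim (mean-truncated F)) , 0 , λ N _ →
        Ev² ev (λ k (p , q) (s , (x , y)) → bound N k p q s x y)
          (zip ev (ev-all {λ n k → abs (b (squarefullPart n) k) * (1ℚ + ℕ→ℚ (a (squarefullPart n))) ≤ℚ v (squarefullPart n)}
             (λ n 1≤n → β-bound (squarefullPart n) (part-≥1 n 1≤n)) N) (ev-all γ-bound N))
          (zip ev (proj₂ S-close F (ℕₚ.m≤n⊔m F₁ (proj₁ S-close))) (zip ev (bd-ev κ-bdd) (bd-ev bα)))
      where
      tail = majorant-tail 0<K ε 0<ε
      F₁ = proj₁ tail
      S-close = at (diff S-lim) ε 0<ε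
      F = F₁ ⊔ proj₁ S-close
      P : ℕ → ℚ
      P k = ∑ (λ f → g f * b f k) F
      w : ℕ × ℕ → ℚ
      w i = avg (truncated F) i - κ (proj₂ i) * P (proj₂ i) * α (proj₂ i)
      bound : ∀ N k → (∀ n → 1 ≤ n → n ≤ N → abs (b (squarefullPart n) k) * (1ℚ + ℕ→ℚ (a (squarefullPart n))) ≤ℚ v (squarefullPart n)) →
        (∀ n → 1 ≤ n → n ≤ N → abs (γ n k) ≤ℚ B) → abs (P k - seq S k) ≤ℚ ε → abs (κ k) ≤ℚ bd κ-bdd → abs (α k) ≤ℚ bd bα →
        abs ((avg partTerm (N , k) - κ k * seq S k * α k) - w (N , k)) ≤ℚ C * ε
      bound N k β≤ γ≤ s≤ κ≤ α≤ = subst₂ _≤ℚ_ (cong abs (sym e)) (ring₂ B (bd κ-bdd) (bd bα) ε)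
          (≤-trans (∣p+q∣≤∣p∣+∣q∣ (i * ∑ d N) (κ k * α k * (P k - seq S k))) (+-mono-≤ first second))
        where
        i = inv (ℕ→ℚ N)
        d : ℕ → ℚ
        d n = partTerm n k - truncated F n k
        ring₂ : ∀ B x y ε → B * ε + x * y * ε ≡ (B + x * y) * ε
        ring₂ = solve-∀ ringℚ
        e : (avg partTerm (N , k) - κ k * seq S k * α k) - w (N , k) ≡ i * ∑ d N + κ k * α k * (P k - seq S k)
        e = trans (ring₁ i (∑ (λ n → partTerm n k) N) (∑ (λ n → truncated F n k) N) (κ k) (seq S k) (P k) (α k))
          (cong (λ t → i * t + κ k * α k * (P k - seq S k)) (sym (∑-- (λ n → partTerm n k) (λ n → truncated F n k) N)))
          where
          ring₁ : ∀ i X Y κ s p α → (i * X - κ * s * α) - (i * Y - κ * p * α) ≡ i * (X - Y) + κ * α * (p - s)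
          ring₁ = solve-∀ ringℚ
        second : abs (κ k * α k * (P k - seq S k)) ≤ℚ bd κ-bdd * bd bα * ε
        second = subst (_≤ℚ bd κ-bdd * bd bα * ε)
          (sym (trans (∣p*q∣≡∣p∣*∣q∣ (κ k * α k) (P k - seq S k)) (cong (_* abs (P k - seq S k)) (∣p*q∣≡∣p∣*∣q∣ (κ k) (α k)))))
          (*-mono (0≤∣p∣ (P k - seq S k)) (*-≥0 (<⇒≤ (bd-pos κ-bdd)) (<⇒≤ (bd-pos bα)))
            (*-mono (0≤∣p∣ (α k)) (<⇒≤ (bd-pos κ-bdd)) κ≤ α≤) s≤)
        term : ∀ n → 1 ≤ n → n ≤ N → abs (d n) ≤ℚ B * (𝟙 (F₁ ℕ.<? squarefullPart n) * v (squarefullPart n))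
        term n 1≤n n≤N = subst₂ _≤ℚ_ (sym e′) (ring t (v f) B)
            (*-mono (*-≥0 0≤c (*-≥0 (0≤∣p∣ (b f k)) (0≤∣p∣ (γ n k)))) (𝟙-≥0 (F₁ ℕ.<? f)) 𝟙≤
              (*-mono (*-≥0 (0≤∣p∣ (b f k)) (0≤∣p∣ (γ n k))) 0≤1 (𝟙-≤1 (gcd n (a f) ℕₚ.≟ 1))
                (*-mono (0≤∣p∣ (γ n k)) (majorant-≥0 0<K f) (b≤v f k (β≤ n 1≤n n≤N)) (γ≤ n 1≤n n≤N))))
          where
          f = squarefullPart n
          t = 𝟙 (F₁ ℕ.<? f)
          c = coprime n f
          0≤c : c ≥0
          0≤c = 𝟙-≥0 (gcd n (a f) ℕₚ.≟ 1)
          ring : ∀ t v B → t * (1ℚ * (v * B)) ≡ B * (t * v)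
          ring = solve-∀ ringℚ
          e′ : abs (d n) ≡ 𝟙 (F ℕ.<? f) * (c * (abs (b f k) * abs (γ n k)))
          e′ = trans (cong abs (truncated-error F n k 1≤n)) (trans (∣p*q∣≡∣p∣*∣q∣ (𝟙 (F ℕ.<? f)) (partTerm n k))
            (cong₂ _*_ (abs-≥0 (𝟙-≥0 (F ℕ.<? f))) (trans (∣p*q∣≡∣p∣*∣q∣ c (b f k * γ n k)) (cong₂ _*_ (abs-≥0 0≤c) (∣p*q∣≡∣p∣*∣q∣ (b f k) (γ n k))))))
          𝟙≤ : 𝟙 (F ℕ.<? f) ≤ℚ t
          𝟙≤ = case (F ℕ.<? f)
            where
            case : Dec (F ℕ.< f) → 𝟙 (F ℕ.<? f) ≤ℚ t
            case (yes F<f) = ≤-reflexive (trans (𝟙-yes (F ℕ.<? f) F<f) (sym (𝟙-yes (F₁ ℕ.<? f) (ℕₚ.≤-<-trans (ℕₚ.m≤m⊔n F₁ (proj₁ S-close)) F<f))))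
            case (no F≮f)  = subst (_≤ℚ t) (sym (𝟙-no (F ℕ.<? f) F≮f)) (𝟙-≥0 (F₁ ℕ.<? f))
        first : abs (i * ∑ d N) ≤ℚ B * ε
        first = ≤-trans (avg-abs N term) (avg-∑-≤ N (*-≥0 0≤B (<⇒≤ 0<ε))
          (subst₂ _≤ℚ_ (sym (∑-* B (λ n → 𝟙 (F₁ ℕ.<? squarefullPart n) * v (squarefullPart n)) N)) (*-swap B (ℕ→ℚ N) ε) (*-monoˡ 0≤B (proj₂ tail N))))

  mean-product : HasMean (λ n k → 𝟙 (gcd n (a n) ℕₚ.≟ 1) * (b n k * γ n k)) (λ k → κ k * seq S k * α k)
  mean-product = mean-approx (λ n 1≤n → lim-*ˡ (bdd-const (coprime n n)) (lim-* (real-bdd (β n)) (bdd B′ 0<B′ (map ev (λ k h → ≤-trans h B≤B′) (γ-bound n 1≤n)))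
        (β-part n 1≤n) lim-refl))
      (mean-cong (λ n k 1≤n → cong (λ t → 𝟙 (gcd n t ℕₚ.≟ 1) * (b (squarefullPart n) k * γ n k)) (sym (a-part n 1≤n))) mean-partTerm)
    where
    B′ = 1ℚ + B
    0<B′ : 0ℚ <ℚ B′
    0<B′ = +-pos 0<1 0≤B
    B≤B′ : B ≤ℚ B′
    B≤B′ = ≤-+ˡ {B} 0≤1

-- Complex functions

1+^ℚ : ∀ {q} → q ≥0 → ∀ l → q ^ℚ suc l + 1ℚ ≤ℚ (q + 1ℚ) ^ℚ suc l
1+^ℚ {q} 0≤q zero    = ≤-reflexive (ring q)
  where
  ring : ∀ q → q * 1ℚ + 1ℚ ≡ (q + 1ℚ) * 1ℚ
  ring = solve-∀ ringℚ
1+^ℚ {q} 0≤q (suc l) = ≤-trans (0≤-⇒≤ (subst (0ℚ ≤ℚ_) (ring q (q ^ℚ suc l)) (+-≥0 0≤q (^ℚ-≥0 0≤q (suc l)))))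
    (*-monoˡ {q + 1ℚ} (+-≥0 0≤q 0≤1) (1+^ℚ 0≤q l))
  where
  ring : ∀ q x → q + x ≡ (q + 1ℚ) * (x + 1ℚ) - (q * x + 1ℚ)
  ring = solve-∀ ringℚ

^ℚ-pos : ∀ {x} → 0ℚ <ℚ x → ∀ k → 0ℚ <ℚ x ^ℚ k
^ℚ-pos 0<x zero    = 0<1
^ℚ-pos 0<x (suc k) = *-pos 0<x (^ℚ-pos 0<x k)

^ℚ-cancel-≤ : ∀ {x y} l → 0ℚ <ℚ y → x ^ℚ suc l ≤ℚ y ^ℚ suc l → x ≤ℚ y
^ℚ-cancel-≤ {x} {y} l 0<y h = ℚₚ.≮⇒≥ λ y<x → ℚₚ.<-irrefl refl (<-≤-trans
  (<-≤-trans (ℚₚ.*-monoˡ-<-pos (y ^ℚ l) {{ℚ.positive (^ℚ-pos 0<y l)}} y<x)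
    (*-monoˡ {x} (<⇒≤ (ℚₚ.<-trans 0<y y<x)) (^ℚ-mono (<⇒≤ 0<y) (<⇒≤ y<x) l))) h)

-- An inequality of reals reaches the approximations only with some slack, here taken to be 1. It
-- survives the extraction of a root because q^m + 1 ≤ (q + 1)^m for m ≥ 1.
root-≤ : ∀ {x q} l → q ≥0 → x ^ℚ suc l ≤ℚ q ^ℚ suc l + 1ℚ → x ≤ℚ q + 1ℚ
root-≤ {x} {q} l 0≤q h = ^ℚ-cancel-≤ l (subst (0ℚ <ℚ_) (+-comm 1ℚ q) (+-pos 0<1 0≤q)) (≤-trans h (1+^ℚ 0≤q l))

abs² : ∀ x → abs x * abs x ≡ x * x
abs² x = trans (sym (∣p*q∣≡∣p∣*∣q∣ x x)) (abs-≥0 (square-≥0 (ℚₚ.≤-total 0ℚ x)))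
  where
  ring : ∀ x → (- x) * (- x) ≡ x * x
  ring = solve-∀ ringℚ
  square-≥0 : 0ℚ ≤ℚ x ⊎ x ≤ℚ 0ℚ → x * x ≥0
  square-≥0 (inj₁ h) = *-≥0 h h
  square-≥0 (inj₂ h) = subst (0ℚ ≤ℚ_) (ring x) (*-≥0 (neg-antimono-≤ h) (neg-antimono-≤ h))

x²-≥0 : ∀ x → x * x ≥0
x²-≥0 x = subst (0ℚ ≤ℚ_) (abs² x) (*-≥0 (0≤∣p∣ x) (0≤∣p∣ x))

x*x≡^2 : ∀ x → x * x ≡ x ^ℚ 2
x*x≡^2 x = cong (x *_) (sym (*-identityʳ x))

abs-from-norm : ∀ {x y t} → t ≥0 → x * x + y * y ≤ℚ t * t + 1ℚ → abs x ≤ℚ t + 1ℚ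
abs-from-norm {x} {y} {t} 0≤t h = root-≤ 1 0≤t (subst₂ _≤ℚ_ (trans (sym (abs² x)) (x*x≡^2 (abs x))) (cong (_+ 1ℚ) (x*x≡^2 t))
  (≤-trans (≤-+ʳ (x²-≥0 y)) h))

-- The norm controls either coordinate, so one argument serves the real and the imaginary part.
module Part (part : ℂ → ℝ)
  (part-norm : ∀ z {t} → t ≥0 → Ev ev (λ k → seq ∣ z ∣² k ≤ℚ t * t + 1ℚ) → Ev ev (λ k → abs (seq (part z) k) ≤ℚ t + 1ℚ)) where

  subpolynomial-bound : ∀ {z : ℕ → ℂ} → Subpolynomial z →
    ∃[ C ] (C ≥0 × (∀ n → 1 ≤ n → Ev ev (λ k → abs (seq (part (z n)) k) ≤ℚ (C + 1ℚ) * growth n)))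
  subpolynomial-bound {z} sub = C , 0≤C , bound
    where
    -- The exponent 1/16 is the one for which `growth` was designed: its 16th power dominates n.
    C = proj₁ (sub 1 16 (s≤s z≤n) (s≤s z≤n))
    0≤C = proj₁ (proj₂ (sub 1 16 (s≤s z≤n) (s≤s z≤n)))
    bound : ∀ n → 1 ≤ n → Ev ev (λ k → abs (seq (part (z n)) k) ≤ℚ (C + 1ℚ) * growth n)
    bound n 1≤n = map ev (λ k h → ≤-trans h last)
        (part-norm (z n) 0≤Cg (map ev (λ k h → root-≤ 15 (*-≥0 0≤Cg 0≤Cg)
          (≤-trans (≤-reflexive (sym (seq-^ ∣ z n ∣² 16 k))) (≤-trans h (+-monoˡ-≤ 1ℚ power))))
          (proj₂ (proj₂ (sub 1 16 (s≤s z≤n) (s≤s z≤n))) n 1≤n 1ℚ 0<1)))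
      where
      G = growth n
      0≤G : G ≥0
      0≤G = ≤-trans 0≤1 (growth-≥1 n)
      Cg = C * G
      0≤Cg : Cg ≥0
      0≤Cg = *-≥0 0≤C 0≤G
      seq-^ : ∀ x l k → seq (x ^ᴿ l) k ≡ seq x k ^ℚ l
      seq-^ x zero    k = refl
      seq-^ x (suc l) k = cong (seq x k *_) (seq-^ x l k)
      power : (C ^ℚ 16 * ℕ→ℚ n ^ℚ 1) ^ℚ 2 ≤ℚ (Cg * Cg) ^ℚ 16
      power = subst₂ _≤ℚ_ refl (trans (sym (x*x≡^2 (Cg ^ℚ 16))) (sym (*-^ℚ Cg Cg 16)))
        (^ℚ-mono (*-≥0 (^ℚ-≥0 0≤C 16) (^ℚ-≥0 (ℕ→ℚ-≥0 n) 1))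
          (subst (C ^ℚ 16 * ℕ→ℚ n ^ℚ 1 ≤ℚ_) (sym (*-^ℚ C G 16))
            (*-monoˡ (^ℚ-≥0 0≤C 16) (subst (_≤ℚ G ^ℚ 16) (sym (*-identityʳ (ℕ→ℚ n))) (growth-16 n)))) 2)
      last : Cg + 1ℚ ≤ℚ (C + 1ℚ) * G
      last = subst (Cg + 1ℚ ≤ℚ_) (ring C G) (+-monoʳ-≤ Cg (growth-≥1 n))
        where
        ring : ∀ C G → C * G + G ≡ (C + 1ℚ) * G
        ring = solve-∀ ringℚ

  bounded-part : ∀ {z M} → ∣ z ∣≤ M → Ev ev (λ k → abs (seq (part z) k) ≤ℚ M + 1ℚ)
  bounded-part {z} (0≤M , h) = part-norm z 0≤M (h 1ℚ 0<1)

module Re = Part re (λ z {t} 0≤t → map ev λ k → abs-from-norm {seq (re z) k} {seq (im z) k} 0≤t)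
module Im = Part im (λ z {t} 0≤t → map ev λ k h → abs-from-norm {seq (im z) k} {seq (re z) k} 0≤t
  (subst (_≤ℚ t * t + 1ℚ) (+-comm (seq (re z) k * seq (re z) k) (seq (im z) k * seq (im z) k)) h))

abs-from-sum : ∀ {x y t} → 0ℚ <ℚ t → x * x + y * y ≤ℚ t * t + t * t → abs x ≤ℚ 2ℚ * t
abs-from-sum {x} {y} {t} 0<t h = ^ℚ-cancel-≤ 1 (*-pos {2ℚ} (positive⁻¹ 2ℚ) 0<t)
  (subst₂ _≤ℚ_ (trans (sym (abs² x)) (x*x≡^2 (abs x))) (trans (ring t) (x*x≡^2 (2ℚ * t)))
    (≤-trans (≤-+ʳ (x²-≥0 y)) (≤-trans h (≤-+ʳ {t * t + t * t} (+-≥0 (x²-≥0 t) (x²-≥0 t))))))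
  where
  ring : ∀ t → (t * t + t * t) + (t * t + t * t) ≡ 2ℚ * t * (2ℚ * t)
  ring = solve-∀ ringℚ

module _ {z : ℕ → ℂ} {L : ℂ} where

  ⟶-re : z ⟶ L → Lim ev² (λ (N , k) → seq (re (z N)) k) (λ (N , k) → seq (re L) k)
  ⟶-re h = lim (small-scale 2ℚ (positive⁻¹ 2ℚ) λ ε 0<ε → let N , g = h ε 0<ε in
    N , λ n p → map ev (λ k q → abs-from-sum {seq (re (z n)) k - seq (re L) k} {seq (im (z n)) k - seq (im L) k} 0<ε q) (proj₂ (g n p) (ε * ε) (*-pos 0<ε 0<ε)))

  ⟶-im : z ⟶ L → Lim ev² (λ (N , k) → seq (im (z N)) k) (λ (N , k) → seq (im L) k)
  ⟶-im h = lim (small-scale 2ℚ (positive⁻¹ 2ℚ) λ ε 0<ε → let N , g = h ε 0<ε in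
    N , λ n p → map ev (λ k q → abs-from-sum {seq (im (z n)) k - seq (im L) k} {seq (re (z n)) k - seq (re L) k} 0<ε
        (subst (_≤ℚ ε * ε + ε * ε) (+-comm ((seq (re (z n)) k - seq (re L) k) * (seq (re (z n)) k - seq (re L) k))
          ((seq (im (z n)) k - seq (im L) k) * (seq (im (z n)) k - seq (im L) k))) q))
      (proj₂ (g n p) (ε * ε) (*-pos 0<ε 0<ε)))

  ⟶-from-parts : Lim ev² (λ (N , k) → seq (re (z N)) k) (λ (N , k) → seq (re L) k) →
                 Lim ev² (λ (N , k) → seq (im (z N)) k) (λ (N , k) → seq (im L) k) → z ⟶ L
  ⟶-from-parts r i ε 0<ε = let N , g = zip ev² (at (diff r) η 0<η) (at (diff i) η 0<η) in
    N , λ n p → <⇒≤ 0<ε , λ δ 0<δ → map ev (λ k (x , y) → bound δ 0<δ x y) (g n p)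
    where
    η = inv 2ℚ * ε
    0<η : 0ℚ <ℚ η
    0<η = *-pos {inv 2ℚ} (inv-pos {2ℚ} (positive⁻¹ 2ℚ)) 0<ε
    square : ∀ {x} → abs x ≤ℚ η → x * x ≤ℚ η * η
    square {x} h = subst (_≤ℚ η * η) (abs² x) (*-mono (0≤∣p∣ x) (<⇒≤ 0<η) h h)
    bound : ∀ δ → 0ℚ <ℚ δ → ∀ {x y} → abs x ≤ℚ η → abs y ≤ℚ η → x * x + y * y ≤ℚ ε * ε + δ
    bound δ 0<δ {x} {y} hx hy = ≤-trans (+-mono-≤ (square hx) (square hy)) (≤-trans
      (subst₂ _≤ℚ_ refl (trans (ring η) (cong₂ _*_ (*-scale {2ℚ} (positive⁻¹ 2ℚ) ε) (*-scale {2ℚ} (positive⁻¹ 2ℚ) ε)))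
        (≤-+ʳ {η * η + η * η} {η * η + η * η} (+-≥0 (x²-≥0 η) (x²-≥0 η))))
      (≤-+ʳ {ε * ε} {δ} (<⇒≤ 0<δ)))
      where
      ring : ∀ t → (t * t + t * t) + (t * t + t * t) ≡ 2ℚ * t * (2ℚ * t)
      ring = solve-∀ ringℚ

seq-re-sumTo : ∀ u N k → seq (re (sumTo u N)) k ≡ ∑ (λ n → seq (re (u n)) k) N
seq-re-sumTo u zero    k = refl
seq-re-sumTo u (suc N) k = cong (_+ seq (re (u (suc N))) k) (seq-re-sumTo u N k)

seq-im-sumTo : ∀ u N k → seq (im (sumTo u N)) k ≡ ∑ (λ n → seq (im (u n)) k) N
seq-im-sumTo u zero    k = refl
seq-im-sumTo u (suc N) k = cong (_+ seq (im (u (suc N))) k) (seq-im-sumTo u N k)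

mean⟶⇒HasMean-re : ∀ {u A} → mean u ⟶ A → HasMean (λ n → seq (re (u n))) (seq (re A))
mean⟶⇒HasMean-re {u} {A} h = hasMean (lim-cong (λ (N , k) → cong (inv (ℕ→ℚ N) *_) (seq-re-sumTo u N k)) (λ _ → refl) (⟶-re {mean u} {A} h))

mean⟶⇒HasMean-im : ∀ {u A} → mean u ⟶ A → HasMean (λ n → seq (im (u n))) (seq (im A))
mean⟶⇒HasMean-im {u} {A} h = hasMean (lim-cong (λ (N , k) → cong (inv (ℕ→ℚ N) *_) (seq-im-sumTo u N k)) (λ _ → refl) (⟶-im {mean u} {A} h))

HasMean⇒mean⟶ : ∀ {u A} → HasMean (λ n → seq (re (u n))) (seq (re A)) → HasMean (λ n → seq (im (u n))) (seq (im A)) → mean u ⟶ A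
HasMean⇒mean⟶ {u} {A} (hasMean r) (hasMean i) = ⟶-from-parts {mean u} {A}
  (lim-cong (λ (N , k) → cong (inv (ℕ→ℚ N) *_) (sym (seq-re-sumTo u N k))) (λ _ → refl) r)
  (lim-cong (λ (N , k) → cong (inv (ℕ→ℚ N) *_) (sym (seq-im-sumTo u N k))) (λ _ → refl) i)

sumsTo-from-parts : ∀ {u S} → Lim ev² (λ (N , k) → ∑ (λ n → seq (re (u n)) k) N) (λ (N , k) → seq (re S) k) →
  Lim ev² (λ (N , k) → ∑ (λ n → seq (im (u n)) k) N) (λ (N , k) → seq (im S) k) → u sumsTo S
sumsTo-from-parts {u} {S} r i = ⟶-from-parts {sumTo u} {S}
  (lim-cong (λ (N , k) → sym (seq-re-sumTo u N k)) (λ _ → refl) r)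
  (lim-cong (λ (N , k) → sym (seq-im-sumTo u N k)) (λ _ → refl) i)

seq-re-when : ∀ {P : Set} z (P? : Dec P) k → seq (re (z when P?)) k ≡ 𝟙 P? * seq (re z) k
seq-re-when z (yes _) k = sym (*-identityˡ (seq (re z) k))
seq-re-when z (no _)  k = sym (*-zeroˡ (seq (re z) k))

seq-im-when : ∀ {P : Set} z (P? : Dec P) k → seq (im (z when P?)) k ≡ 𝟙 P? * seq (im z) k
seq-im-when z (yes _) k = sym (*-identityˡ (seq (im z) k))
seq-im-when z (no _)  k = sym (*-zeroˡ (seq (im z) k))

seq-re-weighted : ∀ {P : Set} w z (P? : Dec P) k → 𝟙 P? * w * seq (re z) k ≡ seq (re (ℚ→ℝ w • z when P?)) k
seq-re-weighted w z P? k = trans (*-assoc (𝟙 P?) w (seq (re z) k)) (sym (seq-re-when (ℚ→ℝ w • z) P? k))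

seq-im-weighted : ∀ {P : Set} w z (P? : Dec P) k → 𝟙 P? * w * seq (im z) k ≡ seq (im (ℚ→ℝ w • z when P?)) k
seq-im-weighted w z P? k = trans (*-assoc (𝟙 P?) w (seq (im z) k)) (sym (seq-im-when (ℚ→ℝ w • z) P? k))

≃ᴿ⇒lim : ∀ {x y} → x ≃ᴿ y → Lim ev (seq x) (seq y)
≃ᴿ⇒lim h = lim (small h)

≃ᴿ-refl : ∀ x → x ≃ᴿ x
≃ᴿ-refl x ε 0<ε = at (diff (lim-refl {F = ev} {u = seq x})) ε 0<ε

-- This recovers a(n) = a(f) as natural numbers from their equality as complex numbers, which is
-- needed because a(n) enters a gcd.
ℕ→ℚ-separated : ∀ {m n} → abs (ℕ→ℚ m - ℕ→ℚ n) ≤ℚ inv 2ℚ → m ≡ n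
ℕ→ℚ-separated {m} {n} h = ℕₚ.≤-antisym (half h) (half (subst (_≤ℚ inv 2ℚ) (abs-sym (ℕ→ℚ m) (ℕ→ℚ n)) h))
  where
  half : ∀ {m n} → abs (ℕ→ℚ m - ℕ→ℚ n) ≤ℚ inv 2ℚ → m ≤ n
  half {m} {n} h = ℕₚ.≮⇒≥ λ n<m → ℚₚ.<-irrefl refl (<-≤-trans (<-≤-trans half<1
      (0≤-⇒≤ {1ℚ} {ℕ→ℚ m - ℕ→ℚ n} (subst (0ℚ ≤ℚ_) (ring (ℕ→ℚ m) (ℕ→ℚ n)) (≤⇒0≤- (subst (_≤ℚ ℕ→ℚ m) (ℕ→ℚ-suc n) (ℕ→ℚ-mono n<m))))))
    (≤-trans (≤-abs (ℕ→ℚ m - ℕ→ℚ n)) h))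
    where
    half<1 : inv 2ℚ <ℚ 1ℚ
    half<1 = ℚ.*<* (ℤ.+<+ (s≤s (s≤s z≤n)))
    ring : ∀ m n → m - (n + 1ℚ) ≡ (m - n) - 1ℚ
    ring = solve-∀ ringℚ

-- The theorem from its real and imaginary parts

module _ (a : ℕ → ℕ) (b c : ℕ → ℂ) (A : ℂ) (sa : IsSFunction (λ n → ℕ→ℂ (a n))) (sb : IsSFunction b)
         (a-pos : ∀ n → 1 ≤ n → ¬ Squarefree n → 1 ≤ a n) (bounded : Bounded c) (average : HasInvariantAverage c A) where

  private
    M = proj₁ bounded
    B = M + 1ℚ
    0≤B : B ≥0
    0≤B = +-≥0 (proj₁ (proj₂ bounded 1 (s≤s z≤n))) 0≤1

    a-part : ∀ n → 1 ≤ n → a n ≡ a (squarefullPart n)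
    a-part n 1≤n = ℕ→ℚ-separated (proj₂ (ev-witness
      (proj₁ (proj₁ sa n (squarefullPart n) 1≤n (squarefullPart-spec n 1≤n)) (inv 2ℚ) (inv-pos {2ℚ} (positive⁻¹ 2ℚ)))))

    boundA = Re.subpolynomial-bound {λ n → ℕ→ℂ (a n)} (proj₂ sa)
    Cₐ = proj₁ boundA
    0≤Cₐ = proj₁ (proj₂ boundA)

    0<C+1 : ∀ {C} → C ≥0 → 0ℚ <ℚ C + 1ℚ
    0<C+1 {C} 0≤C = subst (0ℚ <ℚ_) (+-comm 1ℚ C) (+-pos 0<1 0≤C)

    product-bound : ∀ {C} → C ≥0 → ∀ n → 1 ≤ n → ∀ {x} → abs x ≤ℚ (C + 1ℚ) * growth n →
                    abs x * (1ℚ + ℕ→ℚ (a n)) ≤ℚ (C + 1ℚ) * ((Cₐ + 1ℚ) + 1ℚ) * (growth n * growth n)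
    product-bound {C} 0≤C n 1≤n {x} h = subst (abs x * (1ℚ + ℕ→ℚ (a n)) ≤ℚ_) (ring (C + 1ℚ) (Cₐ + 1ℚ) (growth n))
        (*-mono (+-≥0 {1ℚ} 0≤1 (ℕ→ℚ-≥0 (a n))) (*-≥0 (<⇒≤ (0<C+1 0≤C)) (≤-trans 0≤1 (growth-≥1 n))) h 1+a≤)
      where
      ring : ∀ c d g → c * g * (g + d * g) ≡ c * (d + 1ℚ) * (g * g)
      ring = solve-∀ ringℚ
      1+a≤ : 1ℚ + ℕ→ℚ (a n) ≤ℚ growth n + (Cₐ + 1ℚ) * growth n
      1+a≤ = +-mono-≤ (growth-≥1 n) (≤-trans (≤-abs (ℕ→ℚ (a n))) (proj₂ (ev-witness (proj₂ (proj₂ boundA) n 1≤n))))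

    0<K : ∀ {C} → C ≥0 → 0ℚ <ℚ (C + 1ℚ) * ((Cₐ + 1ℚ) + 1ℚ)
    0<K 0≤C = *-pos (0<C+1 0≤C) (0<C+1 (<⇒≤ (0<C+1 0≤Cₐ)))

    boundRe = Re.subpolynomial-bound {b} (proj₂ sb)
    boundIm = Im.subpolynomial-bound {b} (proj₂ sb)
    0≤Cr = proj₁ (proj₂ boundRe)
    0≤Ci = proj₁ (proj₂ boundIm)

    βr βi : ℕ → ℝ
    βr n = re (b n)
    βi n = im (b n)
    βr-bound : ∀ n → 1 ≤ n → Ev ev (λ k → abs (seq (βr n) k) * (1ℚ + ℕ→ℚ (a n)) ≤ℚ majorant (0<K 0≤Cr) n)
    βr-bound n 1≤n = map ev (λ k → product-bound {proj₁ boundRe} 0≤Cr n 1≤n {seq (βr n) k}) (proj₂ (proj₂ boundRe) n 1≤n)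
    βi-bound : ∀ n → 1 ≤ n → Ev ev (λ k → abs (seq (βi n) k) * (1ℚ + ℕ→ℚ (a n)) ≤ℚ majorant (0<K 0≤Ci) n)
    βi-bound n 1≤n = map ev (λ k → product-bound {proj₁ boundIm} 0≤Ci n 1≤n {seq (βi n) k}) (proj₂ (proj₂ boundIm) n 1≤n)

    module Sr = Series a a-pos (0<K 0≤Cr) βr βr-bound
    module Si = Series a a-pos (0<K 0≤Ci) βi βi-bound

    S ρ : ℂ
    S = Sr.S +i Si.S
    ρ = 6/π² • S

    inner : ℕ → ℂ
    inner d = Sr.inner d +i Si.inner d

    innerTerm-re : ∀ d f k → Sr.innerCoefficient d f * seq (re (b f)) k ≡ seq (re (innerTerm a b d f)) k
    innerTerm-re d f k = seq-re-weighted (ℕ→ℚ (gcd d f) * inv (σf f) * ∏[1+1/p] (gcd d f)) (b f)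
      (1[a1=0] a ℕ.<? f ×-dec squarefull? f ×-dec d ∣? a f) k

    innerTerm-im : ∀ d f k → Si.innerCoefficient d f * seq (im (b f)) k ≡ seq (im (innerTerm a b d f)) k
    innerTerm-im d f k = seq-im-weighted (ℕ→ℚ (gcd d f) * inv (σf f) * ∏[1+1/p] (gcd d f)) (b f)
      (1[a1=0] a ℕ.<? f ×-dec squarefull? f ×-dec d ∣? a f) k

    inner-converges : ∀ d → 1 ≤ d → innerTerm a b d sumsTo inner d
    inner-converges d 1≤d = sumsTo-from-parts {innerTerm a b d} {inner d}
      (lim-cong (λ (F , k) → ∑-cong F λ f _ _ → innerTerm-re d f k) (λ _ → refl) (Sr.inner-lim d 1≤d))
      (lim-cong (λ (F , k) → ∑-cong F λ f _ _ → innerTerm-im d f k) (λ _ → refl) (Si.inner-lim d 1≤d))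

    outer-converges : outerTerm inner sumsTo S
    outer-converges = sumsTo-from-parts {outerTerm inner} {S} Sr.outer-lim Si.outer-lim

    isRho : IsRho a b ρ
    isRho = inner , S , inner-converges , outer-converges , ≃ᴿ-refl (re ρ) , ≃ᴿ-refl (im ρ)

    γr-bound : ∀ n → 1 ≤ n → Ev ev (λ k → abs (seq (re (c n)) k) ≤ℚ B)
    γi-bound : ∀ n → 1 ≤ n → Ev ev (λ k → abs (seq (im (c n)) k) ≤ℚ B)
    γr-mean : ∀ d → 1 ≤ d → HasMean (λ n k → seq (re (c (d ℕ.* n))) k) (seq (re A))
    γi-mean : ∀ d → 1 ≤ d → HasMean (λ n k → seq (im (c (d ℕ.* n))) k) (seq (im A))
    γr-bound = λ n 1≤n → Re.bounded-part {c n} {M} (proj₂ bounded n 1≤n)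
    γi-bound = λ n 1≤n → Im.bounded-part {c n} {M} (proj₂ bounded n 1≤n)
    γr-mean = λ d 1≤d → mean⟶⇒HasMean-re {λ n → c (d ℕ.* n)} {A} (proj₂ average d 1≤d)
    γi-mean = λ d 1≤d → mean⟶⇒HasMean-im {λ n → c (d ℕ.* n)} {A} (proj₂ average d 1≤d)

    βr-part : ∀ n → 1 ≤ n → Lim ev (seq (βr n)) (seq (βr (squarefullPart n)))
    βr-part n 1≤n = ≃ᴿ⇒lim {βr n} {βr (squarefullPart n)} (proj₁ (proj₁ sb n (squarefullPart n) 1≤n (squarefullPart-spec n 1≤n)))
    βi-part : ∀ n → 1 ≤ n → Lim ev (seq (βi n)) (seq (βi (squarefullPart n)))
    βi-part n 1≤n = ≃ᴿ⇒lim {βi n} {βi (squarefullPart n)} (proj₂ (proj₁ sb n (squarefullPart n) 1≤n (squarefullPart-spec n 1≤n)))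

    module MR {γ : ℕ → ℕ → ℚ} {α : ℕ → ℚ} = MeanValue a a-pos a-part (0<K 0≤Cr) βr βr-part βr-bound {γ} {α} {B}
    module MI {γ : ℕ → ℕ → ℚ} {α : ℕ → ℚ} = MeanValue a a-pos a-part (0<K 0≤Ci) βi βi-part βi-bound {γ} {α} {B}

    γr γi : ℕ → ℕ → ℚ
    γr n = seq (re (c n))
    γi n = seq (im (c n))

    indicator : ℕ → ℚ
    indicator n = 𝟙 (gcd n (a n) ≟ 1)

    -- Expanding the complex product gives four real mean values, one for each choice of a part of b
    -- and a part of c. Their limits recombine to the two parts of ρA.
    limit : mean (λ n → b n *ᶜ c n when (gcd n (a n) ≟ 1)) ⟶ ρ *ᶜ A
    limit = HasMean⇒mean⟶ {λ n → b n *ᶜ c n when (gcd n (a n) ≟ 1)} {ρ *ᶜ A}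
        (mean-cong (λ n k _ → trans (ring (indicator n) (seq (βr n) k) (seq (re (c n)) k) (seq (βi n) k) (seq (im (c n)) k))
            (sym (seq-re-when (b n *ᶜ c n) (gcd n (a n) ≟ 1) k)))
          (mean-+ (MR.mean-product {γr} {seq (re A)} (real-bdd (re A)) 0≤B γr-bound γr-mean)
                  (mean-neg (MI.mean-product {γi} {seq (im A)} (real-bdd (im A)) 0≤B γi-bound γi-mean))))
        (mean-cong (λ n k _ → trans (sym (*-distribˡ-+ (indicator n) (seq (βr n) k * seq (im (c n)) k) (seq (βi n) k * seq (re (c n)) k)))
            (sym (seq-im-when (b n *ᶜ c n) (gcd n (a n) ≟ 1) k)))
          (mean-+ (MR.mean-product {γi} {seq (im A)} (real-bdd (im A)) 0≤B γi-bound γi-mean)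
                  (MI.mean-product {γr} {seq (re A)} (real-bdd (re A)) 0≤B γr-bound γr-mean)))
      where
      ring : ∀ t x y z w → t * (x * y) + - (t * (z * w)) ≡ t * (x * y + - (z * w))
      ring = solve-∀ ringℚ

  meanValue : ∃[ ρ ] (IsRho a b ρ × (mean (λ n → b n *ᶜ c n when (gcd n (a n) ≟ 1)) ⟶ ρ *ᶜ A))
  meanValue = ρ , isRho , limit

theorem4p1 : (a : ℕ → ℕ) (b c : ℕ → ℂ) (A : ℂ) →
    IsSFunction (λ n → ℕ→ℂ (a n)) →
    IsSFunction b →
    (∀ n → 1 ≤ n → ¬ Squarefree n → 1 ≤ a n) →
    Bounded c →
    HasInvariantAverage c A →
    ∃[ ρ ] (IsRho a b ρ × (mean (λ n → b n *ᶜ c n when (gcd n (a n) ≟ 1)) ⟶ ρ *ᶜ A))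
theorem4p1 = meanValue
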